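{- Let $r\ge1$ be a fixed integer and let $\Pi=(\Pi_1,\dots,\Pi_\ell)$ be an $[r]$-pattern in which every color of $[r]$ appears. Consider the randomly $[r]$-colored directed random graph process $D_0^r,D_1^r,\dots,D_{N'}^r$ on $[n]$ with $\ell\mid n$. Let $\overrightarrow{\tau}_{\Pi-connected}$ be the least $i$ such that $D_i^r$ is $\Pi$-connected, and $\overrightarrow{\tau}_1$ the least $i$ such that every vertex of $D_i$ has in-degree at least $1$ and out-degree at least $1$. Then with high probability $\overrightarrow{\tau}_{\Pi-connected}=\overrightarrow{\tau}_1$.
   Context: The colored directed random graph process: let $N'=n(n-1)$. $D_0$ is the empty digraph on $[n]$, and for $i\in[N']$, $D_i$ is obtained from $D_{i-1}$ by adding an arc chosen uniformly at random among the arcs not in $D_{i-1}$; independently it receives a color chosen uniformly at random from $[r]$; $D_i^r$ is $D_i$ with these colors. An $[r]$-pattern is a finite sequence $\Pi=(\Pi_1,\dots,\Pi_\ell)$ with entries in $[r]$, indices taken cyclically. A directed path with consecutive arcs $f_1,\dots,f_k$ is $\Pi$-colored if there is $0\le l\le\ell-1$ such that $f_j$ has color $\Pi_{j+l}$ for all $j\in[k]$. The colored digraph is $\Pi$-connected if for every ordered pair of distinct vertices $(u,v)$ there is a $\Pi$-colored directed path from $u$ to $v$ (the directed analog of $\Pi$-connectivity, with strong connectivity replacing connectivity). "With high probability" means with probability tending to $1$ as $n\to\infty$. -}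

module Defs where

open import Data.Nat using (ℕ; zero; suc; _+_; _*_; _∸_; _^_; _≤_; _<_; NonZero)
open import Data.Nat.DivMod using (_mod_)
open import Data.Fin using (Fin; toℕ; inject₁) renaming (zero to fzero; suc to fsuc)
open import Data.Vec using (Vec; lookup; head; last)
open import Data.Product using (_×_; _,_; ∃; ∃-syntax; Σ)
open import Relation.Binary.PropositionalEquality using (_≡_; _≢_)
open import Relation.Nullary using (¬_)

Arc : ℕ → Set
Arc n = Fin n × Fin n

-- N' = n(n-1), the number of possible arcs (loops excluded).
N′ : ℕ → ℕ
N′ n = n * (n ∸ 1)

-- A sample point of the colored directed random graph process:
-- the sequence of arcs in the order they are added (σ j is the arc added
-- at step j+1) and the color of the arc added at each step
-- (colors Fin r standing for [r]).
Outcome : ℕ → ℕ → Set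
Outcome n r = Vec (Arc n) (N′ n) × Vec (Fin r) (N′ n)

-- Valid sample points: every entry is a genuine arc (no loops) and no arc
-- is repeated; so σ enumerates all n(n-1) arcs.  The uniform process
-- (uniform new arc at each step, independent uniform colors) is exactly the
-- uniform distribution on the N'! · r^N' valid sample points.
Valid : ∀ {n r} → Outcome n r → Set
Valid {n} (σ , _) =
  (∀ j → Data.Product.proj₁ (lookup σ j) ≢ Data.Product.proj₂ (lookup σ j)) ×
  (∀ j k → lookup σ j ≡ lookup σ k → j ≡ k)

ArcIn : ∀ {n r} → Outcome n r → ℕ → Fin n → Fin n → Fin r → Set
ArcIn {n} (σ , col) i u v c =
  ∃[ j ] (toℕ j < i × lookup σ j ≡ (u , v) × lookup col j ≡ c)

PiPath : ∀ {n r ℓ} .{{_ : NonZero ℓ}} → Vec (Fin r) ℓ → Outcome n r → ℕ → Fin n → Fin n → Set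
PiPath {n} {r} {ℓ} Π ω i u v =
  ∃[ k ] Σ (Vec (Fin n) (suc k)) λ xs → Σ (Fin ℓ) λ l →
    1 ≤ k × head xs ≡ u × last xs ≡ v ×
    (∀ a b → lookup xs a ≡ lookup xs b → a ≡ b) ×
    (∀ (j : Fin k) → ArcIn ω i (lookup xs (inject₁ j)) (lookup xs (fsuc j))
                       (lookup Π ((toℕ j + toℕ l) mod ℓ)))

PiConnected : ∀ {n r ℓ} .{{_ : NonZero ℓ}} → Vec (Fin r) ℓ → Outcome n r → ℕ → Set
PiConnected {n} Π ω i = ∀ (u v : Fin n) → u ≢ v → PiPath Π ω i u v

MinInOut1 : ∀ {n r} → Outcome n r → ℕ → Set
MinInOut1 {n} ω i =
  ∀ (v : Fin n) → (∃[ u ] ∃[ c ] ArcIn ω i u v c) × (∃[ w ] ∃[ c ] ArcIn ω i v w c)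

IsLeast : (ℕ → Set) → ℕ → Set
IsLeast P t = P t × (∀ i → i < t → ¬ P i)

-- The event τ_{Π-connected} = τ_1 (τ_1 always exists for n ≥ 2; the event
-- requires τ_{Π-connected} to exist and be equal to it).
HittingTimesEqual : ∀ {n r ℓ} .{{_ : NonZero ℓ}} → Vec (Fin r) ℓ → Outcome n r → Set
HittingTimesEqual Π ω =
  ∀ t → IsLeast (MinInOut1 ω) t → IsLeast (PiConnected Π ω) t

-- Give the arcs independent uniform labels; sorting them by label yields the process. For a scale D at
-- which n (1 - 1/D)^(n-1) is a large constant, call the lowest fraction 1/D of the labels early and the
-- lowest fraction 2/D mid. With high probability some vertex has no early arc leaving it, while every
-- vertex has mid arcs in both directions, so the digraph at the hitting time contains all early arcs and
-- consists of mid arcs.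
--
-- Inside a block of linearly many vertices, early arcs of each color join any two sets of linear size.
-- Depth-first search then gives a long Π-colored path P, and for each position in Π all but few vertices
-- of the block can enter P (or be reached from it) there. A vertex w outside the block fails to see one
-- of these large sets through early arcs with probability (1 - 1/(Dr))^(cn), so such bad vertices are few.
-- They hardly depend on the arcs out of a vertex u, and resampling those shows that with high probability
-- no u has only bad out-neighbors at the hitting time; likewise for arcs into v. So there are good w₁, w₂ with
-- arcs u → w₁ and w₂ → v, and w₁ = w₂ can be avoided because two vertices of almost minimal degree rarely
-- share a neighbor. Of five blocks one avoids u, v, w₁ and w₂, and there u → w₁ → x → P → y → w₂ → v
-- is Π-colored.
module Submission where

open import Defs
open import Data.Bool using (Bool; _∧_; _∨_; false; if_then_else_; not; true)
open import Data.Bool.Properties using (∧-identityʳ)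
open import Data.Fin using (Fin; combine; fromℕ; fromℕ<; inject₁; inject≤; punchOut; remQuot; toℕ) renaming (suc to fsuc; zero to fzero)
open import Data.Fin.Properties using (all?; any?; combine-injective; injective⇒≤; inject≤-injective; pigeonhole; punchOut-injective; remQuot-combine; toℕ-fromℕ<; toℕ-injective; toℕ-inject≤; toℕ<n; ¬∀⟶∃¬)
open import Data.List using (List; []; _++_; _∷_; allFin; applyUpTo; cartesianProduct; cartesianProductWith; filterᵇ; length; map)
open import Data.List.Membership.Propositional using (_∈_)
open import Data.List.Membership.Propositional.Properties using (∈-++⁺ʳ; ∈-++⁺ˡ; ∈-++⁻; ∈-allFin; ∈-cartesianProductWith⁺; ∈-cartesianProduct⁺; ∈-cartesianProduct⁻; ∈-map⁻; ∈-∃++)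
open import Data.List.Properties using (length-++; length-map; map-tabulate)
open import Data.List.Relation.Unary.All using (All; []; _∷_)
open import Data.List.Relation.Unary.AllPairs using ([]; _∷_)
open import Data.List.Relation.Unary.Any using (here; there)
open import Data.List.Relation.Unary.Unique.Propositional using (Unique)
open import Data.List.Relation.Unary.Unique.Propositional.Properties using (++⁺; allFin⁺; applyUpTo⁺₁; cartesianProductWith⁺; cartesianProduct⁺; map⁺)
open import Data.Nat
open import Data.Nat.DivMod using (%-distribˡ-+; /-monoˡ-≤; [m+kn]%n≡m%n; _%_; _/_; _mod_; m%n%n≡m%n; m%n<n; m*n/n≡m; m/n*n≤m; m<n⇒m%n≡m; m≡m%n+[m/n]*n)
open import Data.Nat.Divisibility using (_∣_)
open import Data.Nat.Properties
open import Data.Nat.Solver using (module +-*-Solver)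
open import Data.Product using (_,_; _×_; proj₁; proj₂; ∃-syntax)
open import Data.Product.Properties using (≡-dec)
open import Data.Sum using (_⊎_; inj₁; inj₂)
open import Data.Unit using (tt; ⊤)
open import Data.Vec using (Vec; []; _∷_; fromList; last; lookup; tabulate)
open import Data.Vec.Properties using (lookup-map; lookup∘tabulate; tabulate-cong; ∷-injective)
open import Relation.Binary.Definitions using (tri<; tri>; tri≈)
open import Relation.Binary.PropositionalEquality
open import Relation.Nullary using (Dec; contradiction; does; no; yes; ¬?; ¬_)
open import Relation.Nullary.Decidable using (_×-dec_; _→-dec_; dec-false; dec-true)
import Data.Fin as F
import Data.List.Relation.Unary.All as All
import Data.List.Relation.Unary.All.Properties as AllP
import Data.List.Relation.Unary.AllPairs.Properties as AllPairsP
import Data.Vec as Vec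
open +-*-Solver using (solve; _:+_; _:*_; _:=_; con)

-- Probabilities are counts over `Ω`, which lists all label matrices, loops included so that the
-- entries form a full product. The hitting time never enters these counts: it is caught between two
-- fixed thresholds, so each failure event concerns fixed labels, and conditioning means resampling
-- the entries of a mask.
--
-- This requires that what is held fixed does not read the resampled entries. Hence the blocks: the
-- long path of a block depends on the arcs inside it alone, badness towards a block is judged only
-- for vertices outside it, and the blocks of u and v are left out when the arcs at u and v are
-- resampled.
--
-- Let 1/q be the error granted to one event. `D` puts n (1 - 1/D)^(n-1) between q and 2q. In
-- expectation at most 4q vertices lack early arcs to all good vertices, and each has a mid arc to
-- one of the `b₀` bad ones with chance at most 2 b₀/D; this dictates `b₀` near D/(8 q^2).
--
-- A finite label set allows ties. With N = n(n-1), more than 2 N^2 labels make at least half of the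
-- label sequences injective, which costs a factor 2.

variable
  X Y Z : Set

-- Finite sums and counting

∑ : List X → (X → ℕ) → ℕ
∑ [] F = 0
∑ (x ∷ xs) F = F x + ∑ xs F

⟦_⟧ : Bool → ℕ
⟦ b ⟧ = if b then 1 else 0

∑-cong : (xs : List X) {F G : X → ℕ} → (∀ x → F x ≡ G x) → ∑ xs F ≡ ∑ xs G
∑-cong [] h = refl
∑-cong (x ∷ xs) h = cong₂ _+_ (h x) (∑-cong xs h)

∑-mono : (xs : List X) {F G : X → ℕ} → (∀ x → F x ≤ G x) → ∑ xs F ≤ ∑ xs G
∑-mono [] h = z≤n
∑-mono (x ∷ xs) h = +-mono-≤ (h x) (∑-mono xs h)

∑-+ : (xs : List X) (F G : X → ℕ) → ∑ xs (λ x → F x + G x) ≡ ∑ xs F + ∑ xs G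
∑-+ [] F G = refl
∑-+ (x ∷ xs) F G rewrite ∑-+ xs F G =
  solve 4 (λ a b c d → (a :+ b) :+ (c :+ d) := (a :+ c) :+ (b :+ d)) refl (F x) (G x) (∑ xs F) (∑ xs G)

∑-*ˡ : (c : ℕ) (xs : List X) (F : X → ℕ) → ∑ xs (λ x → c * F x) ≡ c * ∑ xs F
∑-*ˡ c [] F = sym (*-zeroʳ c)
∑-*ˡ c (x ∷ xs) F rewrite ∑-*ˡ c xs F = sym (*-distribˡ-+ c (F x) (∑ xs F))

∑-*ʳ : (c : ℕ) (xs : List X) (F : X → ℕ) → ∑ xs (λ x → F x * c) ≡ ∑ xs F * c
∑-*ʳ c xs F = trans (∑-cong xs (λ x → *-comm (F x) c)) (trans (∑-*ˡ c xs F) (*-comm c _))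

∑-const : (xs : List X) (c : ℕ) → ∑ xs (λ _ → c) ≡ length xs * c
∑-const [] c = refl
∑-const (x ∷ xs) c = cong (c +_) (∑-const xs c)

∑-≤const : (xs : List X) {F : X → ℕ} {c : ℕ} → (∀ x → F x ≤ c) → ∑ xs F ≤ length xs * c
∑-≤const xs {c = c} h = ≤-trans (∑-mono xs h) (≤-reflexive (∑-const xs c))

∑-swap : (xs : List X) (ys : List Y) (F : X → Y → ℕ) →
  ∑ xs (λ x → ∑ ys (F x)) ≡ ∑ ys (λ y → ∑ xs (λ x → F x y))
∑-swap [] ys F = sym (trans (∑-const ys 0) (*-zeroʳ (length ys)))
∑-swap (x ∷ xs) ys F rewrite ∑-swap xs ys F = sym (∑-+ ys (F x) _)

∑-++ : (xs ys : List X) (F : X → ℕ) → ∑ (xs ++ ys) F ≡ ∑ xs F + ∑ ys F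
∑-++ [] ys F = refl
∑-++ (x ∷ xs) ys F rewrite ∑-++ xs ys F = sym (+-assoc (F x) _ _)

∑-map : (g : X → Y) (xs : List X) (F : Y → ℕ) → ∑ (map g xs) F ≡ ∑ xs (λ x → F (g x))
∑-map g [] F = refl
∑-map g (x ∷ xs) F = cong (F (g x) +_) (∑-map g xs F)

∑-cartesian : (g : X → Y → Z) (xs : List X) (ys : List Y) (F : Z → ℕ) →
  ∑ (cartesianProductWith g xs ys) F ≡ ∑ xs (λ x → ∑ ys (λ y → F (g x y)))
∑-cartesian g [] ys F = refl
∑-cartesian g (x ∷ xs) ys F =
  trans (∑-++ (map (g x) ys) _ F) (cong₂ _+_ (∑-map (g x) ys F) (∑-cartesian g xs ys F))

∑-member : {xs : List X} (F : X → ℕ) {x : X} → x ∈ xs → F x ≤ ∑ xs F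
∑-member F (here refl) = m≤m+n _ _
∑-member F {x} (there {x = y} p) = ≤-trans (∑-member F p) (m≤n+m _ (F y))

∑≡0 : {xs : List X} (F : X → ℕ) → ∑ xs F ≡ 0 → ∀ {x} → x ∈ xs → F x ≡ 0
∑≡0 F e p = n≤0⇒n≡0 (subst (F _ ≤_) e (∑-member F p))

length≡∑ : (xs : List X) → length xs ≡ ∑ xs (λ _ → 1)
length≡∑ xs = sym (trans (∑-const xs 1) (*-identityʳ _))

⟦⟧≤1 : ∀ b → ⟦ b ⟧ ≤ 1
⟦⟧≤1 true = ≤-refl
⟦⟧≤1 false = z≤n

⟦∧⟧ : ∀ a b → ⟦ a ∧ b ⟧ ≡ ⟦ a ⟧ * ⟦ b ⟧
⟦∧⟧ true b = sym (+-identityʳ _)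
⟦∧⟧ false b = refl

⟦not⟧ : ∀ b → ⟦ b ⟧ + ⟦ not b ⟧ ≡ 1
⟦not⟧ true = refl
⟦not⟧ false = refl

not-false : ∀ {b} → not b ≡ false → b ≡ true
not-false {true} _ = refl

∧-true : ∀ {a b} → a ∧ b ≡ true → a ≡ true × b ≡ true
∧-true {true} {true} _ = refl , refl

true∧ : ∀ {a b} → a ≡ true → b ≡ true → a ∧ b ≡ true
true∧ refl refl = refl

not-true : ∀ {b} → not b ≡ true → b ≡ false
not-true {false} _ = refl

⟦⟧-mono : ∀ {a b} → (a ≡ true → b ≡ true) → ⟦ a ⟧ ≤ ⟦ b ⟧
⟦⟧-mono {false} h = z≤n
⟦⟧-mono {true} h rewrite h refl = ≤-refl

⟦⟧-weaken : ∀ {b c} → (b ≡ true → 1 ≤ c) → ⟦ b ⟧ ≤ c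
⟦⟧-weaken {false} h = z≤n
⟦⟧-weaken {true} h = h refl

⟦⟧≡0 : ∀ {b} → ⟦ b ⟧ ≡ 0 → b ≡ false
⟦⟧≡0 {false} _ = refl

all' : (X → Bool) → List X → Bool
all' p [] = true
all' p (x ∷ xs) = p x ∧ all' p xs

any' : (X → Bool) → List X → Bool
any' p [] = false
any' p (x ∷ xs) = p x ∨ any' p xs

all-true : (p : X → Bool) {xs : List X} → all' p xs ≡ true → ∀ {x} → x ∈ xs → p x ≡ true
all-true p h (here refl) = proj₁ (∧-true h)
all-true p {y ∷ xs} h (there q) = all-true p (proj₂ (∧-true {p y} h)) q

true-all : (p : X → Bool) (xs : List X) → (∀ {x} → x ∈ xs → p x ≡ true) → all' p xs ≡ true
true-all p [] h = refl
true-all p (x ∷ xs) h = true∧ (h (here refl)) (true-all p xs (λ q → h (there q)))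

all-false : (p : X → Bool) (xs : List X) → all' p xs ≡ false → ∃[ x ] (x ∈ xs × p x ≡ false)
all-false p (x ∷ xs) h with p x in e
... | false = x , here refl , e
... | true with all-false p xs h
...   | y , q , r = y , there q , r

any-true : (p : X → Bool) (xs : List X) → any' p xs ≡ true → ∃[ x ] (x ∈ xs × p x ≡ true)
any-true p (x ∷ xs) h with p x in e
... | true = x , here refl , e
... | false with any-true p xs h
...   | y , q , r = y , there q , r

true-any : (p : X → Bool) {xs : List X} {x : X} → x ∈ xs → p x ≡ true → any' p xs ≡ true
true-any p (here refl) e rewrite e = refl
true-any p {y ∷ xs} (there q) e with p y
... | true = refl
... | false = true-any p q e

any-false : (p : X → Bool) {xs : List X} → any' p xs ≡ false → ∀ {x} → x ∈ xs → p x ≡ false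
any-false p {y ∷ xs} h q with p y in e
any-false p h (here refl) | false = e
any-false p h (there q) | false = any-false p h q

all-cong : {p q : X → Bool} (xs : List X) → (∀ x → p x ≡ q x) → all' p xs ≡ all' q xs
all-cong [] h = refl
all-cong (x ∷ xs) h = cong₂ _∧_ (h x) (all-cong xs h)

any-cong : {p q : X → Bool} (xs : List X) → (∀ x → p x ≡ q x) → any' p xs ≡ any' q xs
any-cong [] h = refl
any-cong (x ∷ xs) h = cong₂ _∨_ (h x) (any-cong xs h)

⟦any⟧≤ : (p : X → Bool) (xs : List X) → ⟦ any' p xs ⟧ ≤ ∑ xs (λ x → ⟦ p x ⟧)
⟦any⟧≤ p xs = ⟦⟧-weaken λ h → let (x , q , e) = any-true p xs h in
  ≤-trans (≤-reflexive (sym (cong ⟦_⟧ e))) (∑-member (λ x → ⟦ p x ⟧) q)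

∑-filter : (p : X → Bool) (xs : List X) (F : X → ℕ) → ∑ (filterᵇ p xs) F ≡ ∑ xs (λ x → ⟦ p x ⟧ * F x)
∑-filter p [] F = refl
∑-filter p (x ∷ xs) F with p x
... | true = cong₂ _+_ (sym (+-identityʳ _)) (∑-filter p xs F)
... | false = ∑-filter p xs F

∈-filterᵇ⁻ : (p : X → Bool) (xs : List X) {x : X} → x ∈ filterᵇ p xs → x ∈ xs × p x ≡ true
∈-filterᵇ⁻ p (y ∷ xs) q with p y in e
∈-filterᵇ⁻ p (y ∷ xs) (here refl) | true = here refl , e
∈-filterᵇ⁻ p (y ∷ xs) (there q) | true = let (a , b) = ∈-filterᵇ⁻ p xs q in there a , b
∈-filterᵇ⁻ p (y ∷ xs) q | false = let (a , b) = ∈-filterᵇ⁻ p xs q in there a , b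

∈-filterᵇ⁺ : (p : X → Bool) {xs : List X} {x : X} → x ∈ xs → p x ≡ true → x ∈ filterᵇ p xs
∈-filterᵇ⁺ p {y ∷ xs} (here refl) e rewrite e = here refl
∈-filterᵇ⁺ p {y ∷ xs} (there q) e with p y
... | true = there (∈-filterᵇ⁺ p q e)
... | false = ∈-filterᵇ⁺ p q e

cnt : (n : ℕ) → (Fin n → Bool) → ℕ
cnt n p = ∑ (allFin n) (λ x → ⟦ p x ⟧)

length-filterᵇ : (p : X → Bool) (xs : List X) → length (filterᵇ p xs) ≡ ∑ xs (λ x → ⟦ p x ⟧)
length-filterᵇ p xs = trans (length≡∑ (filterᵇ p xs))
  (trans (∑-filter p xs _) (∑-cong xs (λ x → *-identityʳ _)))

allFin-suc : ∀ n → allFin (suc n) ≡ fzero ∷ map fsuc (allFin n)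
allFin-suc n = cong (fzero ∷_) (sym (map-tabulate (λ x → x) fsuc))

∑-allFin-suc : ∀ n (F : Fin (suc n) → ℕ) → ∑ (allFin (suc n)) F ≡ F fzero + ∑ (allFin n) (λ i → F (fsuc i))
∑-allFin-suc n F = trans (cong (λ l → ∑ l F) (allFin-suc n)) (cong (F fzero +_) (∑-map fsuc (allFin n) F))

length-allFin : ∀ n → length (allFin n) ≡ n
length-allFin zero = refl
length-allFin (suc n) = trans (cong length (allFin-suc n))
  (cong suc (trans (length-map fsuc (allFin n)) (length-allFin n)))

cnt-true : ∀ n → cnt n (λ _ → true) ≡ n
cnt-true n = trans (∑-const (allFin n) 1) (trans (*-identityʳ _) (length-allFin n))

cnt-not : ∀ n (p : Fin n → Bool) → cnt n p + cnt n (λ x → not (p x)) ≡ n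
cnt-not n p = trans (sym (∑-+ (allFin n) _ _))
  (trans (∑-cong (allFin n) (λ x → ⟦not⟧ (p x))) (cnt-true n))

∑-mono-< : {xs : List X} {F G : X → ℕ} → (∀ x → F x ≤ G x) → ∀ {x} → x ∈ xs → F x < G x → ∑ xs F < ∑ xs G
∑-mono-< {xs = _ ∷ xs} h (here refl) l = +-mono-<-≤ l (∑-mono xs h)
∑-mono-< h (there q) l = +-mono-≤-< (h _) (∑-mono-< h q l)

cnt-member : ∀ n (p : Fin n → Bool) → 0 < cnt n p → ∃[ x ] p x ≡ true
cnt-member n p h with any' p (allFin n) in e
... | true = let (x , _ , r) = any-true p (allFin n) e in x , r
... | false = contradiction h (≤⇒≯ (≤-reflexive
  (trans (∑-cong (allFin n) (λ x → cong ⟦_⟧ (any-false p e (∈-allFin x))))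
    (trans (∑-const (allFin n) 0) (*-zeroʳ (length (allFin n)))))))

cnt-< : ∀ M K → K ≤ M → cnt M (λ i → toℕ i <ᵇ K) ≡ K
cnt-< M zero h = trans (∑-const (allFin M) 0) (*-zeroʳ (length (allFin M)))
cnt-< (suc M) (suc K) (s≤s h) = trans (∑-allFin-suc M (λ i → ⟦ toℕ i <ᵇ suc K ⟧)) (cong suc (cnt-< M K h))

-- Resampling

enumV : ∀ n → List X → List (Vec X n)
enumV zero xs = [] ∷ []
enumV (suc n) xs = cartesianProductWith _∷_ xs (enumV n xs)

length-enumV : ∀ n (xs : List X) → length (enumV n xs) ≡ length xs ^ n
length-enumV zero xs = refl
length-enumV (suc n) xs = trans (length≡∑ (enumV (suc n) xs)) (trans (∑-cartesian _∷_ xs (enumV n xs) _)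
  (trans (∑-cong xs (λ x → trans (sym (length≡∑ (enumV n xs))) (length-enumV n xs))) (∑-const xs _)))

∈-enumV : ∀ {n} {xs : List X} → (∀ x → x ∈ xs) → (v : Vec X n) → v ∈ enumV n xs
∈-enumV h [] = here refl
∈-enumV h (x ∷ v) = ∈-cartesianProductWith⁺ _∷_ (h x) (∈-enumV h v)

-- Mixing two independent uniform samples coordinatewise gives a uniform sample.
Resampling : List X → (X → X → X) → Set
Resampling xs mx = ∀ F → ∑ xs (λ a → ∑ xs (λ b → F (mx a b))) ≡ length xs * ∑ xs F

resample-Bool : (b : Bool) (xs : List X) → Resampling xs (λ x y → if b then y else x)
resample-Bool true xs F = ∑-const xs _
resample-Bool false xs F = trans (∑-cong xs (λ x → ∑-const xs (F x))) (∑-*ˡ (length xs) xs F)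

-- The coordinates are independent, so the four nested sums can be reordered and the coordinates
-- mixed one at a time.
resample-Vec : ∀ n (xs : List X) (mx : Fin n → X → X → X) → (∀ i → Resampling xs (mx i)) →
  Resampling (enumV n xs) (λ f h → tabulate (λ i → mx i (lookup f i) (lookup h i)))
resample-Vec zero xs mx R F = refl
resample-Vec {X} (suc n) xs mx R F = begin
  ∑ E (λ f → ∑ E (λ h → F (mix f h)))
    ≡⟨ ∑-cartesian _∷_ xs E' _ ⟩
  ∑ xs (λ a → ∑ E' (λ f → ∑ E (λ h → F (mix (a ∷ f) h))))
    ≡⟨ ∑-cong xs (λ a → ∑-cong E' (λ f → ∑-cartesian _∷_ xs E' _)) ⟩
  ∑ xs (λ a → ∑ E' (λ f → ∑ xs (λ b → ∑ E' (λ h → F (mx fzero a b ∷ mix' f h)))))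
    ≡⟨ ∑-cong xs (λ a → ∑-swap E' xs _) ⟩
  ∑ xs (λ a → ∑ xs (λ b → ∑ E' (λ f → ∑ E' (λ h → F (mx fzero a b ∷ mix' f h)))))
    ≡⟨ ∑-cong xs (λ a → ∑-cong xs (λ b → resample-Vec n xs (λ i → mx (fsuc i)) (λ i → R (fsuc i)) (λ v → F (mx fzero a b ∷ v)))) ⟩
  ∑ xs (λ a → ∑ xs (λ b → length E' * ∑ E' (λ v → F (mx fzero a b ∷ v))))
    ≡⟨ R fzero (λ x → length E' * ∑ E' (λ v → F (x ∷ v))) ⟩
  length xs * ∑ xs (λ a → length E' * ∑ E' (λ v → F (a ∷ v)))
    ≡⟨ cong (length xs *_) (∑-*ˡ (length E') xs _) ⟩
  length xs * (length E' * ∑ xs (λ a → ∑ E' (λ v → F (a ∷ v))))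
    ≡⟨ sym (*-assoc (length xs) _ _) ⟩
  length xs * length E' * ∑ xs (λ a → ∑ E' (λ v → F (a ∷ v)))
    ≡⟨ cong₂ _*_ lenE (sym (∑-cartesian _∷_ xs E' F)) ⟩
  length E * ∑ E F ∎
  where
  open ≡-Reasoning
  E' : List (Vec X n)
  E' = enumV n xs
  E : List (Vec X (suc n))
  E = enumV (suc n) xs
  mix : Vec X (suc n) → Vec X (suc n) → Vec X (suc n)
  mix f h = tabulate (λ i → mx i (lookup f i) (lookup h i))
  mix' : Vec X n → Vec X n → Vec X n
  mix' f h = tabulate (λ i → mx (fsuc i) (lookup f i) (lookup h i))
  lenE : length xs * length E' ≡ length E
  lenE = trans (cong (length xs *_) (length-enumV n xs)) (sym (length-enumV (suc n) xs))

Cell : ℕ → Set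
Cell n = Fin n × Fin n

_≟c_ : ∀ {n} → Cell n → Cell n → Bool
(a , b) ≟c (u , v) = does (a F.≟ u) ∧ does (b F.≟ v)

≡ᵇ-refl : ∀ {n} (a : Fin n) → does (a F.≟ a) ≡ true
≡ᵇ-refl a = dec-true (a F.≟ a) refl

≢ᵇ : ∀ {n} {a b : Fin n} → a ≢ b → does (a F.≟ b) ≡ false
≢ᵇ {a = a} {b} h = dec-false (a F.≟ b) h

≡ᵇ-sound : ∀ {n} {a b : Fin n} → does (a F.≟ b) ≡ true → a ≡ b
≡ᵇ-sound {a = a} {b} h with a F.≟ b
... | yes e = e

≢ᵇ-sound : ∀ {n} {a b : Fin n} → does (a F.≟ b) ≡ false → a ≢ b
≢ᵇ-sound {a = a} h refl = contradiction (trans (sym h) (≡ᵇ-refl a)) λ ()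

cnt-≡ : ∀ k (c : Fin k) → cnt k (λ x → does (x F.≟ c)) ≡ 1
cnt-≡ (suc k) fzero = trans (∑-allFin-suc k (λ x → ⟦ does (x F.≟ fzero) ⟧))
  (cong suc (trans (∑-const (allFin k) 0) (*-zeroʳ (length (allFin k)))))
cnt-≡ (suc k) (fsuc c) = trans (∑-allFin-suc k (λ x → ⟦ does (x F.≟ fsuc c) ⟧)) (cnt-≡ k c)

≟c-refl : ∀ {n} (c : Cell n) → (c ≟c c) ≡ true
≟c-refl (a , b) rewrite ≡ᵇ-refl a | ≡ᵇ-refl b = refl

≟c-≢ : ∀ {n} {c d : Cell n} → c ≢ d → (c ≟c d) ≡ false
≟c-≢ {c = a , b} {u , v} h with a F.≟ u | b F.≟ v
... | yes refl | yes refl = contradiction refl h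
... | yes _ | no _ = refl
... | no _ | _ = refl

-- One coordinate of a uniform vector is uniform; both sides are cross-multiplied to avoid division.
∑-row : {k : ℕ} (v : Fin k) (p : X → ℕ) (ys : List X) →
  length ys * ∑ (enumV k ys) (λ f → p (lookup f v)) ≡ ∑ ys p * length (enumV k ys)
∑-row {k = suc k} v p ys = trans (cong (length ys *_) (∑-cartesian _∷_ ys (enumV k ys) _)) (go v)
  where
  open ≡-Reasoning
  L = length ys
  E = enumV k ys
  go : (v : Fin (suc k)) → L * ∑ ys (λ a → ∑ E (λ f → p (lookup (a ∷ f) v))) ≡ ∑ ys p * length (enumV (suc k) ys)
  go fzero = begin
    L * ∑ ys (λ a → ∑ E (λ f → p a)) ≡⟨ cong (L *_) (∑-cong ys (λ a → ∑-const E (p a))) ⟩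
    L * ∑ ys (λ a → length E * p a) ≡⟨ cong (L *_) (∑-*ˡ (length E) ys p) ⟩
    L * (length E * ∑ ys p) ≡⟨ sym (*-assoc L _ _) ⟩
    L * length E * ∑ ys p ≡⟨ *-comm (L * length E) _ ⟩
    ∑ ys p * (L * length E) ≡⟨ cong (∑ ys p *_) (trans (cong (L *_) (length-enumV k ys)) (sym (length-enumV (suc k) ys))) ⟩
    ∑ ys p * length (enumV (suc k) ys) ∎
  go (fsuc v) = begin
    L * ∑ ys (λ a → ∑ E (λ f → p (lookup f v))) ≡⟨ cong (L *_) (∑-const ys _) ⟩
    L * (L * ∑ E (λ f → p (lookup f v))) ≡⟨ cong (L *_) (∑-row v p ys) ⟩
    L * (∑ ys p * length E) ≡⟨ solve 3 (λ l s e → l :* (s :* e) := s :* (l :* e)) refl L (∑ ys p) (length E) ⟩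
    ∑ ys p * (L * length E) ≡⟨ cong (∑ ys p *_) (trans (cong (L *_) (length-enumV k ys)) (sym (length-enumV (suc k) ys))) ⟩
    ∑ ys p * length (enumV (suc k) ys) ∎

-- Ω enumerates the n × n matrices with entries in xs: these are independent and uniform.
module Matrices {A : Set} (n : ℕ) (xs : List A) (xs≢[] : 0 < length xs) where

  Mat : Set
  Mat = Vec (Vec A n) n

  Ω : List Mat
  Ω = enumV n (enumV n xs)

  _⟨_⟩ : Mat → Cell n → A
  f ⟨ u , v ⟩ = lookup (lookup f u) v

  total : ℕ
  total = length Ω

  total≡ : total ≡ (length xs ^ n) ^ n
  total≡ = trans (length-enumV n (enumV n xs)) (cong (_^ n) (length-enumV n xs))

  total>0 : 0 < total
  total>0 = subst (0 <_) (sym total≡) (m^n>0' (length xs ^ n) n (m^n>0' (length xs) n xs≢[]))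
    where
    m^n>0' : ∀ m k → 0 < m → 0 < m ^ k
    m^n>0' (suc m) k _ = m^n>0 (suc m) k

  instance
    total≢0 : NonZero total
    total≢0 = >-nonZero total>0

  Mask : Set
  Mask = Cell n → Bool

  mix : Mask → Mat → Mat → Mat
  mix μ f h = tabulate (λ u → tabulate (λ v → if μ (u , v) then h ⟨ u , v ⟩ else f ⟨ u , v ⟩))

  mix-at : ∀ μ f h c → mix μ f h ⟨ c ⟩ ≡ (if μ c then h ⟨ c ⟩ else f ⟨ c ⟩)
  mix-at μ f h (u , v) = trans
    (cong (λ row → lookup row v) (lookup∘tabulate (λ u → tabulate (λ v → if μ (u , v) then h ⟨ u , v ⟩ else f ⟨ u , v ⟩)) u))
    (lookup∘tabulate (λ v → if μ (u , v) then h ⟨ u , v ⟩ else f ⟨ u , v ⟩) v)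

  mix-in : ∀ μ f h {c} → μ c ≡ true → mix μ f h ⟨ c ⟩ ≡ h ⟨ c ⟩
  mix-in μ f h {c} e = trans (mix-at μ f h c) (cong (λ b → if b then h ⟨ c ⟩ else f ⟨ c ⟩) e)

  mix-out : ∀ μ f h {c} → μ c ≡ false → mix μ f h ⟨ c ⟩ ≡ f ⟨ c ⟩
  mix-out μ f h {c} e = trans (mix-at μ f h c) (cong (λ b → if b then h ⟨ c ⟩ else f ⟨ c ⟩) e)

  resample : ∀ μ F → ∑ Ω (λ f → ∑ Ω (λ h → F (mix μ f h))) ≡ total * ∑ Ω F
  resample μ = resample-Vec n (enumV n xs) _ (λ u → resample-Vec n xs _ (λ v → resample-Bool (μ (u , v)) xs))

  -- The law of total probability: a bound `b / a` on the average over the masked entries, valid for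
  -- every choice `f` of the others, bounds the full average.
  resample-≤ : ∀ μ (F : Mat → ℕ) a b → (∀ f → a * ∑ Ω (λ h → F (mix μ f h)) ≤ b * total) →
    a * ∑ Ω F ≤ b * total
  resample-≤ μ F a b H = *-cancelˡ-≤ total (begin
    total * (a * ∑ Ω F)
      ≡⟨ solve 3 (λ t a s → t :* (a :* s) := a :* (t :* s)) refl total a (∑ Ω F) ⟩
    a * (total * ∑ Ω F)
      ≡⟨ cong (a *_) (sym (resample μ F)) ⟩
    a * ∑ Ω (λ f → ∑ Ω (λ h → F (mix μ f h)))
      ≡⟨ sym (∑-*ˡ a Ω _) ⟩
    ∑ Ω (λ f → a * ∑ Ω (λ h → F (mix μ f h)))
      ≤⟨ ∑-≤const Ω H ⟩
    total * (b * total) ∎)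
    where open ≤-Reasoning

  -- Independence: `F` reads only entries outside the mask and `G` only entries in it, so the mixed
  -- sum factors.
  resample-product : ∀ μ (F G : Mat → ℕ) → (∀ f h → F (mix μ f h) ≡ F f) → (∀ f h → G (mix μ f h) ≡ G h) →
    total * ∑ Ω (λ f → F f * G f) ≡ ∑ Ω F * ∑ Ω G
  resample-product μ F G hF hG = begin
    total * ∑ Ω (λ f → F f * G f)
      ≡⟨ sym (resample μ (λ f → F f * G f)) ⟩
    ∑ Ω (λ f → ∑ Ω (λ h → F (mix μ f h) * G (mix μ f h)))
      ≡⟨ ∑-cong Ω (λ f → trans (∑-cong Ω (λ h → cong₂ _*_ (hF f h) (hG f h))) (∑-*ˡ (F f) Ω G)) ⟩
    ∑ Ω (λ f → F f * ∑ Ω G)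
      ≡⟨ ∑-*ʳ (∑ Ω G) Ω F ⟩
    ∑ Ω F * ∑ Ω G ∎
    where open ≡-Reasoning

  -- The proportion of entries satisfying `p` is exactly `num / den`. Equality rather than a bound
  -- lets one pass to complements.
  Density : (A → Bool) → ℕ → ℕ → Set
  Density p num den = ∑ xs (λ a → ⟦ p a ⟧) * den ≡ num * length xs

  ∑-cell : ∀ c {p num den} → Density p num den → ∑ Ω (λ f → ⟦ p (f ⟨ c ⟩) ⟧) * den ≡ num * total
  ∑-cell (u , v) {p} {num} {den} D = *-cancelˡ-≡ _ _ (length rows * length xs) (begin
    length rows * length xs * (S * den)
      ≡⟨ solve 4 (λ r x s d → r :* x :* (s :* d) := x :* (r :* s) :* d) refl (length rows) (length xs) S den ⟩
    length xs * (length rows * S) * den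
      ≡⟨ cong (λ z → length xs * z * den) (∑-row u (λ row → ⟦ p (lookup row v) ⟧) rows) ⟩
    length xs * (∑ rows (λ row → ⟦ p (lookup row v) ⟧) * total) * den
      ≡⟨ solve 4 (λ x s t d → x :* (s :* t) :* d := (x :* s) :* (t :* d)) refl (length xs) (∑ rows (λ row → ⟦ p (lookup row v) ⟧)) total den ⟩
    (length xs * ∑ rows (λ row → ⟦ p (lookup row v) ⟧)) * (total * den)
      ≡⟨ cong (_* (total * den)) (∑-row v (λ a → ⟦ p a ⟧) xs) ⟩
    (∑ xs (λ a → ⟦ p a ⟧) * length rows) * (total * den)
      ≡⟨ solve 4 (λ s r t d → (s :* r) :* (t :* d) := (s :* d) :* (r :* t)) refl (∑ xs (λ a → ⟦ p a ⟧)) (length rows) total den ⟩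
    (∑ xs (λ a → ⟦ p a ⟧) * den) * (length rows * total)
      ≡⟨ cong (_* (length rows * total)) D ⟩
    (num * length xs) * (length rows * total)
      ≡⟨ solve 4 (λ m x r t → (m :* x) :* (r :* t) := r :* x :* (m :* t)) refl num (length xs) (length rows) total ⟩
    length rows * length xs * (num * total) ∎)
    where
    open ≡-Reasoning
    rows : List (Vec A n)
    rows = enumV n xs
    S = ∑ Ω (λ f → ⟦ p (f ⟨ u , v ⟩) ⟧)
    instance
      nz : NonZero (length rows * length xs)
      nz = >-nonZero (*-mono-≤ {1} {_} {1} (subst (0 <_) (sym (length-enumV n xs)) (m^n>0 (length xs) {{>-nonZero xs≢[]}} n)) xs≢[])

  FreeOf : (Mat → ℕ) → Cell n → Set
  FreeOf G c = ∀ f h → G (mix (_≟c c) f h) ≡ G f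

  -- Distinct cells are independent of each other and of `G`. The weight `G` is there for the
  -- induction: it absorbs the indicator of the first cell and stays free of the remaining,
  -- different cells.
  ∑-cells : ∀ {p num den} → Density p num den → (cs : List (Cell n)) → Unique cs →
    (G : Mat → ℕ) → (∀ {c} → c ∈ cs → FreeOf G c) →
    ∑ Ω (λ f → G f * ⟦ all' (λ c → p (f ⟨ c ⟩)) cs ⟧) * den ^ length cs ≡ num ^ length cs * ∑ Ω G
  ∑-cells D [] _ G free = trans (*-identityʳ _) (trans (∑-cong Ω (λ f → *-identityʳ (G f))) (sym (*-identityˡ _)))
  ∑-cells {p} {num} {den} D (c ∷ cs) (c∉ ∷ uniq) G free = begin
    ∑ Ω (λ f → G f * ⟦ p (f ⟨ c ⟩) ∧ P f ⟧) * (den * den ^ length cs)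
      ≡⟨ cong (_* (den * den ^ length cs)) (∑-cong Ω (λ f → trans (cong (G f *_) (⟦∧⟧ (p (f ⟨ c ⟩)) (P f))) (sym (*-assoc (G f) _ _)))) ⟩
    ∑ Ω (λ f → G' f * ⟦ P f ⟧) * (den * den ^ length cs)
      ≡⟨ solve 3 (λ s d e → s :* (d :* e) := (s :* e) :* d) refl (∑ Ω (λ f → G' f * ⟦ P f ⟧)) den (den ^ length cs) ⟩
    ∑ Ω (λ f → G' f * ⟦ P f ⟧) * den ^ length cs * den
      ≡⟨ cong (_* den) (∑-cells D cs uniq G' free') ⟩
    num ^ length cs * ∑ Ω G' * den
      ≡⟨ *-assoc (num ^ length cs) _ den ⟩
    num ^ length cs * (∑ Ω G' * den)
      ≡⟨ cong (num ^ length cs *_) (*-cancelˡ-≡ _ _ total step) ⟩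
    num ^ length cs * (num * ∑ Ω G)
      ≡⟨ solve 3 (λ e m s → e :* (m :* s) := m :* e :* s) refl (num ^ length cs) num (∑ Ω G) ⟩
    num * num ^ length cs * ∑ Ω G ∎
    where
    open ≡-Reasoning
    P : Mat → Bool
    P f = all' (λ c → p (f ⟨ c ⟩)) cs
    Q : Mat → ℕ
    Q f = ⟦ p (f ⟨ c ⟩) ⟧
    G' : Mat → ℕ
    G' f = G f * Q f
    free' : ∀ {d} → d ∈ cs → FreeOf G' d
    free' {d} d∈ f h = cong₂ _*_ (free (there d∈) f h)
      (cong (λ a → ⟦ p a ⟧) (mix-out (_≟c d) f h {c} (≟c-≢ (All.lookup c∉ d∈))))
    step : total * (∑ Ω G' * den) ≡ total * (num * ∑ Ω G)
    step = begin
      total * (∑ Ω G' * den) ≡⟨ sym (*-assoc total _ den) ⟩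
      total * ∑ Ω G' * den
        ≡⟨ cong (_* den) (resample-product (_≟c c) G Q (free (here refl))
             (λ f h → cong (λ a → ⟦ p a ⟧) (mix-in (_≟c c) f h {c} (≟c-refl c)))) ⟩
      ∑ Ω G * ∑ Ω Q * den ≡⟨ *-assoc (∑ Ω G) _ den ⟩
      ∑ Ω G * (∑ Ω Q * den) ≡⟨ cong (∑ Ω G *_) (∑-cell c {p} {num} {den} D) ⟩
      ∑ Ω G * (num * total) ≡⟨ solve 3 (λ g m t → g :* (m :* t) := t :* (m :* g)) refl (∑ Ω G) num total ⟩
      total * (num * ∑ Ω G) ∎

  -- The number of cells is usually known only from below. As `num ≤ den`, the surplus factors may
  -- be dropped.
  ∑-cells-≤ : ∀ {p num den} → Density p num den → num ≤ den → 0 < den → (cs : List (Cell n)) → Unique cs →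
    (G : Mat → ℕ) → (∀ {c} → c ∈ cs → FreeOf G c) → ∀ t → t ≤ length cs →
    den ^ t * ∑ Ω (λ f → G f * ⟦ all' (λ c → p (f ⟨ c ⟩)) cs ⟧) ≤ num ^ t * ∑ Ω G
  ∑-cells-≤ {p} {num} {den} D le pos cs uniq G free t t≤ = *-cancelˡ-≤ (den ^ d) {{m^n≢0 den d {{>-nonZero pos}}}} (begin
    den ^ d * (den ^ t * S) ≡⟨ sym (*-assoc (den ^ d) _ S) ⟩
    den ^ d * den ^ t * S ≡⟨ cong (_* S) (trans (sym (^-distribˡ-+-* den d t)) (cong (den ^_) d+t)) ⟩
    den ^ length cs * S ≡⟨ *-comm (den ^ length cs) S ⟩
    S * den ^ length cs ≡⟨ ∑-cells D cs uniq G free ⟩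
    num ^ length cs * ∑ Ω G ≡⟨ cong (λ z → num ^ z * ∑ Ω G) (sym d+t) ⟩
    num ^ (d + t) * ∑ Ω G ≡⟨ cong (_* ∑ Ω G) (^-distribˡ-+-* num d t) ⟩
    num ^ d * num ^ t * ∑ Ω G ≤⟨ *-monoˡ-≤ (∑ Ω G) (*-monoˡ-≤ (num ^ t) (^-monoˡ-≤ d le)) ⟩
    den ^ d * num ^ t * ∑ Ω G ≡⟨ *-assoc (den ^ d) _ _ ⟩
    den ^ d * (num ^ t * ∑ Ω G) ∎)
    where
    open ≤-Reasoning
    d = length cs ∸ t
    d+t : d + t ≡ length cs
    d+t = m∸n+n≡m t≤
    S = ∑ Ω (λ f → G f * ⟦ all' (λ c → p (f ⟨ c ⟩)) cs ⟧)

-- Long colored paths by depth-first search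

-- The search stores its path as a stack with the newest vertex first, so position `t` is counted
-- from the end. The default `d` makes positions total functions of `t`.
lastOr : {X : Set} → X → List X → ℕ → X
lastOr d [] t = d
lastOr d (x ∷ xs) t = if t ≡ᵇ length xs then x else lastOr d xs t

≡ᵇ-reflℕ : ∀ a → (a ≡ᵇ a) ≡ true
≡ᵇ-reflℕ zero = refl
≡ᵇ-reflℕ (suc a) = ≡ᵇ-reflℕ a

<⇒≢ᵇ : ∀ {a b} → a < b → (a ≡ᵇ b) ≡ false
<⇒≢ᵇ {zero} {suc b} _ = refl
<⇒≢ᵇ {suc a} {suc b} (s≤s h) = <⇒≢ᵇ h

lastOr-head : (d x : X) (xs : List X) → lastOr d (x ∷ xs) (length xs) ≡ x
lastOr-head d x xs rewrite ≡ᵇ-reflℕ (length xs) = refl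

lastOr-tail : (d x : X) (xs : List X) {t : ℕ} → t < length xs → lastOr d (x ∷ xs) t ≡ lastOr d xs t
lastOr-tail d x xs h rewrite <⇒≢ᵇ h = refl

lastOr-∈ : (d : X) (xs : List X) {t : ℕ} → t < length xs → lastOr d xs t ∈ xs
lastOr-∈ d (x ∷ xs) {t} (s≤s h) with m≤n⇒m<n∨m≡n h
... | inj₁ l = subst (_∈ (x ∷ xs)) (sym (lastOr-tail d x xs l)) (there (lastOr-∈ d xs l))
... | inj₂ refl = here (lastOr-head d x xs)

lastOr-injective : (d : X) {xs : List X} → Unique xs → ∀ {a b} → a < length xs → b < length xs →
  lastOr d xs a ≡ lastOr d xs b → a ≡ b
lastOr-injective d {x ∷ xs} (x∉ ∷ u) {a} {b} ha hb e with a ≟ length xs | b ≟ length xs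
... | yes p | yes q = trans p (sym q)
... | yes refl | no q = contradiction (trans (sym (lastOr-head d x xs)) (trans e (lastOr-tail d x xs hb')))
    (All.lookup x∉ (lastOr-∈ d xs hb'))
  where
  hb' : b < length xs
  hb' = ≤∧≢⇒< (≤-pred hb) q
... | no p | yes refl = contradiction (trans (sym (lastOr-head d x xs)) (trans (sym e) (lastOr-tail d x xs ha')))
    (All.lookup x∉ (lastOr-∈ d xs ha'))
  where
  ha' : a < length xs
  ha' = ≤∧≢⇒< (≤-pred ha) p
... | no p | no q = lastOr-injective d u ha' hb' (trans (sym (lastOr-tail d x xs ha')) (trans e (lastOr-tail d x xs hb')))
  where
  ha' : a < length xs
  ha' = ≤∧≢⇒< (≤-pred ha) p
  hb' : b < length xs
  hb' = ≤∧≢⇒< (≤-pred hb) q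

color : {r ℓ : ℕ} .{{_ : NonZero ℓ}} → Vec (Fin r) ℓ → ℕ → Fin r
color {ℓ = ℓ} Π t = lookup Π (t mod ℓ)

data Status (ℓ : ℕ) : Set where
  new live : Status ℓ
  dead : Fin ℓ → Status ℓ

-- A pseudorandomness condition: no color leaves a directed bipartite hole of size `s`. The two sets
-- may overlap.
Joined : {r m : ℕ} → ℕ → (Fin r → Fin m → Fin m → Bool) → Set
Joined {r} {m} s E = ∀ (c : Fin r) (p q : Fin m → Bool) → s ≤ cnt m p → s ≤ cnt m q →
  ∃[ a ] ∃[ b ] (p a ≡ true × q b ≡ true × E c a b ≡ true)

-- In the depth-first search a vertex with no arc of its next color into the new vertices dies.
-- The dead vertices waiting for the same color have no such arc into the new ones, so while many
-- vertices are new few are dead, and the live vertices form a long path.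
module LongPath {r ℓ m : ℕ} .{{_ : NonZero ℓ}} (Π : Vec (Fin r) ℓ) (s L : ℕ)
  (E : Fin r → Fin m → Fin m → Bool) (J : Joined s E) (room : L + s + ℓ * s ≤ m) where

  κ : ℕ → Fin r
  κ = color Π

  isNew : Status ℓ → Bool
  isNew new = true
  isNew _ = false

  isDead : Fin ℓ → Status ℓ → Bool
  isDead j (dead i) = does (i F.≟ j)
  isDead j _ = false

  set : (Fin m → Status ℓ) → Fin m → Status ℓ → Fin m → Status ℓ
  set st x v y = if does (y F.≟ x) then v else st y

  set-same : ∀ st x v → set st x v x ≡ v
  set-same st x v rewrite ≡ᵇ-refl x = refl

  set-other : ∀ st {x y} v → y ≢ x → set st x v y ≡ st y
  set-other st v h rewrite ≢ᵇ h = refl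

  -- The vertex `x` stands at position `length xs`, and the arc leaving it carries the color of that
  -- position.
  Chain : List (Fin m) → Set
  Chain [] = ⊤
  Chain (x ∷ []) = ⊤
  Chain (y ∷ x ∷ xs) = E (κ (length xs)) x y ≡ true × Chain (x ∷ xs)

  Chain-tail : ∀ {x} xs → Chain (x ∷ xs) → Chain xs
  Chain-tail [] _ = tt
  Chain-tail (y ∷ xs) (_ , c) = c

  record Inv (st : Fin m → Status ℓ) (xs : List (Fin m)) : Set where
    field
      chain : Chain xs
      unique : Unique xs
      lives : ∀ {x} → x ∈ xs → st x ≡ live
      complete : ∀ x → st x ≡ live → x ∈ xs
      stuck : ∀ j x y → st x ≡ dead j → st y ≡ new → E (lookup Π j) x y ≡ false

  #new : (Fin m → Status ℓ) → ℕ
  #new st = cnt m (λ x → isNew (st x))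

  isNew-sound : ∀ {v} → isNew v ≡ true → v ≡ new
  isNew-sound {new} _ = refl

  isDead-sound : ∀ {v j} → isDead j v ≡ true → v ≡ dead j
  isDead-sound {dead i} h = cong dead (≡ᵇ-sound h)

  ∑-∈ : (xs : List (Fin m)) → ∑ (allFin m) (λ x → ∑ xs (λ y → ⟦ does (x F.≟ y) ⟧)) ≤ length xs
  ∑-∈ xs = begin
    ∑ (allFin m) (λ x → ∑ xs (λ y → ⟦ does (x F.≟ y) ⟧)) ≡⟨ ∑-swap (allFin m) xs _ ⟩
    ∑ xs (λ y → cnt m (λ x → does (x F.≟ y))) ≤⟨ ∑-≤const xs (λ y → ≤-reflexive (cnt-≡ m y)) ⟩
    length xs * 1 ≡⟨ *-identityʳ _ ⟩
    length xs ∎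
    where
    open ≤-Reasoning

  partition-bound : ∀ {st xs} → Inv st xs →
    m ≤ #new st + length xs + ∑ (allFin ℓ) (λ j → cnt m (λ x → isDead j (st x)))
  partition-bound {st} {xs} I = begin
    m ≡⟨ sym (cnt-true m) ⟩
    ∑ (allFin m) (λ _ → 1) ≤⟨ ∑-mono (allFin m) pointwise ⟩
    ∑ (allFin m) (λ x → N x + P x + D x) ≡⟨ trans (∑-+ (allFin m) (λ x → N x + P x) D) (cong (_+ ∑ (allFin m) D) (∑-+ (allFin m) N P)) ⟩
    ∑ (allFin m) N + ∑ (allFin m) P + ∑ (allFin m) D
      ≤⟨ +-mono-≤ (+-monoʳ-≤ (∑ (allFin m) N) (∑-∈ xs)) (≤-reflexive (∑-swap (allFin m) (allFin ℓ) _)) ⟩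
    #new st + length xs + ∑ (allFin ℓ) (λ j → cnt m (λ x → isDead j (st x))) ∎
    where
    open ≤-Reasoning
    N P D : Fin m → ℕ
    N x = ⟦ isNew (st x) ⟧
    P x = ∑ xs (λ y → ⟦ does (x F.≟ y) ⟧)
    D x = ∑ (allFin ℓ) (λ j → ⟦ isDead j (st x) ⟧)
    pointwise : ∀ x → 1 ≤ N x + P x + D x
    pointwise x with st x in e
    ... | new = s≤s z≤n
    ... | live = m≤n⇒m≤n+o _ (≤-trans (≤-reflexive (sym (cong ⟦_⟧ (≡ᵇ-refl x))))
                   (∑-member (λ y → ⟦ does (x F.≟ y) ⟧) (Inv.complete I x e)))
    ... | dead j = m≤n⇒m≤o+n (P x) (≤-trans (≤-reflexive (sym (cong ⟦_⟧ (≡ᵇ-refl j))))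
                   (∑-member (λ i → ⟦ does (j F.≟ i) ⟧) (∈-allFin j)))

  -- No arc of color `lookup Π j` leads from the dead vertices of class `j` to the new ones, so by
  -- `Joined` these two sets cannot both be large.
  dead-few : ∀ {st xs} → Inv st xs → s ≤ #new st → ∀ j → cnt m (λ x → isDead j (st x)) ≤ s
  dead-few {st} I s≤ j with cnt m (λ x → isDead j (st x)) ≤? s
  ... | yes h = h
  ... | no h with J (lookup Π j) (λ x → isDead j (st x)) (λ x → isNew (st x)) (<⇒≤ (≰⇒> h)) s≤
  ...   | a , b , pa , pb , e = contradiction (trans (sym e) (Inv.stuck I j a b (isDead-sound pa) (isNew-sound pb))) λ ()

  -- Strict, so that after one new vertex joins the path at least `s` are still new and `dead-few`
  -- keeps applying.
  new-many : ∀ {st xs} → Inv st xs → length xs < L → s ≤ #new st → s < #new st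
  new-many {st} {xs} I short s≤ = +-cancelʳ-≤ (L + ℓ * s) (suc s) (#new st) (begin
    suc s + (L + ℓ * s) ≡⟨ cong suc (trans (sym (+-assoc s L _)) (cong (_+ ℓ * s) (+-comm s L))) ⟩
    suc (L + s + ℓ * s) ≤⟨ s≤s (≤-trans room (partition-bound I)) ⟩
    suc (#new st + length xs + ∑ (allFin ℓ) (λ j → cnt m (λ x → isDead j (st x))))
      ≤⟨ s≤s (+-monoʳ-≤ (#new st + length xs) (≤-trans (∑-≤const (allFin ℓ) (dead-few I s≤)) (≤-reflexive (cong (_* s) (length-allFin ℓ))))) ⟩
    suc (#new st + length xs + ℓ * s) ≡⟨ cong (_+ ℓ * s) (sym (+-suc (#new st) (length xs))) ⟩
    #new st + suc (length xs) + ℓ * s ≤⟨ +-monoˡ-≤ (ℓ * s) (+-monoʳ-≤ (#new st) short) ⟩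
    #new st + L + ℓ * s ≡⟨ +-assoc (#new st) L _ ⟩
    #new st + (L + ℓ * s) ∎)
    where open ≤-Reasoning

  extend : ∀ {st xs} y → Inv st xs → st y ≡ new → Chain (y ∷ xs) → Inv (set st y live) (y ∷ xs)
  extend {st} {xs} y I ny ch = record
    { chain = ch
    ; unique = All.tabulate (λ {x} x∈ e → y≢ x∈ (sym e)) ∷ Inv.unique I
    ; lives = λ { (here refl) → set-same st y live ; (there x∈) → trans (set-other st live (y≢ x∈)) (Inv.lives I x∈) }
    ; complete = comp
    ; stuck = stk }
    where
    y≢ : ∀ {x} → x ∈ xs → x ≢ y
    y≢ x∈ refl with () ← trans (sym (Inv.lives I x∈)) ny
    comp : ∀ x → set st y live x ≡ live → x ∈ (y ∷ xs)
    comp x e with x F.≟ y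
    ... | yes p = here p
    ... | no p = there (Inv.complete I x e)
    stk : ∀ j x z → set st y live x ≡ dead j → set st y live z ≡ new → E (lookup Π j) x z ≡ false
    stk j x z a b with x F.≟ y | z F.≟ y
    ... | no p | no q = Inv.stuck I j x z a b

  extend-fewer : ∀ st y → st y ≡ new → #new (set st y live) < #new st
  extend-fewer st y ny = ∑-mono-< le (∈-allFin y) lt
    where
    le : ∀ x → ⟦ isNew (set st y live x) ⟧ ≤ ⟦ isNew (st x) ⟧
    le x with x F.≟ y
    ... | yes p = z≤n
    ... | no p = ≤-refl
    lt : ⟦ isNew (set st y live y) ⟧ < ⟦ isNew (st y) ⟧
    lt rewrite set-same st y live | ny = s≤s z≤n

  retire : ∀ {st} x xs → Inv st (x ∷ xs) → (∀ y → st y ≡ new → E (κ (length xs)) x y ≡ false) →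
    Inv (set st x (dead (length xs mod ℓ))) xs
  retire {st} x xs I none with Inv.unique I
  ... | x∉ ∷ uniq = record
    { chain = Chain-tail xs (Inv.chain I)
    ; unique = uniq
    ; lives = λ {y} y∈ → trans (set-other st _ (λ e → All.lookup x∉ y∈ (sym e))) (Inv.lives I (there y∈))
    ; complete = comp
    ; stuck = stk }
    where
    comp : ∀ y → set st x (dead (length xs mod ℓ)) y ≡ live → y ∈ xs
    comp y e with y F.≟ x
    ... | no p with Inv.complete I y e
    ...   | here q = contradiction q p
    ...   | there q = q
    stk : ∀ j a z → set st x (dead (length xs mod ℓ)) a ≡ dead j → set st x (dead (length xs mod ℓ)) z ≡ new → E (lookup Π j) a z ≡ false
    stk j a z ea ez with a F.≟ x | z F.≟ x
    stk j a z refl ez | yes refl | no q = none z ez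
    stk j a z ea ez | no p | no q = Inv.stuck I j a z ea ez

  retire-same : ∀ st x v → st x ≡ live → isNew v ≡ false → #new (set st x v) ≡ #new st
  retire-same st x v lx nv = ∑-cong (allFin m) go
    where
    go : ∀ y → ⟦ isNew (set st x v y) ⟧ ≡ ⟦ isNew (st y) ⟧
    go y with y F.≟ x
    ... | yes refl rewrite lx | nv = refl
    ... | no p = refl

  extend-many : ∀ {st} y → st y ≡ new → s < #new st → s ≤ #new (set st y live)
  extend-many {st} y ny lt = ≤-pred (≤-trans lt (begin
    #new st ≤⟨ ∑-mono (allFin m) le ⟩
    ∑ (allFin m) (λ x → ⟦ isNew (set st y live x) ⟧ + ∑ (y ∷ []) (λ z → ⟦ does (x F.≟ z) ⟧))
      ≡⟨ ∑-+ (allFin m) _ _ ⟩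
    #new (set st y live) + ∑ (allFin m) (λ x → ∑ (y ∷ []) (λ z → ⟦ does (x F.≟ z) ⟧)) ≤⟨ +-monoʳ-≤ _ (∑-∈ (y ∷ [])) ⟩
    #new (set st y live) + 1 ≡⟨ +-comm _ 1 ⟩
    suc (#new (set st y live)) ∎))
    where
    open ≤-Reasoning
    le : ∀ x → ⟦ isNew (st x) ⟧ ≤ ⟦ isNew (set st y live x) ⟧ + ∑ (y ∷ []) (λ z → ⟦ does (x F.≟ z) ⟧)
    le x with x F.≟ y
    ... | yes p = ⟦⟧≤1 (isNew (st x))
    ... | no p = m≤m+n _ _

  -- The measure `2 * #new + length` falls at each move: extending trades a new vertex for one place
  -- on the stack, retiring shortens the stack and keeps the new vertices.
  search : (fuel : ℕ) → ∀ st xs → Inv st xs → s ≤ #new st → 2 * #new st + length xs < fuel →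
    ∃[ ys ] (L ≤ length ys × Chain ys × Unique ys)
  grow : (fuel : ℕ) → ∀ st xs y → Inv st xs → s < #new st → 2 * #new st + length xs < suc fuel →
    st y ≡ new → Chain (y ∷ xs) → ∃[ ys ] (L ≤ length ys × Chain ys × Unique ys)
  search (suc fuel) st xs I s≤ h with L ≤? length xs
  ... | yes long = xs , long , Inv.chain I , Inv.unique I
  search (suc fuel) st [] I s≤ h | no short =
    let lt = new-many I (≰⇒> short) s≤
        (y , ny) = cnt-member m (λ x → isNew (st x)) (≤-trans (s≤s z≤n) lt)
    in grow fuel st [] y I lt h (isNew-sound ny) tt
  search (suc fuel) st (x ∷ xs) I s≤ h | no short
    with any' (λ y → isNew (st y) ∧ E (κ (length xs)) x y) (allFin m) in e
  ... | true = let (y , _ , t) = any-true _ (allFin m) e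
                   (ny , arc) = ∧-true {isNew (st y)} t
               in grow fuel st (x ∷ xs) y I (new-many I (≰⇒> short) s≤) h (isNew-sound ny) (arc , Inv.chain I)
  ... | false = search fuel st' xs I' (≤-trans s≤ (≤-reflexive (sym same)))
      (≤-trans (≤-reflexive (trans (cong (λ z → suc (2 * z + length xs)) same) (sym (+-suc (2 * #new st) (length xs))))) (≤-pred h))
    where
    st' : Fin m → Status ℓ
    st' = set st x (dead (length xs mod ℓ))
    none : ∀ y → st y ≡ new → E (κ (length xs)) x y ≡ false
    none y ny with any-false (λ y → isNew (st y) ∧ E (κ (length xs)) x y) e (∈-allFin y)
    ... | q rewrite ny = q
    I' : Inv st' xs
    I' = retire x xs I none
    same : #new st' ≡ #new st
    same = retire-same st x _ (Inv.lives I (here refl)) refl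
  grow fuel st xs y I lt h ny ch = search fuel (set st y live) (y ∷ xs) (extend y I ny ch) (extend-many y ny lt)
    (≤-pred (begin
      suc (suc (2 * #new (set st y live) + suc (length xs))) ≡⟨ cong (λ z → suc (suc z)) (+-suc _ _) ⟩
      suc (suc (suc (2 * #new (set st y live) + length xs))) ≡⟨ cong (λ z → suc z + length xs) (sym (*-distribˡ-+ 2 1 (#new (set st y live)))) ⟩
      suc (2 * suc (#new (set st y live)) + length xs) ≤⟨ s≤s (+-monoˡ-≤ (length xs) (*-monoʳ-≤ 2 (extend-fewer st y ny))) ⟩
      suc (2 * #new st + length xs) ≤⟨ h ⟩
      suc fuel ∎))
    where open ≤-Reasoning

  found : ∃[ ys ] (L ≤ length ys × Chain ys × Unique ys)
  found = search _ (λ _ → new) [] start (≤-trans (≤-trans (m≤n+m s L) (m≤m+n (L + s) (ℓ * s))) (≤-trans room (≤-reflexive (sym (cnt-true m))))) ≤-refl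
    where
    start : Inv (λ _ → new) []
    start = record { chain = tt ; unique = [] ; lives = λ () ; complete = λ x () ; stuck = λ j x y () }

  path : Fin m → ℕ → Fin m
  path o = lastOr o (proj₁ found)

  path-injective : ∀ o {a b} → a < L → b < L → path o a ≡ path o b → a ≡ b
  path-injective o ha hb = let (ys , long , _ , u) = found in
    lastOr-injective o u (≤-trans ha long) (≤-trans hb long)

  chain-at : ∀ o y ys → Chain (y ∷ ys) → ∀ t → t < length ys →
    E (κ t) (lastOr o (y ∷ ys) t) (lastOr o (y ∷ ys) (suc t)) ≡ true
  chain-at o y (x ∷ xs) (e , c) t h with t ≟ length xs
  ... | yes refl rewrite <⇒≢ᵇ (n<1+n t) | ≡ᵇ-reflℕ t = e
  ... | no q = let h' = ≤∧≢⇒< (≤-pred h) q in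
    subst₂ (λ a b → E (κ t) a b ≡ true) (sym (lastOr-tail o y (x ∷ xs) h)) (sym (lastOr-tail o y (x ∷ xs) (s≤s h')))
      (chain-at o x xs c t h')

  path-arc : ∀ o t → suc t < L → E (κ t) (path o t) (path o (suc t)) ≡ true
  path-arc o t h = go (proj₁ found) (≤-trans h (proj₁ (proj₂ found))) (proj₁ (proj₂ (proj₂ found)))
    where
    go : ∀ ys → suc t < length ys → Chain ys → E (κ t) (lastOr o ys t) (lastOr o ys (suc t)) ≡ true
    go (y ∷ ys) (s≤s h) c = chain-at o y ys c t h

-- Colored trails and the paths of the statement

module _ {ℓ : ℕ} .{{_ : NonZero ℓ}} where

  toℕ-mod : ∀ a → toℕ (a mod ℓ) ≡ a % ℓ
  toℕ-mod a = toℕ-fromℕ< (m%n<n a ℓ)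

  color-cong : {r : ℕ} (Π : Vec (Fin r) ℓ) {a b : ℕ} → a % ℓ ≡ b % ℓ → color Π a ≡ color Π b
  color-cong Π {a} {b} e = cong (lookup Π) (toℕ-injective (trans (toℕ-mod a) (trans e (sym (toℕ-mod b)))))

  %-+ʳ : ∀ {a b} d → a % ℓ ≡ b % ℓ → (a + d) % ℓ ≡ (b + d) % ℓ
  %-+ʳ {a} {b} d e = trans (%-distribˡ-+ a d ℓ) (trans (cong (λ z → (z + d % ℓ) % ℓ) e) (sym (%-distribˡ-+ b d ℓ)))

lookup-injective : ∀ {n} {xs : List (Fin n)} → Unique xs →
  ∀ a b → lookup (fromList xs) a ≡ lookup (fromList xs) b → a ≡ b
lookup-injective {n} {xs} u = go xs u
  where
  lookup-∈ : ∀ (xs : List (Fin n)) a → lookup (fromList xs) a ∈ xs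
  lookup-∈ (x ∷ xs) fzero = here refl
  lookup-∈ (x ∷ xs) (fsuc a) = there (lookup-∈ xs a)
  go : ∀ xs → Unique xs → ∀ a b → lookup (fromList xs) a ≡ lookup (fromList xs) b → a ≡ b
  go (x ∷ xs) _ fzero fzero e = refl
  go (x ∷ xs) (x∉ ∷ _) fzero (fsuc b) e = contradiction e (All.lookup x∉ (lookup-∈ xs b))
  go (x ∷ xs) (x∉ ∷ _) (fsuc a) fzero e = contradiction (sym e) (All.lookup x∉ (lookup-∈ xs a))
  go (x ∷ xs) (_ ∷ u) (fsuc a) (fsuc b) e = cong fsuc (go xs u a b e)

module Trails {n r ℓ : ℕ} .{{_ : NonZero ℓ}} (Π : Vec (Fin r) ℓ) (In : Fin n → Fin n → Fin r → Set) where

  -- The index `p` is the pattern position of the first arc, reduced modulo `ℓ` only inside `color`.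
  -- The list omits the starting vertex.
  data Trail : ℕ → Fin n → List (Fin n) → Fin n → Set where
    stop : ∀ {p v} → Trail p v [] v
    step : ∀ {p x y xs v} → In x y (color Π p) → Trail (suc p) y xs v → Trail p x (y ∷ xs) v

  trail-last : ∀ {p x xs v} → Trail p x xs v → last (x ∷ fromList xs) ≡ v
  trail-last stop = refl
  trail-last (step _ t) = trail-last t

  trail-arc : ∀ {p x xs v} → Trail p x xs v → (j : Fin (length xs)) →
    In (lookup (x ∷ fromList xs) (inject₁ j)) (lookup (x ∷ fromList xs) (fsuc j)) (color Π (p + toℕ j))
  trail-arc {p} (step {x = x} {y} a t) fzero = subst (λ z → In x y (color Π z)) (sym (+-identityʳ p)) a
  trail-arc {p} (step {x = x} {y} {xs} a t) (fsuc j) =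
    subst (λ z → In (lookup (y ∷ fromList xs) (inject₁ j)) (lookup (fromList xs) j) (color Π z)) (sym (+-suc p (toℕ j))) (trail-arc t j)

  -- The long path visits P a, …, P b, in a block B which avoids the other ends of the first
  -- and last two arcs.
  module Connect (B : Fin n → Set) (P : ℕ → Fin n) {L : ℕ}
    (P∈B : ∀ t → B (P t)) (P-inj : ∀ {a b} → a < L → b < L → P a ≡ P b → a ≡ b)
    (P-arc : ∀ t → suc t < L → In (P t) (P (suc t)) (color Π t)) where

    -- Positions on the trail and on the long path agree only modulo `ℓ`. The remainder is therefore
    -- a continuation accepting every index of the right residue.
    segment : ∀ {p a v rest} d → p % ℓ ≡ a % ℓ → a + d < L →
      (∀ {q} → q % ℓ ≡ (a + d) % ℓ → Trail q (P (a + d)) rest v) →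
      Trail p (P a) (applyUpTo (λ i → P (a + suc i)) d ++ rest) v
    segment {p} {a} zero e h k = subst (λ z → Trail p (P z) _ _) (+-identityʳ a)
      (k (trans e (cong (_% ℓ) (sym (+-identityʳ a)))))
    segment {p} {a} {v} {rest} (suc d) e h k = step first
      (subst (λ w → Trail (suc p) (P (a + 1)) (w ++ rest) v) (applyUpTo-cong d (λ i → cong P (+-assoc a 1 (suc i))))
        (segment {suc p} {a + 1} d e' (subst (_< L) assoc' h)
          (λ {q} f → subst (λ z → Trail q (P z) rest v) assoc' (k (trans f (cong (_% ℓ) (sym assoc')))))))
      where
      assoc' : a + suc d ≡ a + 1 + d
      assoc' = sym (+-assoc a 1 d)
      e' : suc p % ℓ ≡ (a + 1) % ℓ
      e' = trans (cong (_% ℓ) (+-comm 1 p)) (%-+ʳ 1 e)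
      first : In (P a) (P (a + 1)) (color Π p)
      first = subst₂ (λ z c → In (P a) (P z) c) (+-comm 1 a) (color-cong Π (sym e))
        (P-arc a (≤-trans (s≤s (≤-trans (≤-reflexive (+-comm 1 a)) (+-monoʳ-≤ a (s≤s z≤n)))) h))
      applyUpTo-cong : ∀ {f g : ℕ → Fin n} d → (∀ i → f i ≡ g i) → applyUpTo f d ≡ applyUpTo g d
      applyUpTo-cong zero h = refl
      applyUpTo-cong (suc d) h = cong₂ _∷_ (h 0) (applyUpTo-cong d (λ i → h (suc i)))

    connect : ∀ {u w₁ x a d y w₂ v p} → a + d < L →
      In u w₁ (color Π p) → In w₁ x (color Π (p + 1)) → In x (P a) (color Π (p + 2)) → a % ℓ ≡ (p + 3) % ℓ →
      In (P (a + d)) y (color Π (a + d)) → In y w₂ (color Π (a + d + 1)) → In w₂ v (color Π (a + d + 2)) →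
      ¬ B u → ¬ B w₁ → ¬ B w₂ → ¬ B v → B x → B y → u ≢ w₁ → u ≢ w₂ → u ≢ v → w₁ ≢ w₂ → w₁ ≢ v → w₂ ≢ v →
      x ≢ y → (∀ t → x ≢ P t) → (∀ t → y ≢ P t) →
      ∃[ y ] ∃[ xs ] (Trail p u (y ∷ xs) v × Unique (u ∷ y ∷ xs))
    connect {u} {w₁} {x} {a} {d} {y} {w₂} {v} {p} h a₁ a₂ a₃ e a₄ a₅ a₆ ¬u ¬w₁ ¬w₂ ¬v Bx By u≢w₁ u≢w₂ u≢v w₁≢w₂ w₁≢v w₂≢v x≢y x≢P y≢P =
      w₁ , x ∷ (seg ++ end) ,
      step a₁ (subst (λ z → Trail z w₁ (x ∷ (seg ++ end)) v) (+-comm p 1)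
        (step a₂ (subst (λ z → Trail z x (seg ++ end) v) (+-suc p 1)
          (step a₃ (subst (λ z → Trail z (P a) (applyUpTo (λ i → P (a + suc i)) d ++ end) v) (+-suc p 2)
            (segment d (sym e) h tail')))))) ,
      -- The four outer vertices avoid `B` and all others lie in it, so only comparisons within
      -- these two groups need an argument of their own.
      ((u≢w₁ ∷ out ¬u Bx ∷ AllP.++⁺ (segAll (λ t → out ¬u (P∈B t))) (out ¬u By ∷ u≢w₂ ∷ u≢v ∷ []))
       ∷ (out ¬w₁ Bx ∷ AllP.++⁺ (segAll (λ t → out ¬w₁ (P∈B t))) (out ¬w₁ By ∷ w₁≢w₂ ∷ w₁≢v ∷ []))
       ∷ AllP.++⁺ (segAll x≢P) (x≢y ∷ (λ q → out ¬w₂ Bx (sym q)) ∷ (λ q → out ¬v Bx (sym q)) ∷ [])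
       ∷ AllPairsP.++⁺ segUnique ((((λ q → out ¬w₂ By (sym q)) ∷ (λ q → out ¬v By (sym q)) ∷ []) ∷ (w₂≢v ∷ []) ∷ [] ∷ []))
           (segAll (λ t → (λ q → y≢P t (sym q)) ∷ (λ q → out ¬w₂ (P∈B t) (sym q)) ∷ (λ q → out ¬v (P∈B t) (sym q)) ∷ [])))
      where
      seg end : List (Fin n)
      seg = P a ∷ applyUpTo (λ i → P (a + suc i)) d
      end = y ∷ w₂ ∷ v ∷ []
      out : ∀ {s t} → ¬ B s → B t → s ≢ t
      out ¬s Bt refl = ¬s Bt
      tail' : ∀ {q} → q % ℓ ≡ (a + d) % ℓ → Trail q (P (a + d)) end v
      tail' {q} f = step (subst (In _ _) (color-cong Π (sym f)) a₄)
        (step (subst (In _ _) (color-cong Π (trans (sym (%-+ʳ 1 f)) (cong (_% ℓ) (+-comm q 1)))) a₅)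
        (step (subst (In _ _) (color-cong Π (trans (sym (%-+ʳ 2 f)) (cong (_% ℓ) (+-comm q 2)))) a₆) stop))
      segAll : ∀ {R : Fin n → Set} → (∀ t → R (P t)) → All R seg
      segAll k = k a ∷ AllP.applyUpTo⁺₁ _ d (λ {i} _ → k (a + suc i))
      bound : ∀ {i} → i < d → a + suc i < L
      bound {i} i<d = ≤-trans (s≤s (+-monoʳ-≤ a i<d)) h
      segUnique : Unique seg
      segUnique = AllP.applyUpTo⁺₁ _ d (λ {i} i<d q → m≢1+m+n a
          (trans (P-inj (≤-trans (s≤s (m≤m+n a d)) h) (bound i<d) q) (+-suc a i)))
        ∷ applyUpTo⁺₁ _ d (λ {i} {j} i<j j<d q → <⇒≢ i<j (suc-injective
            (+-cancelˡ-≡ a (suc i) (suc j) (P-inj (bound (<-trans i<j j<d)) (bound j<d) q))))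

module _ {n r ℓ : ℕ} .{{_ : NonZero ℓ}} (Π : Vec (Fin r) ℓ) (ω : Outcome n r) (i : ℕ) where

  open Trails Π (ArcIn ω i)

  -- The shift in the definition of a colored path is the residue of the starting index.
  trail⇒PiPath : ∀ {p u y xs v} → Trail p u (y ∷ xs) v → Unique (u ∷ y ∷ xs) → PiPath Π ω i u v
  trail⇒PiPath {p} {u} {y} {xs} t uniq =
    _ , u ∷ fromList (y ∷ xs) , p mod ℓ , s≤s z≤n , refl , trail-last t , lookup-injective uniq ,
    λ j → subst (ArcIn ω i _ _) (color-cong Π (residue (toℕ j))) (trail-arc t j)
    where
    residue : ∀ j → (p + j) % ℓ ≡ (j + toℕ (p mod ℓ)) % ℓ
    residue j = trans (%-+ʳ j (sym (trans (cong (_% ℓ) (toℕ-mod p)) (m%n%n≡m%n p ℓ)))) (cong (_% ℓ) (+-comm (toℕ (p mod ℓ)) j))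

  PiPath⇒out : ∀ {u v} → PiPath Π ω i u v → ∃[ w ] ∃[ c ] ArcIn ω i u w c
  PiPath⇒out (suc k , x ∷ xs , l , _ , refl , _ , _ , arcs) = _ , _ , arcs fzero

  PiPath⇒in : ∀ {u v} → PiPath Π ω i u v → ∃[ w ] ∃[ c ] ArcIn ω i w v c
  PiPath⇒in (suc k , xs , l , _ , _ , refl , _ , arcs) =
    _ , _ , subst (λ z → ArcIn ω i (lookup xs (inject₁ (fromℕ k))) z (lookup Π ((toℕ (fromℕ k) + toℕ l) mod ℓ)))
      (lookup-last xs) (arcs (fromℕ k))
    where
    lookup-last : ∀ {k} (xs : Vec (Fin n) (suc k)) → lookup xs (fromℕ k) ≡ last xs
    lookup-last (x ∷ []) = refl
    lookup-last (x ∷ y ∷ xs) = lookup-last (y ∷ xs)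

  -- A second vertex exists; the last arc of a path from it to `v` and the first arc of a path back
  -- witness the two degrees. So connectivity cannot precede the degree condition.
  PiConnected⇒MinInOut1 : 2 ≤ n → PiConnected Π ω i → MinInOut1 ω i
  PiConnected⇒MinInOut1 (s≤s (s≤s _)) C v = let (u , u≢v) = other v in
    PiPath⇒in (C u v u≢v) , PiPath⇒out (C v u (λ e → u≢v (sym e)))
    where
    other : ∀ {k} (v : Fin (suc (suc k))) → ∃[ u ] u ≢ v
    other fzero = fsuc fzero , λ ()
    other (fsuc v) = fzero , λ ()

-- Blocks of vertices and failure events

-- There are D * K labels. Each of the five blocks has three classes of m vertices: the first contains the
-- long path, the others its entry and exit points. At most b₀ vertices may be bad.
record Frame (r ℓ : ℕ) : Set where
  field
    Π : Vec (Fin r) ℓ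
    n m s D K b₀ : ℕ
    1≤r : 1 ≤ r
    2≤D : 2 ≤ D
    1≤K : 1 ≤ K
    origin : Fin m
    room : (s * ℓ + s * ℓ) + s + ℓ * s ≤ m
    blk : Fin 5 → Fin 3 → Fin m → Fin n
    pt : Fin n → ℕ
    pt-blk : ∀ i c x → pt (blk i c x) ≡ toℕ i
    blk-injective : ∀ i {c c' x x'} → blk i c x ≡ blk i c' x' → c ≡ c' × x ≡ x'

data Dir : Set where
  fwd bwd : Dir

<ᵇ-sound : ∀ {a b} → (a <ᵇ b) ≡ true → a < b
<ᵇ-sound {zero} {suc b} _ = s≤s z≤n
<ᵇ-sound {suc a} {suc b} h = s≤s (<ᵇ-sound h)

<ᵇ-complete : ∀ {a b} → a < b → (a <ᵇ b) ≡ true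
<ᵇ-complete {zero} {suc b} _ = refl
<ᵇ-complete {suc a} {suc b} (s≤s h) = <ᵇ-complete h

≤ᵇ-complete : ∀ {a b} → a ≤ b → (a ≤ᵇ b) ≡ true
≤ᵇ-complete {zero} _ = refl
≤ᵇ-complete {suc a} h = <ᵇ-complete h

≤ᵇ-sound : ∀ {a b} → (a ≤ᵇ b) ≡ true → a ≤ b
≤ᵇ-sound {zero} _ = z≤n
≤ᵇ-sound {suc a} h = <ᵇ-sound h

≡ᵇ-soundℕ : ∀ {a b} → (a ≡ᵇ b) ≡ true → a ≡ b
≡ᵇ-soundℕ {zero} {zero} _ = refl
≡ᵇ-soundℕ {suc a} {suc b} h = cong suc (≡ᵇ-soundℕ h)

cnt-image : ∀ {s m} (g : Fin s → Fin m) → (∀ {a b} → g a ≡ g b → a ≡ b) → (p : Fin m → Bool) →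
  (∀ z → p (g z) ≡ true) → s ≤ cnt m p
cnt-image {s} {m} g inj p h = begin
  s ≡⟨ sym (cnt-true s) ⟩
  ∑ (allFin s) (λ _ → 1) ≤⟨ ∑-mono (allFin s) (λ z → ≤-trans (≤-reflexive (sym (trans (cong₂ _*_ (cong ⟦_⟧ (h z)) (cong ⟦_⟧ (≡ᵇ-refl (g z)))) refl)))
      (∑-member (λ y → ⟦ p y ⟧ * ⟦ does (y F.≟ g z) ⟧) (∈-allFin (g z)))) ⟩
  ∑ (allFin s) (λ z → ∑ (allFin m) (λ y → ⟦ p y ⟧ * ⟦ does (y F.≟ g z) ⟧)) ≡⟨ ∑-swap (allFin s) (allFin m) _ ⟩
  ∑ (allFin m) (λ y → ∑ (allFin s) (λ z → ⟦ p y ⟧ * ⟦ does (y F.≟ g z) ⟧)) ≡⟨ ∑-cong (allFin m) (λ y → ∑-*ˡ ⟦ p y ⟧ (allFin s) _) ⟩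
  ∑ (allFin m) (λ y → ⟦ p y ⟧ * cnt s (λ z → does (y F.≟ g z))) ≤⟨ ∑-mono (allFin m) (λ y → ≤-trans (*-monoʳ-≤ ⟦ p y ⟧ (one s g inj y)) (≤-reflexive (*-identityʳ _))) ⟩
  cnt m p ∎
  where
  open ≤-Reasoning
  one : ∀ s (g : Fin s → Fin m) → (∀ {a b} → g a ≡ g b → a ≡ b) → ∀ y → cnt s (λ z → does (y F.≟ g z)) ≤ 1
  one zero g inj y = z≤n
  one (suc s) g inj y with y F.≟ g fzero | ∑-allFin-suc s (λ z → ⟦ does (y F.≟ g z) ⟧)
  ... | yes refl | e = ≤-reflexive (trans e (cong suc
          (trans (∑-cong (allFin s) (λ z → cong ⟦_⟧ (≢ᵇ {a = g fzero} {g (fsuc z)} (λ q → contradiction (inj q) λ ())))) (trans (∑-const (allFin s) 0) (*-zeroʳ (length (allFin s)))))))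
  ... | no q | e = ≤-trans (≤-reflexive e) (one s (λ z → g (fsuc z)) (λ e → fsuc-inj (inj e)) y)
    where
    fsuc-inj : ∀ {k} {a b : Fin k} → fsuc a ≡ fsuc b → a ≡ b
    fsuc-inj refl = refl

abstract
  parts : List (Fin 5)
  parts = allFin 5

  ∈-parts : ∀ i → i ∈ parts
  ∈-parts = ∈-allFin

  length-parts : length parts ≡ 5
  length-parts = refl

module Setup {r ℓ : ℕ} .{{_ : NonZero ℓ}} (Fr : Frame r ℓ) where

  open Frame Fr public

  A : Set
  A = Fin (D * K) × Fin r

  labels : List A
  labels = cartesianProduct (allFin (D * K)) (allFin r)

  ∑-labels : (p : Fin (D * K) → Bool) (q : Fin r → Bool) →
    ∑ labels (λ a → ⟦ p (proj₁ a) ∧ q (proj₂ a) ⟧) ≡ cnt (D * K) p * cnt r q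
  ∑-labels p q = trans (∑-cartesian _,_ (allFin (D * K)) (allFin r) _)
    (trans (∑-cong (allFin (D * K)) (λ i → trans (∑-cong (allFin r) (λ c → ⟦∧⟧ (p i) (q c))) (∑-*ˡ ⟦ p i ⟧ (allFin r) _)))
      (∑-*ʳ (cnt r q) (allFin (D * K)) _))

  length-labels : length labels ≡ D * K * r
  length-labels = trans (length≡∑ labels) (trans (∑-labels (λ _ → true) (λ _ → true)) (cong₂ _*_ (cnt-true (D * K)) (cnt-true r)))

  labels>0 : 0 < length labels
  labels>0 = subst (0 <_) (sym length-labels) (*-mono-≤ {1} {D * K} {1} (*-mono-≤ {1} {D} {1} (<⇒≤ 2≤D) 1≤K) 1≤r)

  open Matrices n labels labels>0 public

  -- Early labels have density 1/D, mid labels (the early ones included) density 2/D, and the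
  -- hitting time almost always lies between the last early and the last mid label.
  early : A → Bool
  early a = toℕ (proj₁ a) <ᵇ K

  earlyIn : Fin r → A → Bool
  earlyIn c a = early a ∧ does (proj₂ a F.≟ c)

  mid : A → Bool
  mid a = toℕ (proj₁ a) <ᵇ 2 * K

  K≤DK : K ≤ D * K
  K≤DK = ≤-trans (≤-reflexive (sym (+-identityʳ K))) (*-monoˡ-≤ K (<⇒≤ 2≤D))

  early-density : Density early 1 D
  early-density = begin
    ∑ labels (λ a → ⟦ early a ⟧) * D ≡⟨ cong (_* D) (∑-cong labels (λ a → cong ⟦_⟧ (sym (∧-identityʳ (early a))))) ⟩
    ∑ labels (λ a → ⟦ early a ∧ true ⟧) * D ≡⟨ cong (_* D) (∑-labels (λ i → toℕ i <ᵇ K) (λ _ → true)) ⟩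
    cnt (D * K) (λ i → toℕ i <ᵇ K) * cnt r (λ _ → true) * D ≡⟨ cong (_* D) (cong₂ _*_ (cnt-< (D * K) K K≤DK) (cnt-true r)) ⟩
    K * r * D ≡⟨ solve 3 (λ d k r → k :* r :* d := con 1 :* (d :* k :* r)) refl D K r ⟩
    1 * (D * K * r) ≡⟨ cong (1 *_) (sym length-labels) ⟩
    1 * length labels ∎
    where open ≡-Reasoning

  mid-density : Density mid 2 D
  mid-density = begin
    ∑ labels (λ a → ⟦ mid a ⟧) * D ≡⟨ cong (_* D) (∑-cong labels (λ a → cong ⟦_⟧ (sym (∧-identityʳ (mid a))))) ⟩
    ∑ labels (λ a → ⟦ mid a ∧ true ⟧) * D ≡⟨ cong (_* D) (∑-labels (λ i → toℕ i <ᵇ 2 * K) (λ _ → true)) ⟩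
    cnt (D * K) (λ i → toℕ i <ᵇ 2 * K) * cnt r (λ _ → true) * D ≡⟨ cong (_* D) (cong₂ _*_ (cnt-< (D * K) (2 * K) (*-monoˡ-≤ K 2≤D)) (cnt-true r)) ⟩
    2 * K * r * D ≡⟨ solve 3 (λ d k r → con 2 :* k :* r :* d := con 2 :* (d :* k :* r)) refl D K r ⟩
    2 * (D * K * r) ≡⟨ cong (2 *_) (sym length-labels) ⟩
    2 * length labels ∎
    where open ≡-Reasoning

  earlyIn-density : ∀ c → Density (earlyIn c) 1 (D * r)
  earlyIn-density c = begin
    ∑ labels (λ a → ⟦ earlyIn c a ⟧) * (D * r) ≡⟨ cong (_* (D * r)) (∑-labels (λ i → toℕ i <ᵇ K) (λ x → does (x F.≟ c))) ⟩
    cnt (D * K) (λ i → toℕ i <ᵇ K) * cnt r (λ x → does (x F.≟ c)) * (D * r) ≡⟨ cong (_* (D * r)) (cong₂ _*_ (cnt-< (D * K) K K≤DK) (cnt-≡ r c)) ⟩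
    K * 1 * (D * r) ≡⟨ solve 3 (λ d k r → k :* con 1 :* (d :* r) := con 1 :* (d :* k :* r)) refl D K r ⟩
    1 * (D * K * r) ≡⟨ cong (1 *_) (sym length-labels) ⟩
    1 * length labels ∎
    where open ≡-Reasoning

  not-density : ∀ {p num den} → Density p num den → Density (λ a → not (p a)) (den ∸ num) den
  not-density {p} {num} {den} h = begin
    ∑ labels (λ a → ⟦ not (p a) ⟧) * den ≡⟨ sym (m+n∸m≡n (num * N) _) ⟩
    num * N + S' * den ∸ num * N ≡⟨ cong (λ z → z + S' * den ∸ num * N) (sym h) ⟩
    S * den + S' * den ∸ num * N ≡⟨ cong (_∸ num * N) (sym (*-distribʳ-+ den S S')) ⟩
    (S + S') * den ∸ num * N ≡⟨ cong (λ z → z * den ∸ num * N) whole ⟩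
    N * den ∸ num * N ≡⟨ cong (_∸ num * N) (*-comm N den) ⟩
    den * N ∸ num * N ≡⟨ sym (*-distribʳ-∸ N den num) ⟩
    (den ∸ num) * N ∎
    where
    open ≡-Reasoning
    N = length labels
    S = ∑ labels (λ a → ⟦ p a ⟧)
    S' = ∑ labels (λ a → ⟦ not (p a) ⟧)
    whole : S + S' ≡ N
    whole = trans (sym (∑-+ labels _ _)) (trans (∑-cong labels (λ a → ⟦not⟧ (p a))) (sym (length≡∑ labels)))

  Block : Set
  Block = Vec (Vec A m) m

  sub : Mat → (Fin m → Fin n) → (Fin m → Fin n) → Block
  sub f α β = tabulate (λ a → tabulate (λ b → f ⟨ α a , β b ⟩))

  sub-at : ∀ f α β a b → lookup (lookup (sub f α β) a) b ≡ f ⟨ α a , β b ⟩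
  sub-at f α β a b = trans (cong (λ row → lookup row b) (lookup∘tabulate (λ a → tabulate (λ b → f ⟨ α a , β b ⟩)) a))
    (lookup∘tabulate (λ b → f ⟨ α a , β b ⟩) b)

  arc : Block → Fin r → Fin m → Fin m → Bool
  arc g c a b = earlyIn c (lookup (lookup g a) b)

  members : Vec Bool m → List (Fin m)
  members S = filterᵇ (lookup S) (allFin m)

  disjoined : Block → Fin r → Vec Bool m → Vec Bool m → Bool
  disjoined g c S T = ((s ≤ᵇ cnt m (lookup S)) ∧ (s ≤ᵇ cnt m (lookup T))) ∧
    all' (λ ab → not (arc g c (proj₁ ab) (proj₂ ab))) (cartesianProduct (members S) (members T))

  subsets : List (Vec Bool m)
  subsets = enumV m (true ∷ false ∷ [])

  ∈-subsets : ∀ S → S ∈ subsets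
  ∈-subsets = ∈-enumV λ { true → here refl ; false → there (here refl) }

  -- A count rather than a truth value, so that its average is directly the union bound over a color
  -- and two sets.
  #disjoined : Block → ℕ
  #disjoined g = ∑ (allFin r) (λ c → ∑ subsets (λ S → ∑ subsets (λ T → ⟦ disjoined g c S T ⟧)))

  joined : ∀ g → #disjoined g ≡ 0 → Joined s (arc g)
  joined g e c p q s≤p s≤q =
    let ((a , b) , ab∈ , h) = all-false (λ ab → not (arc g c (proj₁ ab) (proj₂ ab))) (cartesianProduct (members S) (members T)) none
        (a∈ , b∈) = ∈-cartesianProduct⁻ (members S) (members T) ab∈
    in a , b , trans (sym (lookup∘tabulate p a)) (proj₂ (∈-filterᵇ⁻ (lookup S) (allFin m) a∈)) ,
       trans (sym (lookup∘tabulate q b)) (proj₂ (∈-filterᵇ⁻ (lookup T) (allFin m) b∈)) , not-false h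
    where
    S T : Vec Bool m
    S = tabulate p
    T = tabulate q
    size : (p : Fin m → Bool) → s ≤ cnt m p → (s ≤ᵇ cnt m (lookup (tabulate p))) ≡ true
    size p h = ≤ᵇ-complete (≤-trans h (≤-reflexive (∑-cong (allFin m) (λ x → cong ⟦_⟧ (sym (lookup∘tabulate p x))))))
    zero! : disjoined g c S T ≡ false
    zero! = ⟦⟧≡0 (∑≡0 (λ T → ⟦ disjoined g c S T ⟧) (∑≡0 (λ S → ∑ subsets (λ T → ⟦ disjoined g c S T ⟧))
      (∑≡0 _ e (∈-allFin c)) (∈-subsets S)) (∈-subsets T))
    none : all' (λ ab → not (arc g c (proj₁ ab) (proj₂ ab))) (cartesianProduct (members S) (members T)) ≡ false
    none with zero!
    ... | z rewrite size p s≤p | size q s≤q = z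

  -- A function of the arcs inside one block, hence unchanged when arcs at outside vertices are
  -- resampled. The constant value in the failing case makes it defined for every matrix.
  pathOf : Block → ℕ → Fin m
  pathOf g with #disjoined g ≟ 0
  ... | yes e = LongPath.path Π s (s * ℓ + s * ℓ) (arc g) (joined g e) room origin
  ... | no _ = λ _ → origin

  pathOf-injective : ∀ g → #disjoined g ≡ 0 → ∀ {a b} → a < s * ℓ + s * ℓ → b < s * ℓ + s * ℓ → pathOf g a ≡ pathOf g b → a ≡ b
  pathOf-injective g e ha hb q with #disjoined g ≟ 0
  ... | yes e' = LongPath.path-injective Π s (s * ℓ + s * ℓ) (arc g) (joined g e') room origin ha hb q
  ... | no ¬e = contradiction e ¬e

  pathOf-arc : ∀ g → #disjoined g ≡ 0 → ∀ t → suc t < s * ℓ + s * ℓ → arc g (color Π t) (pathOf g t) (pathOf g (suc t)) ≡ true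
  pathOf-arc g e t h with #disjoined g ≟ 0
  ... | yes e' = LongPath.path-arc Π s (s * ℓ + s * ℓ) (arc g) (joined g e') room origin t h
  ... | no ¬e = contradiction e ¬e

  spine : Fin 5 → Fin m → Fin n
  spine i = blk i fzero

  path : Fin 5 → Mat → ℕ → Fin n
  path i f t = spine i (pathOf (sub f (spine i) (spine i)) t)

  cell : Dir → Fin n → Fin n → Cell n
  cell fwd u v = u , v
  cell bwd u v = v , u

  hub : Dir → Fin 5 → Fin m → Fin n
  hub fwd i = blk i (fsuc fzero)
  hub bwd i = blk i (fsuc (fsuc fzero))

  -- Entry points lie in the first half of the long path, exit points in the second.
  station : Dir → ℕ → Fin s → ℕ
  station fwd j z = (j + 2) % ℓ + toℕ z * ℓ
  station bwd j z = j % ℓ + (s + toℕ z) * ℓ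

  -- Forwards, `w → hub → path` uses positions `j` and `j + 1` and enters the path at residue
  -- `j + 2`. Backwards, `path → hub → w` leaves it at residue `j` and uses `j` and `j + 1`.
  inner outer : Dir → ℕ → Fin r
  inner fwd j = color Π (j + 1)
  inner bwd j = color Π j
  outer fwd j = color Π j
  outer bwd j = color Π (j + 1)

  linked : Dir → Fin 5 → ℕ → Mat → Fin m → Bool
  linked d i j f x = any' (λ z → earlyIn (inner d j) (f ⟨ cell d (hub d i x) (path i f (station d j z)) ⟩)) (allFin s)

  -- The first conjunct makes the event rare whatever the block looks like: too few linked hubs make
  -- no vertex bad, as that case is charged to `Eᶜ`.
  badAt : Dir → Fin 5 → ℕ → Mat → Fin n → Bool
  badAt d i j f w = (m ≤ᵇ cnt m (linked d i j f) + s) ∧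
    all' (λ x → not (earlyIn (outer d j) (f ⟨ cell d w (hub d i x) ⟩))) (filterᵇ (linked d i j f) (allFin m))

  inPart : Fin 5 → Fin n → Bool
  inPart i w = toℕ i ≡ᵇ pt w

  -- For `w` outside the block, the arcs tested at `w` are disjoint from those that fix the path and
  -- its linked hubs.
  badFor : Dir → Fin 5 → Mat → Fin n → Bool
  badFor d i f w = not (inPart i w) ∧ any' (λ j → badAt d i (toℕ j) f w) (allFin ℓ)

  -- Excluding the blocks of u and v makes this independent of the arcs out of u and into v.
  bad : Dir → (Fin 5 → Bool) → Mat → Fin n → Bool
  bad d ex f w = any' (λ i → not (ex i) ∧ badFor d i f w) parts

  -- Counting pairs of a vertex and a block bounds the bad vertices for all choices of excluded
  -- blocks at once.
  #bad : Dir → Mat → ℕ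
  #bad d f = ∑ (allFin n) (λ w → ∑ parts (λ i → ⟦ badFor d i f w ⟧))

  bad≤#bad : ∀ d ex f → cnt n (bad d ex f) ≤ #bad d f
  bad≤#bad d ex f = ∑-mono (allFin n) (λ w → ≤-trans (⟦any⟧≤ (λ i → not (ex i) ∧ badFor d i f w) parts)
    (∑-mono parts {λ i → ⟦ not (ex i) ∧ badFor d i f w ⟧} {λ i → ⟦ badFor d i f w ⟧}
      (λ i → ⟦⟧-mono (λ h → proj₂ (∧-true {not (ex i)} {badFor d i f w} h)))))

  only : Fin n → Fin 5 → Bool
  only u i = inPart i u

  both : Fin n → Fin n → Fin 5 → Bool
  both u v i = inPart i u ∨ inPart i v

  vertices : List (Fin n)
  vertices = allFin n

  but : Fin n → Fin n → Bool
  but u w = not (does (w F.≟ u))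

  but₃ : Fin n → Fin n → Fin n → Fin n → Bool
  but₃ u v w x = (but u x ∧ but v x) ∧ but w x

  goodBut : Dir → Fin n → Mat → Fin n → Bool
  goodBut d u f w = but u w ∧ not (bad d (only u) f w)

  goodBut₃ : Dir → Fin n → Fin n → Fin n → Mat → Fin n → Bool
  goodBut₃ d u v w f x = but₃ u v w x ∧ not (bad d (both u v) f x)

  allEarly : Mat → Bool
  allEarly f = all' (λ u → any' (λ v → early (f ⟨ u , v ⟩)) (filterᵇ (but u) vertices)) vertices

  idle : Dir → Mat → Fin n → Bool
  idle d f u = all' (λ v → not (mid (f ⟨ cell d u v ⟩))) (filterᵇ (but u) vertices)

  disjoinedIn : Mat → Fin 5 → ℕ
  disjoinedIn f i = #disjoined (sub f (spine i) (spine i)) +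
    (#disjoined (sub f (hub fwd i) (spine i)) + #disjoined (sub f (spine i) (hub bwd i)))

  spread : Mat → ℕ
  spread f = ∑ parts (disjoinedIn f)

  -- The first conjunct holds once at most `b₀` vertices are bad. Inside the event it guarantees,
  -- whatever is held fixed, that many resampled arcs have to miss the early labels.
  trapped : Dir → Mat → Fin n → Fin n → Bool
  trapped d f u w = ((n ∸ 1 ≤ᵇ cnt n (goodBut d u f) + b₀) ∧ (but u w ∧ bad d (only u) f w)) ∧ (mid (f ⟨ cell d u w ⟩) ∧
    all' (λ x → not (early (f ⟨ cell d u x ⟩))) (filterᵇ (goodBut d u f) vertices))

  -- Nothing is asked of the quality of `w`: even a good `w` is an obstacle, since a path cannot
  -- visit it twice and the two arcs at `w` need not carry consecutive pattern colors.
  cherry : Mat → Fin n → Fin n → Fin n → Bool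
  cherry f u v w = ((((but u v ∧ but u w) ∧ but v w) ∧
    ((n ∸ 3 ≤ᵇ cnt n (goodBut₃ fwd u v w f) + b₀) ∧ (n ∸ 3 ≤ᵇ cnt n (goodBut₃ bwd u v w f) + b₀))) ∧
    (mid (f ⟨ u , w ⟩) ∧ mid (f ⟨ w , v ⟩))) ∧
    (all' (λ x → not (early (f ⟨ u , x ⟩))) (filterᵇ (goodBut₃ fwd u v w f) vertices) ∧
     all' (λ x → not (early (f ⟨ x , v ⟩))) (filterᵇ (goodBut₃ bwd u v w f) vertices))

  -- Outside Eᵃ all early arcs are present at the hitting time, and outside Eᵇ all arcs present then
  -- are mid. Eᶜ is the failure of joinedness. Eᵈ counts too many bad vertices, Eᵉ the vertices whose
  -- arcs all lead to bad vertices, Eᶠ the pairs u, v whose only usable arcs meet in a vertex w.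
  Eᵃ Eᶜ Eᶠ failure : Mat → ℕ
  Eᵇ Eᵈ Eᵉ both-dirs : Dir → Mat → ℕ
  Eᵃ f = ⟦ allEarly f ⟧
  Eᵇ d f = ∑ vertices (λ u → ⟦ idle d f u ⟧)
  Eᶜ f = spread f
  Eᵈ d f = ⟦ b₀ <ᵇ #bad d f ⟧
  Eᵉ d f = ∑ vertices (λ u → ∑ vertices (λ w → ⟦ trapped d f u w ⟧))
  Eᶠ f = ∑ vertices (λ u → ∑ vertices (λ v → ∑ vertices (λ w → ⟦ cherry f u v w ⟧)))
  both-dirs d f = Eᵇ d f + (Eᵈ d f + Eᵉ d f)
  failure f = Eᵃ f + (Eᶜ f + (Eᶠ f + (both-dirs fwd f + both-dirs bwd f)))

fresh : ∀ {k} (vs : Vec ℕ k) → ∃[ i ] (∀ j → toℕ {suc k} i ≢ lookup vs j)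
fresh {k} vs = let (i , h) = ¬∀⟶∃¬ (suc k) Hit hit? not-all in i , λ j e → h (j , e)
  where
  Hit : Fin (suc k) → Set
  Hit i = ∃[ j ] toℕ i ≡ lookup vs j
  hit? : ∀ i → Dec (Hit i)
  hit? i = any? (λ j → toℕ i ≟ lookup vs j)
  not-all : ¬ (∀ i → Hit i)
  not-all all with pigeonhole (n<1+n k) (λ i → proj₁ (all i))
  ... | i , j , i<j , e = <⇒≢ i<j (trans (proj₂ (all i)) (trans (cong (lookup vs) e) (sym (proj₂ (all j)))))

false-not : ∀ {b} → b ≡ false → not b ≡ true
false-not refl = refl

true⊎false : ∀ b → b ≡ true ⊎ b ≡ false
true⊎false true = inj₁ refl
true⊎false false = inj₂ refl

bool-case : (b : Bool) {P : Set} → (b ≡ true → P) → (b ≡ false → P) → P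
bool-case true t f = t refl
bool-case false t f = f refl

∧-false : ∀ {a b} → a ∧ b ≡ false → a ≡ true → b ≡ false
∧-false h refl = h

∨-false : ∀ {a b} → a ∨ b ≡ false → a ≡ false × b ≡ false
∨-false {false} {false} _ = refl , refl

false∨ : ∀ {a b} → a ≡ false → b ≡ false → a ∨ b ≡ false
false∨ refl refl = refl

≢ᵇℕ : ∀ {a b} → a ≢ b → (a ≡ᵇ b) ≡ false
≢ᵇℕ {a} {b} h with a ≡ᵇ b in e
... | false = refl
... | true = contradiction (≡ᵇ-soundℕ e) h

-- Connecting two vertices when no failure occurs

module Deterministic {r ℓ : ℕ} .{{_ : NonZero ℓ}} (Fr : Frame r ℓ) where

  open Setup Fr

  L : ℕ
  L = s * ℓ + s * ℓ

  offset : Dir → ℕ → ℕ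
  offset fwd j = (j + 2) % ℓ
  offset bwd j = j % ℓ

  shift : Dir → ℕ
  shift fwd = 0
  shift bwd = s

  station-≡ : ∀ d j z → station d j z ≡ offset d j + (shift d + toℕ z) * ℓ
  station-≡ fwd j z = refl
  station-≡ bwd j z = refl

  offset<ℓ : ∀ d j → offset d j < ℓ
  offset<ℓ fwd j = m%n<n (j + 2) ℓ
  offset<ℓ bwd j = m%n<n j ℓ

  station-< : ∀ d j z → station d j z < (shift d + s) * ℓ
  station-< d j z = subst (_< (shift d + s) * ℓ) (sym (station-≡ d j z)) (begin
    suc (offset d j) + (shift d + toℕ z) * ℓ ≤⟨ +-monoˡ-≤ _ (offset<ℓ d j) ⟩
    suc (shift d + toℕ z) * ℓ ≤⟨ *-monoˡ-≤ ℓ (≤-trans (≤-reflexive (sym (+-suc (shift d) (toℕ z)))) (+-monoʳ-≤ (shift d) (toℕ<n z))) ⟩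
    (shift d + s) * ℓ ∎)
    where open ≤-Reasoning

  shift≤s : ∀ d → shift d ≤ s
  shift≤s fwd = z≤n
  shift≤s bwd = ≤-refl

  station-<L : ∀ d j z → station d j z < L
  station-<L d j z = ≤-trans (station-< d j z) (≤-trans (*-monoˡ-≤ ℓ (+-monoˡ-≤ s (shift≤s d))) (≤-reflexive (*-distribʳ-+ ℓ s s)))

  station-injective : ∀ d j {y z} → station d j y ≡ station d j z → y ≡ z
  station-injective d j {y} {z} e = toℕ-injective (+-cancelˡ-≡ (shift d) _ _ (*-cancelʳ-≡ _ _ ℓ
    (+-cancelˡ-≡ (offset d j) _ _ (trans (sym (station-≡ d j y)) (trans e (station-≡ d j z))))))

  station-% : ∀ d j z → station d j z % ℓ ≡ offset d j % ℓ
  station-% d j z = trans (cong (_% ℓ) (station-≡ d j z)) ([m+kn]%n≡m%n (offset d j) (shift d + toℕ z) ℓ)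

  but-sound : ∀ {u w} → but u w ≡ true → w ≢ u
  but-sound h = ≢ᵇ-sound (not-true h)

  cover : ∀ (p q : Fin n → Bool) k → n ≤ cnt n p + k → n ∸ k ≤ cnt n (λ x → p x ∧ not (q x)) + cnt n q
  cover p q k h = ≤-trans (∸-monoˡ-≤ k h) (≤-trans (≤-reflexive (m+n∸n≡m (cnt n p) k))
    (≤-trans (∑-mono (allFin n) (λ x → pointwise (p x) (q x))) (≤-reflexive (∑-+ (allFin n) _ _))))
    where
    pointwise : ∀ a b → ⟦ a ⟧ ≤ ⟦ a ∧ not b ⟧ + ⟦ b ⟧
    pointwise false b = z≤n
    pointwise true false = s≤s z≤n
    pointwise true true = s≤s z≤n

  but-count : ∀ u → cnt n (but u) + 1 ≡ n
  but-count u = trans (cong (cnt n (but u) +_) (sym (cnt-≡ n u))) (trans (+-comm (cnt n (but u)) _) (cnt-not n (λ x → does (x F.≟ u))))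

  but-∧ : ∀ (p : Fin n → Bool) u → cnt n p ≤ cnt n (λ x → p x ∧ but u x) + 1
  but-∧ p u = ≤-trans (∑-mono (allFin n) (λ x → pointwise (p x) (does (x F.≟ u)))) (≤-reflexive (trans (∑-+ (allFin n) _ _) (cong (cnt n (λ x → p x ∧ but u x) +_) (cnt-≡ n u))))
    where
    pointwise : ∀ a b → ⟦ a ⟧ ≤ ⟦ a ∧ not b ⟧ + ⟦ b ⟧
    pointwise false b = z≤n
    pointwise true false = s≤s z≤n
    pointwise true true = s≤s z≤n

  but₃-count : ∀ u v w → n ≤ cnt n (but₃ u v w) + 3
  but₃-count u v w = ≤-trans (≤-reflexive (sym (but-count u))) (≤-trans (+-monoˡ-≤ 1 (≤-trans (but-∧ (but u) v) (+-monoˡ-≤ 1 (but-∧ (λ x → but u x ∧ but v x) w))))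
    (≤-reflexive (trans (+-assoc (cnt n (but₃ u v w) + 1) 1 1) (+-assoc (cnt n (but₃ u v w)) 1 2))))

  module _ (f : Mat) (spread≡0 : spread f ≡ 0) where

    private
      split : ∀ i → #disjoined (sub f (spine i) (spine i)) ≡ 0 ×
        (#disjoined (sub f (hub fwd i) (spine i)) ≡ 0 × #disjoined (sub f (spine i) (hub bwd i)) ≡ 0)
      split i = let e = ∑≡0 (disjoinedIn f) spread≡0 (∈-parts i)
                    x = #disjoined (sub f (spine i) (spine i)) ; y = #disjoined (sub f (hub fwd i) (spine i))
        in m+n≡0⇒m≡0 x e , m+n≡0⇒m≡0 y (m+n≡0⇒n≡0 x e) , m+n≡0⇒n≡0 y (m+n≡0⇒n≡0 x e)

    path-injective : ∀ i {a b} → a < L → b < L → path i f a ≡ path i f b → a ≡ b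
    path-injective i ha hb e = pathOf-injective (sub f (spine i) (spine i)) (proj₁ (split i)) ha hb (proj₂ (blk-injective i e))

    path-arc : ∀ i t → suc t < L → earlyIn (color Π t) (f ⟨ path i f t , path i f (suc t) ⟩) ≡ true
    path-arc i t h = trans (sym (cong (earlyIn (color Π t)) (sub-at f (spine i) (spine i) (pathOf (sub f (spine i) (spine i)) t) (pathOf (sub f (spine i) (spine i)) (suc t)))))
      (pathOf-arc (sub f (spine i) (spine i)) (proj₁ (split i)) t h)

    -- The stations are `s` distinct path vertices. More than `s` unlinked hubs would be joined to
    -- one of them by an early arc of the inner color.
    linked-many : ∀ d i j → m ≤ cnt m (linked d i j f) + s
    linked-many d i j with cnt m unlinked ≤? s
      where
      unlinked : Fin m → Bool
      unlinked x = not (linked d i j f x)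
    ... | yes h = ≤-trans (≤-reflexive (sym (cnt-not m (linked d i j f)))) (+-monoʳ-≤ _ h)
    ... | no h = contradiction (arc-found d) λ { (x , z , un , e) →
        contradiction (trans (sym (not-true un)) (true-any (λ z → earlyIn (inner d j) (f ⟨ cell d (hub d i x) (path i f (station d j z)) ⟩)) (∈-allFin z) e)) λ () }
      where
      unlinked : Fin m → Bool
      unlinked x = not (linked d i j f x)
      g : Fin s → Fin m
      g z = pathOf (sub f (spine i) (spine i)) (station d j z)
      g-inj : ∀ {a b} → g a ≡ g b → a ≡ b
      g-inj {a} {b} e = station-injective d j (pathOf-injective (sub f (spine i) (spine i)) (proj₁ (split i)) (station-<L d j a) (station-<L d j b) e)
      image : Fin m → Bool
      image y = any' (λ z → does (g z F.≟ y)) (allFin s)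
      image-many : s ≤ cnt m image
      image-many = cnt-image g g-inj image (λ z → true-any (λ z' → does (g z' F.≟ g z)) (∈-allFin z) (≡ᵇ-refl (g z)))
      preimage : ∀ {y} → image y ≡ true → ∃[ z ] g z ≡ y
      preimage {y} h = let (z , _ , e) = any-true (λ z → does (g z F.≟ y)) (allFin s) h in z , ≡ᵇ-sound e
      arc-found : ∀ d' → ∃[ x ] ∃[ z ] (unlinked x ≡ true × earlyIn (inner d' j) (f ⟨ cell d' (hub d' i x) (spine i (g z)) ⟩) ≡ true)
      arc-found fwd = let (a , b , na , ib , e) = joined (sub f (hub fwd i) (spine i)) (proj₁ (proj₂ (split i))) (inner fwd j) unlinked image (<⇒≤ (≰⇒> h)) image-many
                          (z , gz) = preimage ib
        in a , z , na , trans (cong (λ v → earlyIn (inner fwd j) (f ⟨ hub fwd i a , spine i v ⟩)) gz)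
             (trans (sym (cong (earlyIn (inner fwd j)) (sub-at f (hub fwd i) (spine i) a b))) e)
      arc-found bwd = let (b , a , ib , na , e) = joined (sub f (spine i) (hub bwd i)) (proj₂ (proj₂ (split i))) (inner bwd j) image unlinked image-many (<⇒≤ (≰⇒> h))
                          (z , gz) = preimage ib
        in a , z , na , trans (cong (λ v → earlyIn (inner bwd j) (f ⟨ spine i v , hub bwd i a ⟩)) gz)
             (trans (sym (cong (earlyIn (inner bwd j)) (sub-at f (spine i) (hub bwd i) b a))) e)

    usable : ∀ d i w → badFor d i f w ≡ false → inPart i w ≡ false → ∀ (j : Fin ℓ) →
      ∃[ x ] ∃[ z ] (earlyIn (outer d (toℕ j)) (f ⟨ cell d w (hub d i x) ⟩) ≡ true ×
        earlyIn (inner d (toℕ j)) (f ⟨ cell d (hub d i x) (path i f (station d (toℕ j) z)) ⟩) ≡ true)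
    usable d i w h out j =
      let nb = any-false (λ j → badAt d i (toℕ j) f w) (∧-false h (false-not out)) (∈-allFin j)
          none = ∧-false nb (≤ᵇ-complete (linked-many d i (toℕ j)))
          (x , x∈ , e) = all-false (λ x → not (earlyIn (outer d (toℕ j)) (f ⟨ cell d w (hub d i x) ⟩))) (filterᵇ (linked d i (toℕ j) f) (allFin m)) none
          (_ , lx) = ∈-filterᵇ⁻ (linked d i (toℕ j) f) (allFin m) x∈
          (z , _ , ez) = any-true (λ z → earlyIn (inner d (toℕ j)) (f ⟨ cell d (hub d i x) (path i f (station d (toℕ j) z)) ⟩)) (allFin s) lx
      in x , z , not-false e , ez

module Routes {r ℓ : ℕ} .{{_ : NonZero ℓ}} (Fr : Frame r ℓ) where

  open Setup Fr
  open Deterministic Fr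

  -- `In` stands for the arcs present at the hitting time. All that is used of them is that they
  -- contain the early arcs, are mid, and leave no vertex without an arc in either direction.
  module Connecting (surj : ∀ c → ∃[ p ] lookup Π p ≡ c) (f : Mat) (ok : failure f ≡ 0)
    (In : Fin n → Fin n → Fin r → Set)
    (early-In : ∀ u v → u ≢ v → early (f ⟨ u , v ⟩) ≡ true → In u v (proj₂ (f ⟨ u , v ⟩)))
    (In-mid : ∀ {u v c} → In u v c → u ≢ v × mid (f ⟨ u , v ⟩) ≡ true)
    (outs : ∀ u → ∃[ w ] ∃[ c ] In u w c) (ins : ∀ u → ∃[ w ] ∃[ c ] In w u c) where

    open Trails Π In

    spread≡0 : spread f ≡ 0
    spread≡0 = m+n≡0⇒m≡0 (spread f) (m+n≡0⇒n≡0 (Eᵃ f) ok)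

    private
      rest : Eᶠ f + (both-dirs fwd f + both-dirs bwd f) ≡ 0
      rest = m+n≡0⇒n≡0 (spread f) (m+n≡0⇒n≡0 (Eᵃ f) ok)

    dir≡0 : ∀ d → both-dirs d f ≡ 0
    dir≡0 fwd = m+n≡0⇒m≡0 (both-dirs fwd f) (m+n≡0⇒n≡0 (Eᶠ f) rest)
    dir≡0 bwd = m+n≡0⇒n≡0 (both-dirs fwd f) (m+n≡0⇒n≡0 (Eᶠ f) rest)

    untrapped : ∀ d u w → trapped d f u w ≡ false
    untrapped d u w = ⟦⟧≡0 (∑≡0 (λ w → ⟦ trapped d f u w ⟧) (∑≡0 (λ u → ∑ vertices (λ w → ⟦ trapped d f u w ⟧))
      (m+n≡0⇒n≡0 (Eᵈ d f) (m+n≡0⇒n≡0 (Eᵇ d f) (dir≡0 d))) (∈-allFin u)) (∈-allFin w))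

    no-cherry : ∀ u v w → cherry f u v w ≡ false
    no-cherry u v w = ⟦⟧≡0 (∑≡0 (λ w → ⟦ cherry f u v w ⟧) (∑≡0 (λ v → ∑ vertices (λ w → ⟦ cherry f u v w ⟧))
      (∑≡0 (λ u → ∑ vertices (λ v → ∑ vertices (λ w → ⟦ cherry f u v w ⟧))) (m+n≡0⇒m≡0 (Eᶠ f) rest) (∈-allFin u)) (∈-allFin v)) (∈-allFin w))

    #bad≤b₀ : ∀ d → #bad d f ≤ b₀
    #bad≤b₀ d = ≮⇒≥ (λ l → contradiction (trans (sym (⟦⟧≡0 (m+n≡0⇒m≡0 (Eᵈ d f) (m+n≡0⇒n≡0 (Eᵇ d f) (dir≡0 d))))) (<ᵇ-complete l)) λ ())

    but-≢ : ∀ {u w} → w ≢ u → but u w ≡ true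
    but-≢ h = false-not (≢ᵇ h)

    Link : Dir → Fin n → Fin n → Fin r → Set
    Link fwd u w c = In u w c
    Link bwd u w c = In w u c

    Link-mid : ∀ d {u w c} → Link d u w c → w ≢ u × mid (f ⟨ cell d u w ⟩) ≡ true
    Link-mid fwd a = let (h , e) = In-mid a in (λ q → h (sym q)) , e
    Link-mid bwd a = In-mid a

    early-Link : ∀ d {u w} → w ≢ u → early (f ⟨ cell d u w ⟩) ≡ true → ∃[ c ] Link d u w c
    early-Link fwd {u} {w} h e = _ , early-In u w (λ q → h (sym q)) e
    early-Link bwd {u} {w} h e = _ , early-In w u h e

    links : ∀ d u → ∃[ w ] ∃[ c ] Link d u w c
    links fwd = outs
    links bwd = ins

    -- Some arc at `u` is present. If its other end is bad, `u` would be trapped unless an early arc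
    -- joins it to a good vertex.
    good-link : ∀ d u → ∃[ w ] ∃[ c ] (Link d u w c × bad d (only u) f w ≡ false)
    good-link d u = go (links d u)
      where
      go : ∃[ w ] ∃[ c ] Link d u w c → ∃[ w ] ∃[ c ] (Link d u w c × bad d (only u) f w ≡ false)
      go (w , c , a) = by (true⊎false (bad d (only u) f w))
        where
        by : bad d (only u) f w ≡ true ⊎ bad d (only u) f w ≡ false → ∃[ w ] ∃[ c ] (Link d u w c × bad d (only u) f w ≡ false)
        by (inj₂ e) = w , c , a , e
        by (inj₁ e) =
          let (w≢u , am) = Link-mid d a
              few = ≤ᵇ-complete (≤-trans (cover (but u) (bad d (only u) f) 1 (≤-reflexive (sym (but-count u)))) (+-monoʳ-≤ (cnt n (goodBut d u f)) (≤-trans (bad≤#bad d (only u) f) (#bad≤b₀ d))))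
              none = ∧-false (∧-false (untrapped d u w) (true∧ few (true∧ (but-≢ w≢u) e))) am
              (x , x∈ , ex) = all-false (λ x → not (early (f ⟨ cell d u x ⟩))) (filterᵇ (goodBut d u f) vertices) none
              (b , nb) = ∧-true {but u x} (proj₂ (∈-filterᵇ⁻ (goodBut d u f) vertices x∈))
              (c' , a') = early-Link d (but-sound b) (not-false ex)
          in x , c' , a' , not-true nb

    earlyIn-In : ∀ {u v c} → u ≢ v → earlyIn c (f ⟨ u , v ⟩) ≡ true → In u v c
    earlyIn-In {u} {v} {c} h e = let (e₁ , e₂) = ∧-true {early (f ⟨ u , v ⟩)} e in
      subst (In u v) (≡ᵇ-sound e₂) (early-In u v h e₁)

    color-lookup : ∀ (p : Fin ℓ) → color Π (toℕ p) ≡ lookup Π p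
    color-lookup p = cong (lookup Π) (toℕ-injective (trans (toℕ-mod (toℕ p)) (m<n⇒m%n≡m (toℕ<n p))))

    Route : Fin n → Fin n → Set
    Route u v = ∃[ p ] ∃[ y ] ∃[ xs ] (Trail p u (y ∷ xs) v × Unique (u ∷ y ∷ xs))

    edge : ∀ {u v c} → u ≢ v → In u v c → Route u v
    edge {u} {v} {c} h a = let (p , e) = surj c in
      toℕ p , v , [] , step (subst (In u v) (sym (trans (color-lookup p) e)) a) stop , (h ∷ []) ∷ [] ∷ []

    badFor-false : ∀ d ex w i → bad d ex f w ≡ false → ex i ≡ false → badFor d i f w ≡ false
    badFor-false d ex w i h e = ∧-false (any-false (λ i → not (ex i) ∧ badFor d i f w) h (∈-parts i)) (false-not e)

    -- The colors of the two end arcs are arbitrary, but each occurs in the pattern, at `p₁` and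
    -- `p₂`. The path starts at `p₁`; being able to enter and leave the long path at every residue
    -- lets it arrive at `p₂`.
    route : ∀ {u v w₁ w₂ c₁ c₂} → u ≢ v → In u w₁ c₁ → In w₂ v c₂ → w₁ ≢ v → w₂ ≢ u → w₁ ≢ w₂ →
      bad fwd (both u v) f w₁ ≡ false → bad bwd (both u v) f w₂ ≡ false → Route u v
    route {u} {v} {w₁} {w₂} {c₁} {c₂} u≢v a₁ a₆ w₁≢v w₂≢u w₁≢w₂ g₁ g₂ =
      toℕ p₁ , connect below arc₁ arc₂ arc₃ a-residue arc₄ arc₅ arc₆
        (outside fzero) (outside (fsuc (fsuc fzero))) (outside (fsuc (fsuc (fsuc fzero)))) (outside (fsuc fzero))
        (pt-blk i _ x) (pt-blk i _ y) (proj₁ (In-mid a₁)) (λ e → w₂≢u (sym e)) u≢v w₁≢w₂ w₁≢v (proj₁ (In-mid a₆))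
        x≢y x≢P y≢P
      where
      avoid : Vec ℕ 4
      avoid = pt u ∷ pt v ∷ pt w₁ ∷ pt w₂ ∷ []
      i : Fin 5
      i = proj₁ (fresh avoid)
      B : Fin n → Set
      B z = pt z ≡ toℕ i
      outside : ∀ j → ¬ (lookup avoid j ≡ toℕ i)
      outside j e = proj₂ (fresh avoid) j (sym e)
      notIn : ∀ j → (toℕ i ≡ᵇ lookup avoid j) ≡ false
      notIn j = ≢ᵇℕ (proj₂ (fresh avoid) j)
      excluded : both u v i ≡ false
      excluded = false∨ (notIn fzero) (notIn (fsuc fzero))
      p₁ p₂ : Fin ℓ
      p₁ = proj₁ (surj c₁)
      p₂ = proj₁ (surj c₂)
      j₁ j₂ : Fin ℓ
      j₁ = (toℕ p₁ + 1) mod ℓ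
      -- Two positions before `p₂`, since two arcs precede the last one after leaving the long path;
      -- adding `2 * (ℓ ∸ 1)` avoids truncated subtraction.
      j₂ = (toℕ p₂ + 2 * (ℓ ∸ 1)) mod ℓ
      u₁ : ∃[ x ] ∃[ z ] (earlyIn (outer fwd (toℕ j₁)) (f ⟨ cell fwd w₁ (hub fwd i x) ⟩) ≡ true ×
        earlyIn (inner fwd (toℕ j₁)) (f ⟨ cell fwd (hub fwd i x) (path i f (station fwd (toℕ j₁) z)) ⟩) ≡ true)
      u₁ = usable f spread≡0 fwd i w₁ (badFor-false fwd (both u v) w₁ i g₁ excluded) (notIn (fsuc (fsuc fzero))) j₁
      u₂ : ∃[ x ] ∃[ z ] (earlyIn (outer bwd (toℕ j₂)) (f ⟨ cell bwd w₂ (hub bwd i x) ⟩) ≡ true ×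
        earlyIn (inner bwd (toℕ j₂)) (f ⟨ cell bwd (hub bwd i x) (path i f (station bwd (toℕ j₂) z)) ⟩) ≡ true)
      u₂ = usable f spread≡0 bwd i w₂ (badFor-false bwd (both u v) w₂ i g₂ excluded) (notIn (fsuc (fsuc (fsuc fzero)))) j₂
      x y : Fin m
      x = proj₁ u₁
      y = proj₁ u₂
      z₁ z₂ : Fin s
      z₁ = proj₁ (proj₂ u₁)
      z₂ = proj₁ (proj₂ u₂)
      a b d : ℕ
      a = station fwd (toℕ j₁) z₁
      b = station bwd (toℕ j₂) z₂
      d = b ∸ a
      -- Entries lie in the first half of the path and exits in the second, so `b ∸ a` is a true
      -- difference.
      a+d : a + d ≡ b
      a+d = m+[n∸m]≡n (≤-trans (<⇒≤ (station-< fwd (toℕ j₁) z₁)) (≤-trans (*-monoˡ-≤ ℓ (m≤m+n s (toℕ z₂))) (m≤n+m ((s + toℕ z₂) * ℓ) (toℕ j₂ % ℓ))))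
      below : a + d < L
      below = subst (_< L) (sym a+d) (station-<L bwd (toℕ j₂) z₂)
      ≢-class : ∀ {c c' x y} → c ≢ c' → blk i c x ≢ blk i c' y
      ≢-class h e = h (proj₁ (blk-injective i e))
      x≢y : hub fwd i x ≢ hub bwd i y
      x≢y = ≢-class λ ()
      x≢P : ∀ t → hub fwd i x ≢ path i f t
      x≢P t = ≢-class λ ()
      y≢P : ∀ t → hub bwd i y ≢ path i f t
      y≢P t = ≢-class λ ()
      ≢-part : ∀ {s c x} → ¬ B s → s ≢ blk i c x
      ≢-part {c = c} {x} ¬s refl = ¬s (pt-blk i c x)
      open Connect B (path i f) (λ t → pt-blk i _ _) (path-injective f spread≡0 i)
        (λ t h → earlyIn-In (λ e → 1+n≢n (sym (path-injective f spread≡0 i (<-trans (n<1+n t) h) h e))) (path-arc f spread≡0 i t h))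
      j₁% : toℕ j₁ % ℓ ≡ (toℕ p₁ + 1) % ℓ
      j₁% = trans (cong (_% ℓ) (toℕ-mod (toℕ p₁ + 1))) (m%n%n≡m%n (toℕ p₁ + 1) ℓ)
      j₂% : (toℕ j₂ + 2) % ℓ ≡ toℕ p₂ % ℓ
      j₂% = begin
        (toℕ j₂ + 2) % ℓ ≡⟨ %-+ʳ 2 (trans (cong (_% ℓ) (toℕ-mod (toℕ p₂ + 2 * (ℓ ∸ 1)))) (m%n%n≡m%n _ ℓ)) ⟩
        (toℕ p₂ + 2 * (ℓ ∸ 1) + 2) % ℓ ≡⟨ cong (_% ℓ) (trans (+-assoc (toℕ p₂) _ 2) (cong (toℕ p₂ +_) (trans (sym (*-distribˡ-+ 2 (ℓ ∸ 1) 1)) (cong (2 *_) (m∸n+n≡m (>-nonZero⁻¹ ℓ)))))) ⟩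
        (toℕ p₂ + 2 * ℓ) % ℓ ≡⟨ [m+kn]%n≡m%n (toℕ p₂) 2 ℓ ⟩
        toℕ p₂ % ℓ ∎
        where open ≡-Reasoning
      b% : (a + d) % ℓ ≡ toℕ j₂ % ℓ
      b% = trans (cong (_% ℓ) a+d) (trans (station-% bwd (toℕ j₂) z₂) (m%n%n≡m%n (toℕ j₂) ℓ))
      a-residue : a % ℓ ≡ (toℕ p₁ + 3) % ℓ
      a-residue = trans (station-% fwd (toℕ j₁) z₁) (trans (m%n%n≡m%n (toℕ j₁ + 2) ℓ) (trans (%-+ʳ 2 j₁%) (cong (_% ℓ) (+-assoc (toℕ p₁) 1 2))))
      arc₁ : In u w₁ (color Π (toℕ p₁))
      arc₁ = subst (In u w₁) (sym (trans (color-lookup p₁) (proj₂ (surj c₁)))) a₁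
      arc₂ : In w₁ (hub fwd i x) (color Π (toℕ p₁ + 1))
      arc₂ = subst (In w₁ (hub fwd i x)) (color-cong Π j₁%) (earlyIn-In (≢-part (outside (fsuc (fsuc fzero)))) (proj₁ (proj₂ (proj₂ u₁))))
      arc₃ : In (hub fwd i x) (path i f a) (color Π (toℕ p₁ + 2))
      arc₃ = subst (In (hub fwd i x) (path i f a)) (color-cong Π (trans (%-+ʳ 1 j₁%) (cong (_% ℓ) (+-assoc (toℕ p₁) 1 1)))) (earlyIn-In (x≢P a) (proj₂ (proj₂ (proj₂ u₁))))
      arc₄ : In (path i f (a + d)) (hub bwd i y) (color Π (a + d))
      arc₄ = subst₂ (λ t c → In (path i f t) (hub bwd i y) c) (sym a+d) (color-cong Π (sym b%))
        (earlyIn-In (λ e → y≢P b (sym e)) (proj₂ (proj₂ (proj₂ u₂))))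
      arc₅ : In (hub bwd i y) w₂ (color Π (a + d + 1))
      arc₅ = subst (In (hub bwd i y) w₂) (color-cong Π (sym (%-+ʳ 1 b%))) (earlyIn-In (λ e → ≢-part (outside (fsuc (fsuc (fsuc fzero)))) (sym e)) (proj₁ (proj₂ (proj₂ u₂))))
      arc₆ : In w₂ v (color Π (a + d + 2))
      arc₆ = subst (In w₂ v) (sym (trans (color-cong Π (trans (%-+ʳ 2 b%) j₂%)) (trans (color-lookup p₂) (proj₂ (surj c₂))))) a₆

    -- Excluding more blocks leaves fewer ways to be bad. This passes from the exclusion of one
    -- block in `good-link` to that of both in `route`.
    weaken : ∀ d ex ex' w → (∀ i → ex i ≡ true → ex' i ≡ true) → bad d ex f w ≡ false → bad d ex' f w ≡ false
    weaken d ex ex' w h e = by (true⊎false (bad d ex' f w))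
      where
      contra : ∀ i → ex' i ≡ false → ex i ≡ true ⊎ ex i ≡ false → ex i ≡ false
      contra i q (inj₁ z) = contradiction (trans (sym (h i z)) q) λ ()
      contra i q (inj₂ z) = z
      by : bad d ex' f w ≡ true ⊎ bad d ex' f w ≡ false → bad d ex' f w ≡ false
      by (inj₂ e') = e'
      by (inj₁ e') = let (i , _ , q) = any-true (λ i → not (ex' i) ∧ badFor d i f w) parts e'
                         (a , b) = ∧-true {not (ex' i)} {badFor d i f w} q
        in contradiction (trans (sym b) (badFor-false d ex w i e (contra i (not-true a) (true⊎false (ex i))))) λ ()

    connected : ∀ u v → u ≢ v → Route u v
    connected u v u≢v = go (good-link fwd u) (good-link bwd v)
      where
      ∨-l : ∀ {a b} → a ≡ true → a ∨ b ≡ true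
      ∨-l refl = refl
      ∨-r : ∀ {a b} → b ≡ true → a ∨ b ≡ true
      ∨-r {false} refl = refl
      ∨-r {true} refl = refl
      go : ∃[ w ] ∃[ c ] (In u w c × bad fwd (only u) f w ≡ false) → ∃[ w ] ∃[ c ] (In w v c × bad bwd (only v) f w ≡ false) → Route u v
      go (w₁ , c₁ , a₁ , h₁) (w₂ , c₂ , a₂ , h₂) = by (w₁ F.≟ v) (w₂ F.≟ u) (w₁ F.≟ w₂)
        where
        g₁ : bad fwd (both u v) f w₁ ≡ false
        g₁ = weaken fwd (only u) (both u v) w₁ (λ i → ∨-l) h₁
        g₂ : bad bwd (both u v) f w₂ ≡ false
        g₂ = weaken bwd (only v) (both u v) w₂ (λ i → ∨-r) h₂
        few : ∀ d w → (n ∸ 3 ≤ᵇ cnt n (goodBut₃ d u v w f) + b₀) ≡ true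
        few d w = ≤ᵇ-complete (≤-trans (cover (but₃ u v w) (bad d (both u v) f) 3 (but₃-count u v w))
          (+-monoʳ-≤ (cnt n (goodBut₃ d u v w f)) (≤-trans (bad≤#bad d (both u v) f) (#bad≤b₀ d))))
        by : Dec (w₁ ≡ v) → Dec (w₂ ≡ u) → Dec (w₁ ≡ w₂) → Route u v
        by (yes refl) _ _ = edge u≢v a₁
        by (no _) (yes refl) _ = edge u≢v a₂
        by (no p) (no q) (no z) = route u≢v a₁ a₂ p q z g₁ g₂
        -- The shared neighbor is replaced at one end: without a cherry, either `u` has an early arc
        -- to another good vertex or `v` has one from another good vertex.
        by (no p) (no q) (yes refl) = cases (true⊎false outTest)
          where
          outTest inTest : Bool
          outTest = all' (λ x → not (early (f ⟨ u , x ⟩))) (filterᵇ (goodBut₃ fwd u v w₁ f) vertices)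
          inTest = all' (λ x → not (early (f ⟨ x , v ⟩))) (filterᵇ (goodBut₃ bwd u v w₁ f) vertices)
          good₃ : ∀ d {x} → x ∈ filterᵇ (goodBut₃ d u v w₁ f) vertices → (x ≢ u × x ≢ v × x ≢ w₁) × bad d (both u v) f x ≡ false
          good₃ d {x} x∈ =
            let (b3 , nb) = ∧-true {but₃ u v w₁ x} (proj₂ (∈-filterᵇ⁻ (goodBut₃ d u v w₁ f) vertices x∈))
                (b2 , xw) = ∧-true {but u x ∧ but v x} b3
                (xu , xv) = ∧-true {but u x} b2
            in (but-sound xu , but-sound xv , but-sound xw) , not-true nb
          u≢w : u ≢ w₁
          u≢w = proj₁ (In-mid a₁)
          inFalse : outTest ≡ true → inTest ≡ false
          inFalse = ∧-false (∧-false (no-cherry u v w₁) (true∧ (true∧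
            (true∧ (true∧ (but-≢ (λ q → u≢v (sym q))) (but-≢ (λ e → u≢w (sym e)))) (but-≢ (proj₁ (In-mid a₂))))
            (true∧ (few fwd w₁) (few bwd w₁))) (true∧ (proj₂ (In-mid a₁)) (proj₂ (In-mid a₂)))))
          cases : outTest ≡ true ⊎ outTest ≡ false → Route u v
          cases (inj₂ e) =
            let (x , x∈ , ex) = all-false (λ x → not (early (f ⟨ u , x ⟩))) (filterᵇ (goodBut₃ fwd u v w₁ f) vertices) e
                ((xu , xv , xw) , nb) = good₃ fwd x∈
            in route u≢v (early-In u x (λ q → xu (sym q)) (not-false ex)) a₂ xv q xw nb g₂
          cases (inj₁ e) =
            let (x , x∈ , ex) = all-false (λ x → not (early (f ⟨ x , v ⟩))) (filterᵇ (goodBut₃ bwd u v w₁ f) vertices) (inFalse e)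
                ((xu , xv , xw) , nb) = good₃ bwd x∈
            in route u≢v a₁ (early-In x v xv (not-false ex)) p xu (λ q → xw (sym q)) g₁ nb

-- Probabilities of the failure events

all-map : (p : Y → Bool) (g : X → Y) (xs : List X) → all' p (map g xs) ≡ all' (λ x → p (g x)) xs
all-map p g [] = refl
all-map p g (x ∷ xs) = cong (p (g x) ∧_) (all-map p g xs)

length-pairs : (xs : List X) (ys : List Y) → length (cartesianProduct xs ys) ≡ length xs * length ys
length-pairs xs ys = trans (length≡∑ (cartesianProduct xs ys)) (trans (∑-cartesian _,_ xs ys (λ _ → 1))
  (trans (∑-cong xs (λ _ → sym (length≡∑ ys))) (∑-const xs (length ys))))

all-cong∈ : {p q : X → Bool} (xs : List X) → (∀ {x} → x ∈ xs → p x ≡ q x) → all' p xs ≡ all' q xs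
all-cong∈ [] h = refl
all-cong∈ (x ∷ xs) h = cong₂ _∧_ (h (here refl)) (all-cong∈ xs (λ e → h (there e)))

any-all : (p : X → Bool) (xs : List X) → ⟦ any' p xs ⟧ + ⟦ all' (λ x → not (p x)) xs ⟧ ≡ 1
any-all p [] = refl
any-all p (x ∷ xs) with p x
... | true = refl
... | false = any-all p xs

filterᵇ-cong : {p q : X → Bool} (xs : List X) → (∀ x → p x ≡ q x) → filterᵇ p xs ≡ filterᵇ q xs
filterᵇ-cong [] h = refl
filterᵇ-cong {p = p} {q} (x ∷ xs) h with p x | q x | h x
... | true | .true | refl = cong (x ∷_) (filterᵇ-cong xs h)
... | false | .false | refl = filterᵇ-cong xs h

filterᵇ-unique : (p : X → Bool) {xs : List X} → Unique xs → Unique (filterᵇ p xs)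
filterᵇ-unique p [] = []
filterᵇ-unique p {x ∷ xs} (x∉ ∷ u) with p x
... | true = All.tabulate (λ y∈ → All.lookup x∉ (proj₁ (∈-filterᵇ⁻ p xs y∈))) ∷ filterᵇ-unique p u
... | false = filterᵇ-unique p u

module Bounds {r ℓ : ℕ} .{{_ : NonZero ℓ}} (Fr : Frame r ℓ) where

  open Setup Fr
  open Deterministic Fr using (but-count)

  -- The average of `G` is at most `num / den`; for indicators and their sums this is a probability
  -- or a union bound.
  record Rare (num den : ℕ) (G : Mat → ℕ) : Set where
    constructor rare
    field bound : den * ∑ Ω G ≤ num * total
  open Rare

  Rare-mono : ∀ {num den F G} → (∀ f → F f ≤ G f) → Rare num den G → Rare num den F
  Rare-mono {den = den} h (rare R) = rare (≤-trans (*-monoʳ-≤ den (∑-mono Ω h)) R)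

  Rare-∑ : ∀ {num den} (ys : List Y) (F : Y → Mat → ℕ) → (∀ y → Rare num den (F y)) →
    Rare (length ys * num) den (λ f → ∑ ys (λ y → F y f))
  Rare-∑ {num = num} {den} ys F R = rare (begin
    den * ∑ Ω (λ f → ∑ ys (λ y → F y f)) ≡⟨ cong (den *_) (∑-swap Ω ys (λ f y → F y f)) ⟩
    den * ∑ ys (λ y → ∑ Ω (F y)) ≡⟨ sym (∑-*ˡ den ys _) ⟩
    ∑ ys (λ y → den * ∑ Ω (F y)) ≤⟨ ∑-≤const ys (λ y → bound (R y)) ⟩
    length ys * (num * total) ≡⟨ sym (*-assoc (length ys) num total) ⟩
    length ys * num * total ∎)
    where open ≤-Reasoning

  Rare-0 : ∀ {num den F} → (∀ f → F f ≡ 0) → Rare num den F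
  Rare-0 {num} {den} {F} h = rare (≤-trans (≤-reflexive (trans (cong (den *_) (trans (∑-cong Ω h) (trans (∑-const Ω 0) (*-zeroʳ total)))) (*-zeroʳ den))) z≤n)

  ∑1 : ∑ Ω (λ _ → 1) ≡ total
  ∑1 = sym (length≡∑ Ω)

  free-all : ∀ (p : A → Bool) (g : Y → Cell n) (ys : List Y) {c} → (∀ {y} → y ∈ ys → g y ≢ c) →
    FreeOf (λ f → ⟦ all' (λ y → p (f ⟨ g y ⟩)) ys ⟧) c
  free-all p g ys {c} h f f' = cong ⟦_⟧ (all-cong∈ ys (λ {y} y∈ → cong p (mix-out (_≟c c) f f' {g y} (≟c-≢ (h y∈)))))

  free-* : ∀ {F G c} → FreeOf F c → FreeOf G c → FreeOf (λ f → F f * G f) c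
  free-* hF hG f f' = cong₂ _*_ (hF f f') (hG f f')

  cells-rare : ∀ {p num den} → Density p num den → num ≤ den → 0 < den → (g : Y → Cell n) → (∀ {x y} → g x ≡ g y → x ≡ y) →
    (ys : List Y) → Unique ys → ∀ t → t ≤ length ys →
    (G : Mat → ℕ) → (∀ {y} → y ∈ ys → FreeOf G (g y)) →
    den ^ t * ∑ Ω (λ f → G f * ⟦ all' (λ y → p (f ⟨ g y ⟩)) ys ⟧) ≤ num ^ t * ∑ Ω G
  cells-rare {p = p} {num} {den} D≡ le pos g inj ys uniq t t≤ G free = ≤-trans
    (≤-reflexive (cong (den ^ t *_) (∑-cong Ω (λ f → cong (λ b → G f * ⟦ b ⟧) (sym (all-map (λ c → p (f ⟨ c ⟩)) g ys))))))
    (∑-cells-≤ {p} {num} {den} D≡ le pos (map g ys) (map⁺ inj uniq) G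
      (λ c∈ → let (y , y∈ , e) = ∈-map⁻ g c∈ in subst (FreeOf G) (sym e) (free y∈)) t (≤-trans t≤ (≤-reflexive (sym (length-map g ys)))))

  cells-rare₁ : ∀ {p num den} → Density p num den → num ≤ den → 0 < den → (g : Y → Cell n) → (∀ {x y} → g x ≡ g y → x ≡ y) →
    (ys : List Y) → Unique ys → ∀ t → t ≤ length ys → Rare (num ^ t) (den ^ t) (λ f → ⟦ all' (λ y → p (f ⟨ g y ⟩)) ys ⟧)
  cells-rare₁ {p = p} {num} {den} D≡ le pos g inj ys uniq t t≤ = rare (≤-trans
    (≤-reflexive (cong (den ^ t *_) (∑-cong Ω (λ f → sym (+-identityʳ _)))))
    (≤-trans (cells-rare {p = p} D≡ le pos g inj ys uniq t t≤ (λ _ → 1) (λ _ _ _ → refl)) (≤-reflexive (cong (num ^ t *_) ∑1))))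

  0<D : 0 < D
  0<D = ≤-trans (s≤s z≤n) 2≤D

  cell-injective : ∀ d u {v w} → cell d u v ≡ cell d u w → v ≡ w
  cell-injective fwd u refl = refl
  cell-injective bwd u refl = refl

  others : Fin n → List (Fin n)
  others u = filterᵇ (but u) vertices

  others-unique : ∀ u → Unique (others u)
  others-unique u = filterᵇ-unique (but u) (allFin⁺ n)

  length-others : ∀ u → length (others u) ≡ n ∸ 1
  length-others u = trans (length-filterᵇ (but u) vertices)
    (trans (sym (m+n∸n≡m (cnt n (but u)) 1)) (cong (_∸ 1) (but-count u)))

  Eᵇ-rare : ∀ d → Rare (n * (D ∸ 2) ^ (n ∸ 1)) (D ^ (n ∸ 1)) (Eᵇ d)
  Eᵇ-rare d = subst (λ z → Rare (z * (D ∸ 2) ^ (n ∸ 1)) (D ^ (n ∸ 1)) (Eᵇ d)) (length-allFin n)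
    (Rare-∑ vertices (λ u f → ⟦ idle d f u ⟧) (λ u →
      cells-rare₁ {p = λ a → not (mid a)} (not-density {mid} {2} {D} mid-density) (m∸n≤m D 2) 0<D (cell d u) (cell-injective d u) (others u) (others-unique u)
        (n ∸ 1) (≤-reflexive (sym (length-others u)))))

  row : Dir → Fin n → Mask
  row fwd u (a , b) = does (a F.≟ u)
  row bwd u (a , b) = does (b F.≟ u)

  row-cell : ∀ d u a b → row d u (cell d a b) ≡ does (a F.≟ u)
  row-cell fwd u a b = refl
  row-cell bwd u a b = refl

  departs : Fin n → Mat → Bool
  departs u f = any' (λ v → early (f ⟨ u , v ⟩)) (others u)

  τ γ : ℕ
  τ = D ^ (n ∸ 1)
  γ = (D ∸ 1) ^ (n ∸ 1)

  -- Obtained from the exact chance of the complement, as here the chance of having no early out-arc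
  -- is needed from below.
  departs-rare : ∀ u → Rare (τ ∸ γ) τ (λ f → ⟦ departs u f ⟧)
  departs-rare u = rare (begin
    τ * S ≡⟨ sym (m+n∸n≡m (τ * S) (γ * total)) ⟩
    τ * S + γ * total ∸ γ * total ≡⟨ cong (λ z → τ * S + z ∸ γ * total) (sym none) ⟩
    τ * S + S' * τ ∸ γ * total ≡⟨ cong (_∸ γ * total) (trans (cong (τ * S +_) (*-comm S' τ)) (sym (*-distribˡ-+ τ S S'))) ⟩
    τ * (S + S') ∸ γ * total ≡⟨ cong (λ z → τ * z ∸ γ * total) (trans (sym (∑-+ Ω _ _)) (trans (∑-cong Ω (λ f → any-all (λ v → early (f ⟨ u , v ⟩)) (others u))) ∑1)) ⟩
    τ * total ∸ γ * total ≡⟨ sym (*-distribʳ-∸ total τ γ) ⟩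
    (τ ∸ γ) * total ∎)
    where
    open ≤-Reasoning
    quiet : Mat → Bool
    quiet f = all' (λ v → not (early (f ⟨ u , v ⟩))) (others u)
    S = ∑ Ω (λ f → ⟦ departs u f ⟧)
    S' = ∑ Ω (λ f → ⟦ quiet f ⟧)
    none : S' * τ ≡ γ * total
    none = subst (λ k → S' * D ^ k ≡ (D ∸ 1) ^ k * total) (trans (length-map (u ,_) (others u)) (length-others u))
      (trans (cong (_* D ^ length (map (u ,_) (others u))) (∑-cong Ω (λ f → trans (cong ⟦_⟧ (sym (all-map (λ c → not (early (f ⟨ c ⟩))) (u ,_) (others u)))) (sym (+-identityʳ _)))))
      (trans (∑-cells (not-density {early} {1} {D} early-density) (map (u ,_) (others u)) (map⁺ (λ { refl → refl }) (others-unique u)) (λ _ → 1) (λ _ _ _ → refl))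
        (cong ((D ∸ 1) ^ length (map (u ,_) (others u)) *_) ∑1)))

  -- Arcs leaving different vertices occupy different rows, so the probabilities multiply and no
  -- second moment is needed.
  all-depart : ∀ (us : List (Fin n)) → Unique us → Rare ((τ ∸ γ) ^ length us) (τ ^ length us) (λ f → ⟦ all' (λ u → departs u f) us ⟧)
  all-depart [] _ = rare (≤-reflexive (cong (1 *_) ∑1))
  all-depart (u ∷ us) (u∉ ∷ uniq) = rare (*-cancelˡ-≤ total (begin
    total * (τ * τ ^ k * ∑ Ω (λ f → ⟦ departs u f ∧ P f ⟧))
      ≡⟨ solve 4 (λ T τ e S → T :* (τ :* e :* S) := (τ :* e) :* (T :* S)) refl total τ (τ ^ k) (∑ Ω (λ f → ⟦ departs u f ∧ P f ⟧)) ⟩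
    τ * τ ^ k * (total * ∑ Ω (λ f → ⟦ departs u f ∧ P f ⟧))
      ≡⟨ cong (λ z → τ * τ ^ k * (total * z)) (∑-cong Ω (λ f → trans (⟦∧⟧ (departs u f) (P f)) (*-comm ⟦ departs u f ⟧ _))) ⟩
    τ * τ ^ k * (total * ∑ Ω (λ f → ⟦ P f ⟧ * ⟦ departs u f ⟧))
      ≡⟨ cong (τ * τ ^ k *_) (resample-product (row fwd u) (λ f → ⟦ P f ⟧) (λ f → ⟦ departs u f ⟧) indep dep) ⟩
    τ * τ ^ k * (∑ Ω (λ f → ⟦ P f ⟧) * ∑ Ω (λ f → ⟦ departs u f ⟧))
      ≡⟨ solve 4 (λ τ e p q → (τ :* e) :* (p :* q) := (τ :* q) :* (e :* p)) refl τ (τ ^ k) (∑ Ω (λ f → ⟦ P f ⟧)) (∑ Ω (λ f → ⟦ departs u f ⟧)) ⟩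
    τ * ∑ Ω (λ f → ⟦ departs u f ⟧) * (τ ^ k * ∑ Ω (λ f → ⟦ P f ⟧))
      ≤⟨ *-mono-≤ (bound (departs-rare u)) (bound (all-depart us uniq)) ⟩
    (τ ∸ γ) * total * ((τ ∸ γ) ^ k * total)
      ≡⟨ solve 3 (λ a b T → (a :* T) :* (b :* T) := T :* (a :* b :* T)) refl (τ ∸ γ) ((τ ∸ γ) ^ k) total ⟩
    total * ((τ ∸ γ) * (τ ∸ γ) ^ k * total) ∎))
    where
    open ≤-Reasoning
    k = length us
    P : Mat → Bool
    P f = all' (λ u → departs u f) us
    indep : ∀ f h → ⟦ P (mix (row fwd u) f h) ⟧ ≡ ⟦ P f ⟧
    indep f h = cong ⟦_⟧ (all-cong∈ us (λ {w} w∈ → any-cong (others w) (λ v → cong early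
      (mix-out (row fwd u) f h {w , v} (≢ᵇ (λ e → All.lookup u∉ w∈ (sym e)))))))
    dep : ∀ f h → ⟦ departs u (mix (row fwd u) f h) ⟧ ≡ ⟦ departs u h ⟧
    dep f h = cong ⟦_⟧ (any-cong (others u) (λ v → cong early (mix-in (row fwd u) f h {u , v} (≡ᵇ-refl u))))

  Eᵃ-rare : Rare ((D ^ (n ∸ 1) ∸ (D ∸ 1) ^ (n ∸ 1)) ^ n) ((D ^ (n ∸ 1)) ^ n) Eᵃ
  Eᵃ-rare = subst (λ k → Rare ((D ^ (n ∸ 1) ∸ (D ∸ 1) ^ (n ∸ 1)) ^ k) ((D ^ (n ∸ 1)) ^ k) Eᵃ) (length-allFin n)
    (all-depart vertices (allFin⁺ n))

  0<Dr : 0 < D * r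
  0<Dr = *-mono-≤ {1} {D} {1} 0<D 1≤r

  earlyIn-not-density : ∀ c → Density (λ a → not (earlyIn c a)) (D * r ∸ 1) (D * r)
  earlyIn-not-density c = not-density {earlyIn c} {1} {D * r} (earlyIn-density c)

  -- A union bound over `r` colors and `2 ^ m` choices for each set. Two sets of size at least `s`
  -- span at least `s * s` different cells, even if they overlap.
  #disjoined-rare : ∀ α β → (∀ {a b a' b'} → (α a , β b) ≡ (α a' , β b') → (a , b) ≡ (a' , b')) →
    Rare (r * (2 ^ m * (2 ^ m * (D * r ∸ 1) ^ (s * s)))) ((D * r) ^ (s * s)) (λ f → #disjoined (sub f α β))
  #disjoined-rare α β inj = subst (λ z → Rare z ((D * r) ^ (s * s)) (λ f → #disjoined (sub f α β)))
    (cong₂ _*_ (length-allFin r) (cong₂ _*_ len (cong (_* (D * r ∸ 1) ^ (s * s)) len)))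
    (Rare-∑ (allFin r) (λ c f → ∑ subsets (λ S → ∑ subsets (λ T → ⟦ disjoined (sub f α β) c S T ⟧)))
      (λ c → Rare-∑ subsets (λ S f → ∑ subsets (λ T → ⟦ disjoined (sub f α β) c S T ⟧))
        (λ S → Rare-∑ subsets (λ T f → ⟦ disjoined (sub f α β) c S T ⟧) (one c S))))
    where
    len : length subsets ≡ 2 ^ m
    len = length-enumV m (true ∷ false ∷ [])
    one : ∀ c S T → Rare ((D * r ∸ 1) ^ (s * s)) ((D * r) ^ (s * s)) (λ f → ⟦ disjoined (sub f α β) c S T ⟧)
    one c S T with true⊎false ((s ≤ᵇ cnt m (lookup S)) ∧ (s ≤ᵇ cnt m (lookup T)))
    ... | inj₂ e = Rare-0 {(D * r ∸ 1) ^ (s * s)} {(D * r) ^ (s * s)} (λ f → cong (λ b → ⟦ b ∧ all' (λ ab → not (arc (sub f α β) c (proj₁ ab) (proj₂ ab))) (cartesianProduct (members S) (members T)) ⟧) e)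
    ... | inj₁ e = Rare-mono {(D * r ∸ 1) ^ (s * s)} {(D * r) ^ (s * s)} le
        (cells-rare₁ {p = λ a → not (earlyIn c a)} (earlyIn-not-density c) (m∸n≤m (D * r) 1) 0<Dr g inj pairs
          (cartesianProduct⁺ (filterᵇ-unique (lookup S) (allFin⁺ m)) (filterᵇ-unique (lookup T) (allFin⁺ m))) (s * s) size)
      where
      pairs : List (Fin m × Fin m)
      pairs = cartesianProduct (members S) (members T)
      g : Fin m × Fin m → Cell n
      g ab = α (proj₁ ab) , β (proj₂ ab)
      le : ∀ f → ⟦ disjoined (sub f α β) c S T ⟧ ≤ ⟦ all' (λ ab → not (earlyIn c (f ⟨ g ab ⟩))) pairs ⟧
      le f = ⟦⟧-mono (λ h → trans (all-cong pairs (λ ab → cong (λ a → not (earlyIn c a)) (sym (sub-at f α β (proj₁ ab) (proj₂ ab)))))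
        (proj₂ (∧-true {(s ≤ᵇ cnt m (lookup S)) ∧ (s ≤ᵇ cnt m (lookup T))} h)))
      size : s * s ≤ length pairs
      size = let (e₁ , e₂) = ∧-true {s ≤ᵇ cnt m (lookup S)} e in
        ≤-trans (*-mono-≤ (≤-trans (≤ᵇ-sound {s} e₁) (≤-reflexive (sym (length-filterᵇ (lookup S) (allFin m)))))
                          (≤-trans (≤ᵇ-sound {s} e₂) (≤-reflexive (sym (length-filterᵇ (lookup T) (allFin m))))))
          (≤-reflexive (sym (length-pairs (members S) (members T))))

  blk-pairs : ∀ i {c c' a b a' b'} → (blk i c a , blk i c' b) ≡ (blk i c a' , blk i c' b') → (a , b) ≡ (a' , b')
  blk-pairs i e = cong₂ _,_ (proj₂ (blk-injective i (cong proj₁ e))) (proj₂ (blk-injective i (cong proj₂ e)))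

  Eᶜ-rare : let z = r * (2 ^ m * (2 ^ m * (D * r ∸ 1) ^ (s * s))) in Rare (5 * (z + (z + z))) ((D * r) ^ (s * s)) Eᶜ
  Eᶜ-rare = subst (λ k → Rare (k * (z + (z + z))) ((D * r) ^ (s * s)) Eᶜ) length-parts
    (Rare-∑ parts (λ i f → disjoinedIn f i) (λ i → Rare-+ (#disjoined-rare (spine i) (spine i) (blk-pairs i))
      (Rare-+ (#disjoined-rare (hub fwd i) (spine i) (blk-pairs i)) (#disjoined-rare (spine i) (hub bwd i) (blk-pairs i)))))
    where
    z : ℕ
    z = r * (2 ^ m * (2 ^ m * (D * r ∸ 1) ^ (s * s)))
    Rare-+ : ∀ {x y den F G} → Rare x den F → Rare y den G → Rare (x + y) den (λ f → F f + G f)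
    Rare-+ {x} {y} {den} {F} {G} (rare h) (rare k) = rare (≤-trans (≤-reflexive (trans (cong (den *_) (∑-+ Ω F G)) (*-distribˡ-+ den _ _)))
      (≤-trans (+-mono-≤ h k) (≤-reflexive (sym (*-distribʳ-+ total x y)))))

-- Bad vertices, traps and cherries

module Bounds₂ {r ℓ : ℕ} .{{_ : NonZero ℓ}} (Fr : Frame r ℓ) where

  open Setup Fr
  open Deterministic Fr using (but-count; but-sound)
  open Bounds Fr
  open Rare

  Rare-resample : ∀ {num den G} μ → (∀ f → Rare num den (λ h → G (mix μ f h))) → Rare num den G
  Rare-resample {num} {den} {G} μ R = rare (resample-≤ μ G den num (λ f → bound (R f)))

  -- No arc inside block `i` is resampled, so its path, stations and linked hubs stay as they are.
  Avoids : Mask → Fin 5 → Set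
  Avoids μ i = ∀ c x c' y → μ (blk i c x , blk i c' y) ≡ false

  sub-mix : ∀ μ f h α β → (∀ x y → μ (α x , β y) ≡ false) → sub (mix μ f h) α β ≡ sub f α β
  sub-mix μ f h α β out = tabulate-cong (λ a → tabulate-cong (λ b → mix-out μ f h {α a , β b} (out a b)))

  avoids-hub : ∀ {μ i} d x y → Avoids μ i → μ (cell d (hub d i x) (spine i y)) ≡ false
  avoids-hub fwd x y av = av _ x _ y
  avoids-hub bwd x y av = av _ y _ x

  linked-mix : ∀ μ f h d i j → Avoids μ i → ∀ x → linked d i j (mix μ f h) x ≡ linked d i j f x
  linked-mix μ f h d i j av x = any-cong (allFin s) (λ z → cong (earlyIn (inner d j))
    (trans (cong (λ g → mix μ f h ⟨ cell d (hub d i x) (spine i (pathOf g (station d j z))) ⟩)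
        (sub-mix μ f h (spine i) (spine i) (λ a b → av _ a _ b)))
      (mix-out μ f h {cell d (hub d i x) (path i f (station d j z))} (avoids-hub {μ} d x (pathOf (sub f (spine i) (spine i)) (station d j z)) av))))

  enough : Dir → Fin 5 → ℕ → Mat → Bool
  enough d i j f = m ≤ᵇ cnt m (linked d i j f) + s

  hubs : Dir → Fin 5 → ℕ → Mat → List (Fin m)
  hubs d i j f = filterᵇ (linked d i j f) (allFin m)

  enough-mix : ∀ μ f h d i j → Avoids μ i → enough d i j (mix μ f h) ≡ enough d i j f
  enough-mix μ f h d i j av = cong (λ k → m ≤ᵇ k + s) (∑-cong (allFin m) (λ x → cong ⟦_⟧ (linked-mix μ f h d i j av x)))

  hubs-mix : ∀ μ f h d i j → Avoids μ i → hubs d i j (mix μ f h) ≡ hubs d i j f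
  hubs-mix μ f h d i j av = filterᵇ-cong (allFin m) (linked-mix μ f h d i j av)

  badFor-mix : ∀ μ f h d i w → (inPart i w ≡ false → Avoids μ i × (∀ x → μ (cell d w (hub d i x)) ≡ false)) →
    badFor d i (mix μ f h) w ≡ badFor d i f w
  badFor-mix μ f h d i w H = bool-case (inPart i w)
    (λ e → trans (cong (λ b → not b ∧ any' (λ j → badAt d i (toℕ j) (mix μ f h) w) (allFin ℓ)) e)
                   (sym (cong (λ b → not b ∧ any' (λ j → badAt d i (toℕ j) f w) (allFin ℓ)) e)))
    (λ e → cong (not (inPart i w) ∧_) (any-cong (allFin ℓ) (λ j → badAt-mix e (toℕ j))))
    where
    badAt-mix : inPart i w ≡ false → ∀ j → badAt d i j (mix μ f h) w ≡ badAt d i j f w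
    badAt-mix e j = cong₂ _∧_ (enough-mix μ f h d i j (proj₁ (H e)))
      (trans (cong (all' (λ x → not (earlyIn (outer d j) (mix μ f h ⟨ cell d w (hub d i x) ⟩)))) (hubs-mix μ f h d i j (proj₁ (H e))))
        (all-cong (hubs d i j f) (λ x → cong (λ a → not (earlyIn (outer d j) a)) (mix-out μ f h {cell d w (hub d i x)} (proj₂ (H e) x)))))

  bad-mix : ∀ μ f h d ex w → (∀ i → ex i ≡ false → inPart i w ≡ false → Avoids μ i × (∀ x → μ (cell d w (hub d i x)) ≡ false)) →
    bad d ex (mix μ f h) w ≡ bad d ex f w
  bad-mix μ f h d ex w H = any-cong parts go
    where
    go : ∀ i → (not (ex i) ∧ badFor d i (mix μ f h) w) ≡ (not (ex i) ∧ badFor d i f w)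
    go i = bool-case (ex i)
      (λ e → trans (cong (λ b → not b ∧ badFor d i (mix μ f h) w) e) (sym (cong (λ b → not b ∧ badFor d i f w) e)))
      (λ e → cong (not (ex i) ∧_) (badFor-mix μ f h d i w (H i e)))

  notIn-≢ : ∀ {i u} c x → inPart i u ≡ false → blk i c x ≢ u
  notIn-≢ {i} c x e refl = contradiction (trans (sym e) (trans (cong (toℕ i ≡ᵇ_) (pt-blk i c x)) (≡ᵇ-reflℕ (toℕ i)))) λ ()

  row-avoids : ∀ d {i u} → inPart i u ≡ false → Avoids (row d u) i
  row-avoids fwd e c x c' y = ≢ᵇ (notIn-≢ c x e)
  row-avoids bwd e c x c' y = ≢ᵇ (notIn-≢ c' y e)

  -- The arcs at `w` in direction `d` are resampled. As `w` lies outside the block, the linked hubs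
  -- are already decided, and at least `m ∸ s` fresh arcs must all miss the outer color.
  badAt-rare : ∀ d i j w → inPart i w ≡ false →
    Rare ((D * r ∸ 1) ^ (m ∸ s)) ((D * r) ^ (m ∸ s)) (λ f → ⟦ badAt d i j f w ⟧)
  badAt-rare d i j w out = Rare-resample (row d w) resampled
    where
    num den : ℕ
    num = (D * r ∸ 1) ^ (m ∸ s)
    den = (D * r) ^ (m ∸ s)
    av : Avoids (row d w) i
    av = row-avoids d out
    isolated : Mat → Mat → Bool
    isolated f h = all' (λ x → not (earlyIn (outer d j) (h ⟨ cell d w (hub d i x) ⟩))) (hubs d i j f)
    same : ∀ f h → badAt d i j (mix (row d w) f h) w ≡ enough d i j f ∧ isolated f h
    same f h = cong₂ _∧_ (enough-mix (row d w) f h d i j av)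
      (trans (cong (all' (λ x → not (earlyIn (outer d j) (mix (row d w) f h ⟨ cell d w (hub d i x) ⟩)))) (hubs-mix (row d w) f h d i j av))
        (all-cong (hubs d i j f) (λ x → cong (λ a → not (earlyIn (outer d j) a))
          (mix-in (row d w) f h {cell d w (hub d i x)} (trans (row-cell d w w (hub d i x)) (≡ᵇ-refl w))))))
    hub-injective : ∀ {x y} → cell d w (hub d i x) ≡ cell d w (hub d i y) → x ≡ y
    hub-injective e = hub-inj d (cell-injective d w e)
      where
      hub-inj : ∀ d {x y} → hub d i x ≡ hub d i y → x ≡ y
      hub-inj fwd e = proj₂ (blk-injective i e)
      hub-inj bwd e = proj₂ (blk-injective i e)
    resampled : ∀ f → Rare num den (λ h → ⟦ badAt d i j (mix (row d w) f h) w ⟧)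
    resampled f = bool-case (enough d i j f) isolating
      (λ e → Rare-0 (λ h → cong ⟦_⟧ (trans (same f h) (cong (_∧ isolated f h) e))))
      where
      isolating : enough d i j f ≡ true → Rare num den (λ h → ⟦ badAt d i j (mix (row d w) f h) w ⟧)
      isolating e = Rare-mono (λ h → ⟦⟧-mono (λ q → proj₂ (∧-true {enough d i j f} (trans (sym (same f h)) q))))
        (cells-rare₁ {p = λ a → not (earlyIn (outer d j) a)} (earlyIn-not-density (outer d j)) (m∸n≤m (D * r) 1) 0<Dr
          (λ x → cell d w (hub d i x)) hub-injective (hubs d i j f) (filterᵇ-unique (linked d i j f) (allFin⁺ m)) (m ∸ s)
          (≤-trans (∸-monoˡ-≤ s (≤ᵇ-sound {m} e)) (≤-trans (≤-reflexive (m+n∸n≡m _ s)) (≤-reflexive (sym (length-filterᵇ (linked d i j f) (allFin m)))))))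

  badFor-rare : ∀ d i w → Rare (ℓ * (D * r ∸ 1) ^ (m ∸ s)) ((D * r) ^ (m ∸ s)) (λ f → ⟦ badFor d i f w ⟧)
  badFor-rare d i w = bool-case (inPart i w)
    (λ e → Rare-0 (λ f → cong (λ b → ⟦ not b ∧ any' (λ j → badAt d i (toℕ j) f w) (allFin ℓ) ⟧) e))
    (λ e → Rare-mono (λ f → ≤-trans (⟦⟧-mono (λ q → proj₂ (∧-true {not (inPart i w)} q))) (⟦any⟧≤ (λ j → badAt d i (toℕ j) f w) (allFin ℓ)))
      (subst (λ k → Rare (k * (D * r ∸ 1) ^ (m ∸ s)) ((D * r) ^ (m ∸ s)) (λ f → ∑ (allFin ℓ) (λ j → ⟦ badAt d i (toℕ j) f w ⟧))) (length-allFin ℓ)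
        (Rare-∑ (allFin ℓ) (λ j f → ⟦ badAt d i (toℕ j) f w ⟧) (λ j → badAt-rare d i (toℕ j) w e))))

  #bad-rare : ∀ d → Rare (n * (5 * (ℓ * (D * r ∸ 1) ^ (m ∸ s)))) ((D * r) ^ (m ∸ s)) (#bad d)
  #bad-rare d = subst₂ (λ a b → Rare (a * (b * (ℓ * (D * r ∸ 1) ^ (m ∸ s)))) ((D * r) ^ (m ∸ s)) (#bad d)) (length-allFin n) length-parts
    (Rare-∑ vertices (λ w f → ∑ parts (λ i → ⟦ badFor d i f w ⟧)) (λ w → Rare-∑ parts (λ i f → ⟦ badFor d i f w ⟧) (λ i → badFor-rare d i w)))

  -- Markov's inequality; exceeding `b₀` means reaching `suc b₀`, the factor in the denominator.
  Eᵈ-rare : ∀ d → Rare (n * (5 * (ℓ * (D * r ∸ 1) ^ (m ∸ s)))) (suc b₀ * (D * r) ^ (m ∸ s)) (Eᵈ d)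
  Eᵈ-rare d = rare (begin
    suc b₀ * (D * r) ^ (m ∸ s) * ∑ Ω (Eᵈ d) ≡⟨ solve 3 (λ b e x → b :* e :* x := e :* (b :* x)) refl (suc b₀) ((D * r) ^ (m ∸ s)) (∑ Ω (Eᵈ d)) ⟩
    (D * r) ^ (m ∸ s) * (suc b₀ * ∑ Ω (Eᵈ d)) ≡⟨ cong ((D * r) ^ (m ∸ s) *_) (sym (∑-*ˡ (suc b₀) Ω (Eᵈ d))) ⟩
    (D * r) ^ (m ∸ s) * ∑ Ω (λ f → suc b₀ * Eᵈ d f) ≤⟨ *-monoʳ-≤ ((D * r) ^ (m ∸ s)) (∑-mono Ω markov) ⟩
    (D * r) ^ (m ∸ s) * ∑ Ω (#bad d) ≤⟨ bound (#bad-rare d) ⟩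
    n * (5 * (ℓ * (D * r ∸ 1) ^ (m ∸ s))) * total ∎)
    where
    open ≤-Reasoning
    markov : ∀ f → suc b₀ * Eᵈ d f ≤ #bad d f
    markov f = bool-case (b₀ <ᵇ #bad d f)
      (λ e → ≤-trans (≤-reflexive (trans (cong (λ b → suc b₀ * ⟦ b ⟧) e) (*-identityʳ (suc b₀)))) (<ᵇ-sound e))
      (λ e → ≤-trans (≤-reflexive (trans (cong (λ b → suc b₀ * ⟦ b ⟧) e) (*-zeroʳ (suc b₀)))) z≤n)

  -- The arcs at `u` could influence the badness of another vertex only through the block of `u`,
  -- which `only u` excludes.
  bad-row : ∀ d u f h w → w ≢ u → bad d (only u) (mix (row d u) f h) w ≡ bad d (only u) f w
  bad-row d u f h w w≢u = bad-mix (row d u) f h d (only u) w (λ i e _ → row-avoids d e , λ x → trans (row-cell d u w _) (≢ᵇ w≢u))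

  but-∧-cong : ∀ {b x y} → (b ≡ true → x ≡ y) → b ∧ x ≡ b ∧ y
  but-∧-cong {false} h = refl
  but-∧-cong {true} h = h refl

  goodBut-row : ∀ d u f h w → goodBut d u (mix (row d u) f h) w ≡ goodBut d u f w
  goodBut-row d u f h w = but-∧-cong {but u w} (λ e → cong not (bad-row d u f h w (but-sound e)))

  -- Resampling at `u` leaves at most `b₀` culprits fixed. For each, the arc to it is mid with
  -- chance `2 / D`, independently of the arcs to good vertices, all of which must miss the early
  -- labels.
  trapped-rare : ∀ d u → Rare (b₀ * (2 * (D ∸ 1) ^ (n ∸ 1 ∸ b₀))) (D * D ^ (n ∸ 1 ∸ b₀)) (λ f → ∑ vertices (λ w → ⟦ trapped d f u w ⟧))
  trapped-rare d u = Rare-resample (row d u) resampled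
    where
    t num den : ℕ
    t = n ∸ 1 ∸ b₀
    num = 2 * (D ∸ 1) ^ t
    den = D * D ^ t
    good : Mat → List (Fin n)
    good f = filterᵇ (goodBut d u f) vertices
    few : Mat → Bool
    few f = n ∸ 1 ≤ᵇ cnt n (goodBut d u f) + b₀
    culprit : Mat → Fin n → Bool
    culprit f w = but u w ∧ bad d (only u) f w
    quiet : Mat → Mat → Bool
    quiet f h = all' (λ x → not (early (h ⟨ cell d u x ⟩))) (good f)
    in-row : ∀ f h x → mix (row d u) f h ⟨ cell d u x ⟩ ≡ h ⟨ cell d u x ⟩
    in-row f h x = mix-in (row d u) f h {cell d u x} (trans (row-cell d u u x) (≡ᵇ-refl u))
    same : ∀ f h w → trapped d (mix (row d u) f h) u w ≡ (few f ∧ culprit f w) ∧ (mid (h ⟨ cell d u w ⟩) ∧ quiet f h)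
    same f h w = cong₂ _∧_
      (cong₂ _∧_ (cong (λ k → n ∸ 1 ≤ᵇ k + b₀) (∑-cong vertices (λ x → cong ⟦_⟧ (goodBut-row d u f h x))))
        (but-∧-cong {but u w} (λ e → bad-row d u f h w (but-sound e))))
      (cong₂ _∧_ (cong mid (in-row f h w))
        (trans (cong (all' (λ x → not (early (mix (row d u) f h ⟨ cell d u x ⟩)))) (filterᵇ-cong vertices (goodBut-row d u f h)))
          (all-cong (good f) (λ x → cong (λ a → not (early a)) (in-row f h x)))))
    one : ∀ f w → few f ≡ true → culprit f w ≡ true → Rare num den (λ h → ⟦ mid (h ⟨ cell d u w ⟩) ∧ quiet f h ⟧)
    one f w fe ce = rare (begin
      D * D ^ t * ∑ Ω (λ h → ⟦ mid (h ⟨ cell d u w ⟩) ∧ quiet f h ⟧)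
        ≡⟨ cong (D * D ^ t *_) (∑-cong Ω (λ h → ⟦∧⟧ (mid (h ⟨ cell d u w ⟩)) (quiet f h))) ⟩
      D * D ^ t * ∑ Ω (λ h → ⟦ mid (h ⟨ cell d u w ⟩) ⟧ * ⟦ quiet f h ⟧)
        ≡⟨ *-assoc D _ _ ⟩
      D * (D ^ t * ∑ Ω (λ h → ⟦ mid (h ⟨ cell d u w ⟩) ⟧ * ⟦ quiet f h ⟧))
        ≤⟨ *-monoʳ-≤ D (cells-rare {p = λ a → not (early a)} (not-density {early} {1} {D} early-density) (m∸n≤m D 1) 0<D (cell d u) (cell-injective d u)
             (good f) (filterᵇ-unique (goodBut d u f) (allFin⁺ n)) t size (λ h → ⟦ mid (h ⟨ cell d u w ⟩) ⟧) free) ⟩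
      D * ((D ∸ 1) ^ t * ∑ Ω (λ h → ⟦ mid (h ⟨ cell d u w ⟩) ⟧))
        ≡⟨ solve 3 (λ d e x → d :* (e :* x) := e :* (x :* d)) refl D ((D ∸ 1) ^ t) (∑ Ω (λ h → ⟦ mid (h ⟨ cell d u w ⟩) ⟧)) ⟩
      (D ∸ 1) ^ t * (∑ Ω (λ h → ⟦ mid (h ⟨ cell d u w ⟩) ⟧) * D)
        ≡⟨ cong ((D ∸ 1) ^ t *_) (∑-cell (cell d u w) {mid} {2} {D} mid-density) ⟩
      (D ∸ 1) ^ t * (2 * total)
        ≡⟨ solve 2 (λ e T → e :* (con 2 :* T) := con 2 :* e :* T) refl ((D ∸ 1) ^ t) total ⟩
      num * total ∎)
      where
      open ≤-Reasoning
      size : t ≤ length (good f)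
      size = ≤-trans (∸-monoˡ-≤ b₀ (≤ᵇ-sound {n ∸ 1} fe)) (≤-reflexive (trans (m+n∸n≡m _ b₀) (sym (length-filterᵇ (goodBut d u f) vertices))))
      free : ∀ {x} → x ∈ good f → FreeOf (λ h → ⟦ mid (h ⟨ cell d u w ⟩) ⟧) (cell d u x)
      free {x} x∈ h h' = cong (λ a → ⟦ mid a ⟧) (mix-out (_≟c cell d u x) h h' {cell d u w} (≟c-≢ (λ e → w≢x (cell-injective d u e))))
        where
        w≢x : w ≢ x
        w≢x refl = contradiction (trans (sym (proj₂ (∧-true {but u w} ce))) (not-true (proj₂ (∧-true {but u w} (proj₂ (∈-filterᵇ⁻ (goodBut d u f) vertices x∈)))))) λ ()
    culprits : ∀ f → few f ≡ true → cnt n (culprit f) ≤ b₀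
    culprits f fe = +-cancelˡ-≤ (cnt n (goodBut d u f)) _ _ (begin
      cnt n (goodBut d u f) + cnt n (culprit f) ≡⟨ trans (sym (∑-+ vertices _ _)) (∑-cong vertices (λ x → split (but u x) (bad d (only u) f x))) ⟩
      cnt n (but u) ≡⟨ trans (sym (m+n∸n≡m _ 1)) (cong (_∸ 1) (but-count u)) ⟩
      n ∸ 1 ≤⟨ ≤ᵇ-sound {n ∸ 1} fe ⟩
      cnt n (goodBut d u f) + b₀ ∎)
      where
      open ≤-Reasoning
      split : ∀ a b → ⟦ a ∧ not b ⟧ + ⟦ a ∧ b ⟧ ≡ ⟦ a ⟧
      split false b = refl
      split true false = refl
      split true true = refl
    resampled : ∀ f → Rare (b₀ * num) den (λ h → ∑ vertices (λ w → ⟦ trapped d (mix (row d u) f h) u w ⟧))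
    resampled f = bool-case (few f) trapping (λ e → Rare-0 (λ h → trans (∑-cong vertices (λ w → cong ⟦_⟧ (trans (same f h w) (cong (λ b → (b ∧ culprit f w) ∧ (mid (h ⟨ cell d u w ⟩) ∧ quiet f h)) e))))
          (trans (∑-const vertices 0) (*-zeroʳ (length vertices)))))
      where
      open ≤-Reasoning
      each : few f ≡ true → ∀ w → den * (⟦ culprit f w ⟧ * ∑ Ω (λ h → ⟦ mid (h ⟨ cell d u w ⟩) ∧ quiet f h ⟧)) ≤ ⟦ culprit f w ⟧ * (num * total)
      each e w = bool-case (culprit f w)
        (λ c → subst (λ b → den * (⟦ b ⟧ * P) ≤ ⟦ b ⟧ * (num * total)) (sym c) (≤-trans (≤-reflexive (cong (den *_) (+-identityʳ _))) (≤-trans (bound (one f w e c)) (≤-reflexive (sym (+-identityʳ _))))))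
        (λ c → subst (λ b → den * (⟦ b ⟧ * P) ≤ ⟦ b ⟧ * (num * total)) (sym c) (≤-reflexive (*-zeroʳ den)))
        where
        P : ℕ
        P = ∑ Ω (λ h → ⟦ mid (h ⟨ cell d u w ⟩) ∧ quiet f h ⟧)
      trapping : few f ≡ true → Rare (b₀ * num) den (λ h → ∑ vertices (λ w → ⟦ trapped d (mix (row d u) f h) u w ⟧))
      trapping e = rare (begin
        den * ∑ Ω (λ h → ∑ vertices (λ w → ⟦ trapped d (mix (row d u) f h) u w ⟧))
          ≡⟨ cong (den *_) (trans (∑-swap Ω vertices (λ h w → ⟦ trapped d (mix (row d u) f h) u w ⟧)) (∑-cong vertices (λ w → trans (∑-cong Ω (λ h → trans (cong ⟦_⟧ (trans (same f h w) (cong (λ b → (b ∧ culprit f w) ∧ (mid (h ⟨ cell d u w ⟩) ∧ quiet f h)) e)))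
               (⟦∧⟧ (culprit f w) _))) (∑-*ˡ ⟦ culprit f w ⟧ Ω _)))) ⟩
        den * ∑ vertices (λ w → ⟦ culprit f w ⟧ * ∑ Ω (λ h → ⟦ mid (h ⟨ cell d u w ⟩) ∧ quiet f h ⟧))
          ≡⟨ sym (∑-*ˡ den vertices _) ⟩
        ∑ vertices (λ w → den * (⟦ culprit f w ⟧ * ∑ Ω (λ h → ⟦ mid (h ⟨ cell d u w ⟩) ∧ quiet f h ⟧)))
          ≤⟨ ∑-mono vertices (each e) ⟩
        ∑ vertices (λ w → ⟦ culprit f w ⟧ * (num * total))
          ≡⟨ ∑-*ʳ (num * total) vertices _ ⟩
        cnt n (culprit f) * (num * total)
          ≤⟨ *-monoˡ-≤ (num * total) (culprits f e) ⟩
        b₀ * (num * total)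
          ≡⟨ sym (*-assoc b₀ num total) ⟩
        b₀ * num * total ∎)

  Eᵉ-rare : ∀ d → Rare (n * (b₀ * (2 * (D ∸ 1) ^ (n ∸ 1 ∸ b₀)))) (D * D ^ (n ∸ 1 ∸ b₀)) (Eᵉ d)
  Eᵉ-rare d = subst (λ k → Rare (k * (b₀ * (2 * (D ∸ 1) ^ (n ∸ 1 ∸ b₀)))) (D * D ^ (n ∸ 1 ∸ b₀)) (Eᵉ d)) (length-allFin n)
    (Rare-∑ vertices (λ u f → ∑ vertices (λ w → ⟦ trapped d f u w ⟧)) (trapped-rare d))

  module _ (u v w : Fin n) where

    private
      μ : Mask
      μ c = row fwd u c ∨ row bwd v c
      t : ℕ
      t = n ∸ 3 ∸ b₀

    distinct : Bool
    distinct = (but u v ∧ but u w) ∧ but v w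

    good₃ : Dir → Mat → List (Fin n)
    good₃ d f = filterᵇ (goodBut₃ d u v w f) vertices

    few₃ : Dir → Mat → Bool
    few₃ d f = n ∸ 3 ≤ᵇ cnt n (goodBut₃ d u v w f) + b₀

    but₃-sound : ∀ {x} → but₃ u v w x ≡ true → x ≢ u × x ≢ v × x ≢ w
    but₃-sound {x} h = let (h₁ , h₂) = ∧-true {but u x ∧ but v x} h ; (h₃ , h₄) = ∧-true {but u x} h₁ in
      but-sound h₃ , but-sound h₄ , but-sound h₂

    good₃-sound : ∀ d f {x} → x ∈ good₃ d f → x ≢ u × x ≢ v × x ≢ w
    good₃-sound d f {x} x∈ = but₃-sound {x} (proj₁ (∧-true {but₃ u v w x} (proj₂ (∈-filterᵇ⁻ (goodBut₃ d u v w f) vertices x∈))))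

    -- The row of `u` and the column of `v` are resampled together, which is why the blocks of both
    -- are excluded.
    goodBut₃-mix : ∀ d f h x → goodBut₃ d u v w (mix μ f h) x ≡ goodBut₃ d u v w f x
    goodBut₃-mix d f h x = but-∧-cong {but₃ u v w x} (λ e → let (x≢u , x≢v , _) = but₃-sound {x} e in
      cong not (bad-mix μ f h d (both u v) x (λ i ee _ → let (eu , ev) = ∨-false {inPart i u} ee in
        (λ c a c' b → false∨ (row-avoids fwd eu c a c' b) (row-avoids bwd ev c a c' b)) , λ y → out d i y x≢u x≢v eu ev)))
      where
      out : ∀ d i y → x ≢ u → x ≢ v → inPart i u ≡ false → inPart i v ≡ false → μ (cell d x (hub d i y)) ≡ false
      out fwd i y x≢u x≢v eu ev = false∨ (≢ᵇ x≢u) (≢ᵇ (notIn-≢ _ y ev))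
      out bwd i y x≢u x≢v eu ev = false∨ (≢ᵇ (notIn-≢ _ y eu)) (≢ᵇ x≢v)

    in-out : ∀ f h x → mix μ f h ⟨ u , x ⟩ ≡ h ⟨ u , x ⟩
    in-out f h x = mix-in μ f h {u , x} (cong (_∨ row bwd v (u , x)) (≡ᵇ-refl u))

    in-in : ∀ f h x → mix μ f h ⟨ x , v ⟩ ≡ h ⟨ x , v ⟩
    in-in f h x = mix-in μ f h {x , v} (trans (cong (row fwd u (x , v) ∨_) (≡ᵇ-refl v)) (∨-t (row fwd u (x , v))))
      where
      ∨-t : ∀ b → b ∨ true ≡ true
      ∨-t true = refl
      ∨-t false = refl

    legs : List (Cell n)
    legs = (u , w) ∷ (w , v) ∷ []

    quietOut quietIn : Mat → Mat → Bool
    quietOut f h = all' (λ x → not (early (h ⟨ u , x ⟩))) (good₃ fwd f)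
    quietIn f h = all' (λ x → not (early (h ⟨ x , v ⟩))) (good₃ bwd f)

    guard : Mat → Bool
    guard f = distinct ∧ (few₃ fwd f ∧ few₃ bwd f)

    cherry-mix : ∀ f h → cherry (mix μ f h) u v w ≡
      (guard f ∧ (mid (h ⟨ u , w ⟩) ∧ mid (h ⟨ w , v ⟩))) ∧ (quietOut f h ∧ quietIn f h)
    cherry-mix f h = cong₂ _∧_
      (cong₂ _∧_ (cong (distinct ∧_) (cong₂ _∧_ (few-same fwd) (few-same bwd))) (cong₂ _∧_ (cong mid (in-out f h w)) (cong mid (in-in f h w))))
      (cong₂ _∧_
        (trans (cong (all' (λ x → not (early (mix μ f h ⟨ u , x ⟩)))) (filterᵇ-cong vertices (goodBut₃-mix fwd f h)))
          (all-cong (good₃ fwd f) (λ x → cong (λ a → not (early a)) (in-out f h x))))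
        (trans (cong (all' (λ x → not (early (mix μ f h ⟨ x , v ⟩)))) (filterᵇ-cong vertices (goodBut₃-mix bwd f h)))
          (all-cong (good₃ bwd f) (λ x → cong (λ a → not (early a)) (in-in f h x)))))
      where
      few-same : ∀ d → few₃ d (mix μ f h) ≡ few₃ d f
      few-same d = cong (λ k → n ∸ 3 ≤ᵇ k + b₀) (∑-cong vertices (λ x → cong ⟦_⟧ (goodBut₃-mix d f h x)))

    -- The two legs, the arcs from `u` to good vertices and the arcs from good vertices to `v` are
    -- all different cells: `u`, `v`, `w` are distinct and the good vertices differ from all three.
    -- So the factors multiply.
    cherry-rare : Rare (2 ^ 2 * ((D ∸ 1) ^ t * (D ∸ 1) ^ t)) (D ^ 2 * (D ^ t * D ^ t)) (λ f → ⟦ cherry f u v w ⟧)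
    cherry-rare = Rare-resample μ resampled
      where
      num den : ℕ
      num = 2 ^ 2 * ((D ∸ 1) ^ t * (D ∸ 1) ^ t)
      den = D ^ 2 * (D ^ t * D ^ t)
      quiet-density : Density (λ a → not (early a)) (D ∸ 1) D
      quiet-density = not-density {early} {1} {D} early-density
      resampled : ∀ f → Rare num den (λ h → ⟦ cherry (mix μ f h) u v w ⟧)
      unguarded : ∀ f → guard f ≡ false → Rare num den (λ h → ⟦ cherry (mix μ f h) u v w ⟧)
      unguarded f e = Rare-0 (λ h → cong ⟦_⟧ (trans (cherry-mix f h)
        (cong (λ b → (b ∧ (mid (h ⟨ u , w ⟩) ∧ mid (h ⟨ w , v ⟩))) ∧ (quietOut f h ∧ quietIn f h)) e)))
      guarded : ∀ f → guard f ≡ true → Rare num den (λ h → ⟦ cherry (mix μ f h) u v w ⟧)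
      resampled f = bool-case (guard f) (guarded f) (unguarded f)
      guarded f e = Rare-mono le (rare (begin
          D ^ 2 * (D ^ t * D ^ t) * ∑ Ω G₃ ≡⟨ solve 3 (λ a b s → a :* (b :* b) :* s := a :* (b :* (b :* s))) refl (D ^ 2) (D ^ t) (∑ Ω G₃) ⟩
          D ^ 2 * (D ^ t * (D ^ t * ∑ Ω G₃)) ≤⟨ *-monoʳ-≤ (D ^ 2) (*-monoʳ-≤ (D ^ t) stepIn) ⟩
          D ^ 2 * (D ^ t * ((D ∸ 1) ^ t * ∑ Ω G₂)) ≡⟨ solve 4 (λ a b e s → a :* (b :* (e :* s)) := e :* (a :* (b :* s))) refl (D ^ 2) (D ^ t) ((D ∸ 1) ^ t) (∑ Ω G₂) ⟩
          (D ∸ 1) ^ t * (D ^ 2 * (D ^ t * ∑ Ω G₂)) ≤⟨ *-monoʳ-≤ ((D ∸ 1) ^ t) (*-monoʳ-≤ (D ^ 2) stepOut) ⟩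
          (D ∸ 1) ^ t * (D ^ 2 * ((D ∸ 1) ^ t * ∑ Ω G₁)) ≡⟨ solve 3 (λ a e s → e :* (a :* (e :* s)) := e :* (e :* (a :* s))) refl (D ^ 2) ((D ∸ 1) ^ t) (∑ Ω G₁) ⟩
          (D ∸ 1) ^ t * ((D ∸ 1) ^ t * (D ^ 2 * ∑ Ω G₁)) ≤⟨ *-monoʳ-≤ ((D ∸ 1) ^ t) (*-monoʳ-≤ ((D ∸ 1) ^ t) (bound stepLegs)) ⟩
          (D ∸ 1) ^ t * ((D ∸ 1) ^ t * (2 ^ 2 * total)) ≡⟨ solve 3 (λ q e T → e :* (e :* (q :* T)) := q :* (e :* e) :* T) refl (2 ^ 2) ((D ∸ 1) ^ t) total ⟩
          num * total ∎))
        where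
        open ≤-Reasoning
        G₁ G₂ G₃ : Mat → ℕ
        G₁ h = ⟦ all' (λ c → mid (h ⟨ c ⟩)) legs ⟧
        G₂ h = G₁ h * ⟦ quietOut f h ⟧
        G₃ h = G₂ h * ⟦ quietIn f h ⟧
        dist : (but u v ≡ true × but u w ≡ true) × but v w ≡ true
        dist = let (a , _) = ∧-true {distinct} e ; (b , c) = ∧-true {but u v ∧ but u w} a in ∧-true {but u v} b , c
        v≢u : v ≢ u
        v≢u = but-sound (proj₁ (proj₁ dist))
        w≢u : w ≢ u
        w≢u = but-sound (proj₂ (proj₁ dist))
        fews : few₃ fwd f ≡ true × few₃ bwd f ≡ true
        fews = ∧-true {few₃ fwd f} (proj₂ (∧-true {distinct} e))
        size : ∀ d → few₃ d f ≡ true → t ≤ length (good₃ d f)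
        size d fe = ≤-trans (∸-monoˡ-≤ b₀ (≤ᵇ-sound {n ∸ 3} fe)) (≤-reflexive (trans (m+n∸n≡m _ b₀) (sym (length-filterᵇ (goodBut₃ d u v w f) vertices))))
        le : ∀ h → ⟦ cherry (mix μ f h) u v w ⟧ ≤ G₃ h
        le h = ≤-trans (⟦⟧-mono {cherry (mix μ f h) u v w} {(all' (λ c → mid (h ⟨ c ⟩)) legs ∧ quietOut f h) ∧ quietIn f h}
            (λ q → let (a , b) = ∧-true {guard f ∧ (mid (h ⟨ u , w ⟩) ∧ mid (h ⟨ w , v ⟩))} (trans (sym (cherry-mix f h)) q)
                       (_ , ms) = ∧-true {guard f} a
                       (m₁ , m₂) = ∧-true {mid (h ⟨ u , w ⟩)} ms
                       (q₁ , q₂) = ∧-true {quietOut f h} b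
              in true∧ (true∧ (true∧ m₁ (true∧ m₂ refl)) q₁) q₂))
          (≤-reflexive (trans (⟦∧⟧ (all' (λ c → mid (h ⟨ c ⟩)) legs ∧ quietOut f h) (quietIn f h)) (cong (_* ⟦ quietIn f h ⟧) (⟦∧⟧ (all' (λ c → mid (h ⟨ c ⟩)) legs) (quietOut f h)))))
        stepLegs : Rare (2 ^ 2) (D ^ 2) G₁
        stepLegs = cells-rare₁ {p = mid} mid-density 2≤D 0<D (λ c → c) (λ q → q) legs
          (((λ q → w≢u (sym (cong proj₁ q))) ∷ []) ∷ [] ∷ []) 2 ≤-refl
        legs-free : ∀ {c} → (u , w) ≢ c → (w , v) ≢ c → FreeOf G₁ c
        legs-free h₁ h₂ = free-all mid (λ c → c) legs λ { (here refl) → h₁ ; (there (here refl)) → h₂ }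
        stepOut : D ^ t * ∑ Ω G₂ ≤ (D ∸ 1) ^ t * ∑ Ω G₁
        stepOut = cells-rare {p = λ a → not (early a)} quiet-density (m∸n≤m D 1) 0<D (u ,_) (λ { refl → refl }) (good₃ fwd f)
          (filterᵇ-unique (goodBut₃ fwd u v w f) (allFin⁺ n)) t (size fwd (proj₁ fews)) G₁
          (λ {x} x∈ → let (_ , _ , x≢w) = good₃-sound fwd f x∈ in legs-free (λ q → x≢w (sym (cong proj₂ q))) (λ q → w≢u (cong proj₁ q)))
        stepIn : D ^ t * ∑ Ω G₃ ≤ (D ∸ 1) ^ t * ∑ Ω G₂
        stepIn = cells-rare {p = λ a → not (early a)} quiet-density (m∸n≤m D 1) 0<D (_, v) (λ { refl → refl }) (good₃ bwd f)
          (filterᵇ-unique (goodBut₃ bwd u v w f) (allFin⁺ n)) t (size bwd (proj₂ fews)) G₂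
          (λ {x} x∈ → let (x≢u , _ , x≢w) = good₃-sound bwd f x∈ in
            free-* {G₁} {λ h → ⟦ quietOut f h ⟧} (legs-free (λ q → x≢u (sym (cong proj₁ q))) (λ q → x≢w (sym (cong proj₁ q))))
              (free-all (λ a → not (early a)) (u ,_) (good₃ fwd f) (λ {y} _ q → x≢u (sym (cong proj₁ q)))))

  Eᶠ-rare : let t = n ∸ 3 ∸ b₀ in Rare (n * (n * (n * (2 ^ 2 * ((D ∸ 1) ^ t * (D ∸ 1) ^ t))))) (D ^ 2 * (D ^ t * D ^ t)) Eᶠ
  Eᶠ-rare = subst (λ k → Rare (k * (k * (k * (2 ^ 2 * ((D ∸ 1) ^ t * (D ∸ 1) ^ t))))) (D ^ 2 * (D ^ t * D ^ t)) Eᶠ) (length-allFin n)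
    (Rare-∑ vertices (λ u f → ∑ vertices (λ v → ∑ vertices (λ w → ⟦ cherry f u v w ⟧))) (λ u →
      Rare-∑ vertices (λ v f → ∑ vertices (λ w → ⟦ cherry f u v w ⟧)) (λ v →
        Rare-∑ vertices (λ w f → ⟦ cherry f u v w ⟧) (λ w → cherry-rare u v w))))
    where
    t : ℕ
    t = n ∸ 3 ∸ b₀

-- From labellings to outcomes

-- The `N`-element subsets of `Fin M`, by Pascal's rule: either `fzero` is the least element or all
-- elements are successors.
increasing : ∀ M N → List (Vec (Fin M) N)
increasing M zero = [] ∷ []
increasing zero (suc N) = []
increasing (suc M) (suc N) = map (λ v → fzero ∷ Vec.map fsuc v) (increasing M N) ++ map (Vec.map fsuc) (increasing M (suc N))

Increasing : ∀ {M N} → Vec (Fin M) N → Set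
Increasing v = ∀ i j → toℕ i < toℕ j → toℕ (lookup v i) < toℕ (lookup v j)

Increasing-suc : ∀ {M N} {v : Vec (Fin M) N} → Increasing v → Increasing (Vec.map fsuc v)
Increasing-suc {v = v} h i j l rewrite lookup-map i fsuc v | lookup-map j fsuc v = s≤s (h i j l)

increasing-sound : ∀ M N {v} → v ∈ increasing M N → Increasing v
increasing-sound M zero _ ()
increasing-sound (suc M) (suc N) v∈ with ∈-++⁻ (map (λ v → fzero ∷ Vec.map fsuc v) (increasing M N)) v∈
... | inj₁ p with ∈-map⁻ (λ v → fzero ∷ Vec.map fsuc v) p
...   | v , v∈' , refl = go
  where
  go : Increasing (fzero ∷ Vec.map fsuc v)
  go fzero (fsuc j) _ rewrite lookup-map j fsuc v = s≤s z≤n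
  go (fsuc i) (fsuc j) (s≤s l) = Increasing-suc {v = v} (increasing-sound M N v∈') i j l
increasing-sound (suc M) (suc N) v∈ | inj₂ p with ∈-map⁻ (Vec.map fsuc) p
... | v , v∈' , refl = Increasing-suc {v = v} (increasing-sound M (suc N) v∈')

map-suc-injective : ∀ {M N} (v w : Vec (Fin M) N) → Vec.map fsuc v ≡ Vec.map fsuc w → v ≡ w
map-suc-injective [] [] _ = refl
map-suc-injective (x ∷ v) (y ∷ w) e with ∷-injective e
... | refl , e' = cong (x ∷_) (map-suc-injective v w e')

increasing-unique : ∀ M N → Unique (increasing M N)
increasing-unique M zero = [] ∷ []
increasing-unique zero (suc N) = []
increasing-unique (suc M) (suc N) = ++⁺
  (map⁺ (λ {v} {w} e → map-suc-injective v w (proj₂ (∷-injective e))) (increasing-unique M N))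
  (map⁺ (λ {v} {w} → map-suc-injective v w) (increasing-unique M (suc N)))
  λ (p , q) → disjoint (∈-map⁻ (λ v → fzero ∷ Vec.map fsuc v) p) (∈-map⁻ (Vec.map fsuc) q)
  where
  disjoint : ∀ {x} → ∃[ v ] (v ∈ increasing M N × x ≡ fzero ∷ Vec.map fsuc v) →
    ∃[ w ] (w ∈ increasing M (suc N) × x ≡ Vec.map fsuc w) → _
  disjoint (v , _ , refl) (y ∷ w , _ , ())

falling : ℕ → ℕ → ℕ
falling M zero = 1
falling M (suc N) = M * falling (M ∸ 1) N

falling-suc : ∀ M N → falling M (suc N) ≡ falling M N * (M ∸ N)
falling-suc M zero = *-comm M 1
falling-suc M (suc N) = begin
  M * falling (M ∸ 1) (suc N) ≡⟨ cong (M *_) (falling-suc (M ∸ 1) N) ⟩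
  M * (falling (M ∸ 1) N * (M ∸ 1 ∸ N)) ≡⟨ sym (*-assoc M _ _) ⟩
  M * falling (M ∸ 1) N * (M ∸ 1 ∸ N) ≡⟨ cong (M * falling (M ∸ 1) N *_) (∸-+-assoc M 1 N) ⟩
  falling M (suc N) * (M ∸ suc N) ∎
  where open ≡-Reasoning

falling-zero : ∀ M N → M < N → falling M N ≡ 0
falling-zero zero (suc N) _ = refl
falling-zero (suc M) (suc N) (s≤s h) = trans (cong (suc M *_) (falling-zero M N h)) (*-zeroʳ (suc M))

length-increasing : ∀ M N → N ! * length (increasing M N) ≡ falling M N
length-increasing M zero = refl
length-increasing zero (suc N) = *-zeroʳ (suc N !)
length-increasing (suc M) (suc N) = begin
  suc N ! * length (increasing (suc M) (suc N))
    ≡⟨ cong (suc N ! *_) (trans (length-++ (map (λ v → fzero ∷ Vec.map fsuc v) (increasing M N)))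
         (cong₂ _+_ (length-map _ (increasing M N)) (length-map _ (increasing M (suc N))))) ⟩
  suc N ! * (length (increasing M N) + length (increasing M (suc N)))
    ≡⟨ *-distribˡ-+ (suc N !) (length (increasing M N)) _ ⟩
  suc N * N ! * length (increasing M N) + suc N ! * length (increasing M (suc N))
    ≡⟨ cong₂ _+_ (trans (*-assoc (suc N) (N !) _) (cong (suc N *_) (length-increasing M N))) (trans (length-increasing M (suc N)) (falling-suc M N)) ⟩
  suc N * falling M N + falling M N * (M ∸ N)
    ≡⟨ pascal ⟩
  suc M * falling M N ∎
  where
  open ≡-Reasoning
  pascal : suc N * falling M N + falling M N * (M ∸ N) ≡ suc M * falling M N
  pascal with N ≤? M
  ... | yes h = trans (cong (suc N * falling M N +_) (*-comm (falling M N) (M ∸ N)))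
                  (trans (sym (*-distribʳ-+ (falling M N) (suc N) (M ∸ N))) (cong (λ z → suc z * falling M N) (m+[n∸m]≡n h)))
  ... | no h rewrite falling-zero M N (≰⇒> h) = trans (cong (_+ 0) (*-zeroʳ (suc N))) (sym (*-zeroʳ (suc M)))

falling-≥ : ∀ M N → (M ∸ N) ^ N ≤ falling M N
falling-≥ M zero = ≤-refl
falling-≥ M (suc N) = *-mono-≤ (m∸n≤m M (suc N)) (≤-trans (≤-reflexive (cong (_^ N) (sym (∸-+-assoc M 1 N)))) (falling-≥ (M ∸ 1) N))

-- Applied to a monotone permutation and its monotone inverse, this forces both to be the identity.
monotone⇒≥ : ∀ {N} (π : Fin N → Fin N) → (∀ i j → toℕ i < toℕ j → toℕ (π i) < toℕ (π j)) → ∀ k i → toℕ i ≡ k → k ≤ toℕ (π i)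
monotone⇒≥ π mono zero i _ = z≤n
monotone⇒≥ π mono (suc k) i e = ≤-trans (s≤s (monotone⇒≥ π mono k i' e')) (mono i' i (≤-reflexive (trans (cong suc e') (sym e))))
  where
  k< : k < _
  k< = <-trans (≤-reflexive (sym e)) (toℕ<n i)
  i' : Fin _
  i' = fromℕ< k<
  e' : toℕ i' ≡ k
  e' = toℕ-fromℕ< k<

vec-ext : ∀ {N} {v w : Vec X N} → (∀ i → lookup v i ≡ lookup w i) → v ≡ w
vec-ext {v = []} {[]} h = refl
vec-ext {v = x ∷ v} {y ∷ w} h = cong₂ _∷_ (h fzero) (vec-ext (λ i → h (fsuc i)))

enumV-unique : ∀ N {xs : List X} → Unique xs → Unique (enumV N xs)
enumV-unique zero u = [] ∷ []
enumV-unique (suc N) u = cartesianProductWith⁺ _∷_ ∷-injective u (enumV-unique N u)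

∑-injective : (F : X → ℕ) (g : Y → X) (ys : List Y) (xs : List X) → Unique ys →
  (∀ {y z} → y ∈ ys → z ∈ ys → g y ≡ g z → y ≡ z) → (∀ {y} → y ∈ ys → g y ∈ xs) →
  ∑ ys (λ y → F (g y)) ≤ ∑ xs F
∑-injective F g [] xs _ _ _ = z≤n
∑-injective F g (y ∷ ys) xs (y∉ ∷ u) inj sub with ∈-∃++ (sub (here refl))
... | as , bs , refl = begin
  F (g y) + ∑ ys (λ y → F (g y)) ≤⟨ +-monoʳ-≤ (F (g y)) (∑-injective F g ys (as ++ bs) u (λ p q → inj (there p) (there q)) rest) ⟩
  F (g y) + ∑ (as ++ bs) F ≡⟨ cong (F (g y) +_) (∑-++ as bs F) ⟩
  F (g y) + (∑ as F + ∑ bs F) ≡⟨ solve 3 (λ a b c → a :+ (b :+ c) := b :+ (a :+ c)) refl (F (g y)) (∑ as F) (∑ bs F) ⟩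
  ∑ as F + (F (g y) + ∑ bs F) ≡⟨ sym (∑-++ as (g y ∷ bs) F) ⟩
  ∑ (as ++ g y ∷ bs) F ∎
  where
  open ≤-Reasoning
  rest : ∀ {z} → z ∈ ys → g z ∈ as ++ bs
  rest {z} z∈ with ∈-++⁻ as (sub (there z∈))
  ... | inj₁ p = ∈-++⁺ˡ p
  ... | inj₂ (here e) = contradiction (inj (here refl) (there z∈) (sym e)) (All.lookup y∉ z∈)
  ... | inj₂ (there p) = ∈-++⁺ʳ as p

injective⇒surjective : ∀ {k} (h : Fin k → Fin k) → (∀ {i j} → h i ≡ h j → i ≡ j) → ∀ c → ∃[ j ] h j ≡ c
injective⇒surjective {suc k} h inj c with any? (λ j → h j F.≟ c)
... | yes p = p
... | no missed = contradiction (injective⇒≤ {f = g} (λ {i} {j} e → inj (punchOut-injective (avoids i) (avoids j) e))) (<⇒≱ (n<1+n k))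
  where
  avoids : ∀ j → c ≢ h j
  avoids j e = missed (j , sym e)
  g : Fin (suc k) → Fin k
  g j = punchOut (avoids j)

arcCode : ∀ {k} (u v : Fin k) → u ≢ v → Fin (N′ k)
arcCode {suc k} u v h = combine u (punchOut h)

arcCode-injective : ∀ {k} {u v u' v' : Fin k} (h : u ≢ v) (h' : u' ≢ v') → arcCode u v h ≡ arcCode u' v' h' → (u , v) ≡ (u' , v')
arcCode-injective {suc k} {u} {v} {u'} {v'} h h' e with combine-injective u (punchOut h) u' (punchOut h') e
... | refl , e' = cong (u ,_) (punchOut-injective h h' e')

module Sampling {n r M : ℕ} where

  Label : Set
  Label = Fin M × Fin r

  N : ℕ
  N = N′ n

  _≟a_ : (a b : Arc n) → Dec (a ≡ b)
  _≟a_ = ≡-dec F._≟_ F._≟_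

  valid? : (ω : Outcome n r) → Dec (Valid ω)
  valid? (σ , _) = all? (λ j → ¬? (proj₁ (lookup σ j) F.≟ proj₂ (lookup σ j)))
    ×-dec all? (λ j → all? (λ k → (lookup σ j ≟a lookup σ k) →-dec (j F.≟ k)))

  position? : (ω : Outcome n r) (a : Arc n) → Dec (∃[ j ] lookup (proj₁ ω) j ≡ a)
  position? ω a = any? (λ j → lookup (proj₁ ω) j ≟a a)

  -- `Valid` only says that the arcs are distinct and loopless. There are as many steps as codes for
  -- such arcs, so an injective enumeration misses none.
  covers : ∀ (ω : Outcome n r) → Valid ω → ∀ {u v} → u ≢ v → ∃[ j ] lookup (proj₁ ω) j ≡ (u , v)
  covers (σ , _) (loopless , distinct) {u} {v} u≢v =
    let (j , e) = injective⇒surjective code code-injective (arcCode u v u≢v) in j , arcCode-injective (loopless j) u≢v e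
    where
    code : Fin N → Fin N
    code j = arcCode (proj₁ (lookup σ j)) (proj₂ (lookup σ j)) (loopless j)
    code-injective : ∀ {i j} → code i ≡ code j → i ≡ j
    code-injective {i} {j} e = distinct i j (arcCode-injective (loopless i) (loopless j) e)

  -- The arc added at step `j` receives the `j`-th label and its own color. A loop is never added;
  -- its entry comes from `g`, so the diagonal is free.
  entry : Outcome n r → Vec (Fin M) N → Vec Label n → Fin n → Fin n → Label
  entry ω s g u v with position? ω (u , v)
  ... | yes (j , _) = lookup s j , lookup (proj₂ ω) j
  ... | no _ = lookup g u

  point : Outcome n r → Vec (Fin M) N → Vec Label n → Vec (Vec Label n) n
  point ω s g = tabulate (λ u → tabulate (entry ω s g u))

  point-at : ∀ ω s g u v → lookup (lookup (point ω s g) u) v ≡ entry ω s g u v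
  point-at ω s g u v = trans (cong (λ row → lookup row v) (lookup∘tabulate (λ u → tabulate (entry ω s g u)) u)) (lookup∘tabulate (entry ω s g u) v)

  point-arc : ∀ ω s g → Valid ω → ∀ j {u v} → lookup (proj₁ ω) j ≡ (u , v) →
    lookup (lookup (point ω s g) u) v ≡ (lookup s j , lookup (proj₂ ω) j)
  point-arc ω s g V j {u} {v} e = trans (point-at ω s g u v) go
    where
    go : entry ω s g u v ≡ (lookup s j , lookup (proj₂ ω) j)
    go with position? ω (u , v)
    ... | yes (k , e') = cong (λ i → lookup s i , lookup (proj₂ ω) i) (proj₂ V k j (trans e' (sym e)))
    ... | no none = contradiction (j , e) none

  point-loop : ∀ ω s g → Valid ω → ∀ u → lookup (lookup (point ω s g) u) u ≡ lookup g u
  point-loop ω s g V u = trans (point-at ω s g u u) go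
    where
    go : entry ω s g u u ≡ lookup g u
    go with position? ω (u , u)
    ... | yes (k , e) = contradiction (trans (cong proj₁ e) (sym (cong proj₂ e))) (proj₁ V k)
    ... | no _ = refl

  -- The increasing labels recover the order of the arcs.
  point-injective : ∀ {ω ω' s s' g g'} → Valid ω → Valid ω' → Increasing s → Increasing s' →
    point ω s g ≡ point ω' s' g' → (ω , s , g) ≡ (ω' , s' , g')
  point-injective {ω@(σ , col)} {ω'@(σ' , col')} {s} {s'} {g} {g'} V V' I I' e =
    cong₂ _,_ (cong₂ _,_ (vec-ext σ≡) (vec-ext col≡)) (cong₂ _,_ (vec-ext s≡) (vec-ext g≡))
    where
    match : ∀ {ω₁ ω₂ s₁ s₂ g₁ g₂} → Valid ω₁ → Valid ω₂ → point ω₁ s₁ g₁ ≡ point ω₂ s₂ g₂ → ∀ j →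
      ∃[ k ] (lookup (proj₁ ω₂) k ≡ lookup (proj₁ ω₁) j × lookup s₂ k ≡ lookup s₁ j × lookup (proj₂ ω₂) k ≡ lookup (proj₂ ω₁) j)
    match {ω₁} {ω₂} {s₁} {s₂} {g₁} {g₂} V₁ V₂ e j =
      let (k , ek) = covers ω₂ V₂ (proj₁ V₁ j)
          u = proj₁ (lookup (proj₁ ω₁) j) ; v = proj₂ (lookup (proj₁ ω₁) j)
          labels≡ = trans (sym (point-arc ω₂ s₂ g₂ V₂ k ek)) (trans (cong (λ f → lookup (lookup f u) v) (sym e)) (point-arc ω₁ s₁ g₁ V₁ j refl))
      in k , ek , cong proj₁ labels≡ , cong proj₂ labels≡
    mono : ∀ {ω₁ ω₂ s₁ s₂ g₁ g₂} (V₁ : Valid ω₁) (V₂ : Valid ω₂) (e : point ω₁ s₁ g₁ ≡ point ω₂ s₂ g₂) → Increasing s₁ → Increasing s₂ →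
      ∀ i j → toℕ i < toℕ j → toℕ (proj₁ (match V₁ V₂ e i)) < toℕ (proj₁ (match V₁ V₂ e j))
    mono {s₁ = s₁} {s₂} V₁ V₂ e I₁ I₂ i j i<j with <-cmp (toℕ (proj₁ (match V₁ V₂ e i))) (toℕ (proj₁ (match V₁ V₂ e j)))
    ... | tri< l _ _ = l
    ... | tri≈ _ q _ = contradiction (subst₂ _<_ (cong toℕ (trans (sym (proj₁ (proj₂ (proj₂ (match V₁ V₂ e i))))) (cong (lookup s₂) (toℕ-injective q)))) (cong toℕ (sym (proj₁ (proj₂ (proj₂ (match V₁ V₂ e j)))))) (I₁ i j i<j)) (<-irrefl refl)
    ... | tri> _ _ l = contradiction (subst₂ _<_ (cong toℕ (sym (proj₁ (proj₂ (proj₂ (match V₁ V₂ e i)))))) (cong toℕ (sym (proj₁ (proj₂ (proj₂ (match V₁ V₂ e j)))))) (I₁ i j i<j)) (<-asym (I₂ _ _ l))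
    π π' : Fin N → Fin N
    π j = proj₁ (match V V' e j)
    π' j = proj₁ (match V' V (sym e) j)
    inverse : ∀ j → π' (π j) ≡ j
    inverse j = proj₂ V _ _ (trans (proj₁ (proj₂ (match V' V (sym e) (π j)))) (proj₁ (proj₂ (match V V' e j))))
    π≡ : ∀ j → π j ≡ j
    π≡ j = toℕ-injective (≤-antisym
      (≤-trans (monotone⇒≥ π' (mono V' V (sym e) I' I) _ (π j) refl) (≤-reflexive (cong toℕ (inverse j))))
      (monotone⇒≥ π (mono V V' e I I') _ j refl))
    σ≡ : ∀ j → lookup σ j ≡ lookup σ' j
    σ≡ j = trans (sym (proj₁ (proj₂ (match V V' e j)))) (cong (lookup σ') (π≡ j))
    s≡ : ∀ j → lookup s j ≡ lookup s' j
    s≡ j = trans (sym (proj₁ (proj₂ (proj₂ (match V V' e j))))) (cong (lookup s') (π≡ j))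
    col≡ : ∀ j → lookup col j ≡ lookup col' j
    col≡ j = trans (sym (proj₂ (proj₂ (proj₂ (match V V' e j))))) (cong (lookup col') (π≡ j))
    g≡ : ∀ u → lookup g u ≡ lookup g' u
    g≡ u = trans (sym (point-loop ω s g V u)) (trans (cong (λ f → lookup (lookup f u) u) e) (point-loop ω' s' g' V' u))

  arcs : List (Arc n)
  arcs = cartesianProduct (allFin n) (allFin n)

  outcomes : List (Outcome n r)
  outcomes = cartesianProduct (enumV N arcs) (enumV N (allFin r))

  ∈-outcomes : ∀ ω → ω ∈ outcomes
  ∈-outcomes (σ , col) = ∈-cartesianProduct⁺ (∈-enumV (λ { (u , v) → ∈-cartesianProduct⁺ (∈-allFin u) (∈-allFin v) }) σ) (∈-enumV ∈-allFin col)

  module _ (labels : List Label) (labels-unique : Unique labels) (∈-labels : ∀ a → a ∈ labels) (Fail : Vec (Vec Label n) n → ℕ) where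

    loops : List (Vec Label n)
    loops = enumV n labels

    -- Every increasing labelling must fail, because a single one without failure already proves
    -- that the hitting times agree.
    exceptional : Outcome n r → Bool
    exceptional ω = does (valid? ω) ∧ all' (λ s → all' (λ g → 1 ≤ᵇ Fail (point ω s g)) loops) (increasing M N)

    exceptions : List (Outcome n r)
    exceptions = filterᵇ exceptional outcomes

    ∈-exceptions : ∀ ω → Valid ω → (∀ s g → Increasing s → 1 ≤ Fail (point ω s g)) → ω ∈ exceptions
    ∈-exceptions ω V h = ∈-filterᵇ⁺ exceptional (∈-outcomes ω) (true∧ (dec-true (valid? ω) V)
      (true-all _ (increasing M N) (λ {s} s∈ → true-all _ loops (λ {g} _ → ≤ᵇ-complete (h s g (increasing-sound M N s∈))))))

    -- Double counting: each exceptional outcome yields the same number of matrices, different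
    -- triples give different matrices, and each contributes at least one failure.
    exceptions-few : length exceptions * (length (increasing M N) * length loops) ≤ ∑ (enumV n (enumV n labels)) Fail
    exceptions-few = begin
      length exceptions * (length (increasing M N) * length loops)
        ≡⟨ sym (trans (length-pairs exceptions (cartesianProduct (increasing M N) loops)) (cong (length exceptions *_) (length-pairs (increasing M N) loops))) ⟩
      length triples ≡⟨ length≡∑ triples ⟩
      ∑ triples (λ _ → 1) ≤⟨ ∑-mono∈ triples (λ { {ω , s , g} t∈ → fails t∈ }) ⟩
      ∑ triples (λ { (ω , s , g) → Fail (point ω s g) })
        ≤⟨ ∑-injective Fail (λ { (ω , s , g) → point ω s g }) triples _ unique injective (λ _ → ∈-enumV (∈-enumV ∈-labels) _) ⟩
      ∑ (enumV n (enumV n labels)) Fail ∎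
      where
      open ≤-Reasoning
      triples : List (Outcome n r × Vec (Fin M) N × Vec Label n)
      triples = cartesianProduct exceptions (cartesianProduct (increasing M N) loops)
      ∑-mono∈ : {X : Set} (xs : List X) {F : X → ℕ} → (∀ {x} → x ∈ xs → 1 ≤ F x) → ∑ xs (λ _ → 1) ≤ ∑ xs F
      ∑-mono∈ [] h = z≤n
      ∑-mono∈ (x ∷ xs) h = +-mono-≤ (h (here refl)) (∑-mono∈ xs (λ p → h (there p)))
      unique : Unique triples
      unique = cartesianProduct⁺ (filterᵇ-unique exceptional (cartesianProduct⁺ (enumV-unique N (cartesianProduct⁺ (allFin⁺ n) (allFin⁺ n))) (enumV-unique N (allFin⁺ r))))
        (cartesianProduct⁺ (increasing-unique M N) (enumV-unique n labels-unique))
      components : ∀ {ω s g} → (ω , s , g) ∈ triples → exceptional ω ≡ true × (s ∈ increasing M N × g ∈ loops)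
      components t∈ = let (p , q) = ∈-cartesianProduct⁻ exceptions (cartesianProduct (increasing M N) loops) t∈ in
        proj₂ (∈-filterᵇ⁻ exceptional outcomes p) , ∈-cartesianProduct⁻ (increasing M N) loops q
      sound : ∀ {ω} → does (valid? ω) ≡ true → Valid ω
      sound {ω} = does-sound (valid? ω)
        where
        does-sound : {P : Set} (d : Dec P) → does d ≡ true → P
        does-sound (yes p) _ = p
      injective : ∀ {y z} → y ∈ triples → z ∈ triples → _ → y ≡ z
      injective {ω , s , g} {ω' , s' , g'} y∈ z∈ e = let (h , s∈ , _) = components y∈ ; (h' , s'∈ , _) = components z∈ in
        point-injective (sound {ω} (proj₁ (∧-true h))) (sound {ω'} (proj₁ (∧-true h'))) (increasing-sound M N s∈) (increasing-sound M N s'∈) e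
      fails : ∀ {ω s g} → (ω , s , g) ∈ triples → 1 ≤ Fail (point ω s g)
      fails {ω} t∈ = let (h , s∈ , g∈) = components t∈ in
        ≤ᵇ-sound {1} (all-true _ (all-true _ (proj₂ (∧-true {does (valid? ω)} h)) s∈) g∈)

-- The hitting time between the early and the mid labels

module Hitting {r ℓ : ℕ} .{{_ : NonZero ℓ}} (Fr : Frame r ℓ) where

  open Setup Fr
  open Sampling {n} {r} {D * K}

  module _ (surj : ∀ c → ∃[ p ] lookup Π p ≡ c) (2≤n : 2 ≤ n)
    (ω : Outcome n r) (V : Valid ω) (labelling : Vec (Fin (D * K)) N) (loop : Vec Label n) (I : Increasing labelling)
    (ok : failure (point ω labelling loop) ≡ 0) where

    private
      f : Mat
      f = point ω labelling loop

      time : Fin N → ℕ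
      time j = toℕ (lookup labelling j)

      tail≢head : ∀ {j u v} → lookup (proj₁ ω) j ≡ (u , v) → u ≢ v
      tail≢head {j} e h = proj₁ V j (trans (cong proj₁ e) (trans h (sym (cong proj₂ e))))

      order : ∀ i j → time i < time j → toℕ i < toℕ j
      order i j h = ≰⇒> (λ j≤i → by (m≤n⇒m<n∨m≡n j≤i))
        where
        by : ¬ (toℕ j < toℕ i ⊎ toℕ j ≡ toℕ i)
        by (inj₁ j<i) = <-asym h (I j i j<i)
        by (inj₂ e) = <-irrefl (cong time (toℕ-injective (sym e))) h

      dirs : both-dirs fwd f + both-dirs bwd f ≡ 0
      dirs = m+n≡0⇒n≡0 (Eᶠ f) (m+n≡0⇒n≡0 (Eᶜ f) (m+n≡0⇒n≡0 (Eᵃ f) ok))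

      busy : ∀ d u → idle d f u ≡ false
      busy fwd u = ⟦⟧≡0 (∑≡0 (λ u → ⟦ idle fwd f u ⟧) (m+n≡0⇒m≡0 (Eᵇ fwd f) (m+n≡0⇒m≡0 (both-dirs fwd f) dirs)) (∈-allFin u))
      busy bwd u = ⟦⟧≡0 (∑≡0 (λ u → ⟦ idle bwd f u ⟧) (m+n≡0⇒m≡0 (Eᵇ bwd f) (m+n≡0⇒n≡0 (both-dirs fwd f) dirs)) (∈-allFin u))

      mid-arc : ∀ d u → ∃[ v ] ∃[ j ] (lookup (proj₁ ω) j ≡ cell d u v × time j < 2 * K)
      mid-arc d u =
        let (v , v∈ , e) = all-false (λ v → not (mid (f ⟨ cell d u v ⟩))) (filterᵇ (but u) vertices) (busy d u)
            v≢u = ≢ᵇ-sound (not-true (proj₂ (∈-filterᵇ⁻ (but u) vertices v∈)))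
            (j , ej) = arc-of d v v≢u
        in v , j , ej , subst (λ a → toℕ (proj₁ a) < 2 * K) (point-arc ω labelling loop V j ej) (<ᵇ-sound (not-false e))
        where
        arc-of : ∀ d v → v ≢ u → ∃[ j ] lookup (proj₁ ω) j ≡ cell d u v
        arc-of fwd v h = covers ω V (λ e → h (sym e))
        arc-of bwd v h = covers ω V h

      late-vertex : ∃[ u ] (any' (λ v → early (f ⟨ u , v ⟩)) (filterᵇ (but u) vertices) ≡ false)
      late-vertex = let (u , _ , e) = all-false (λ u → any' (λ v → early (f ⟨ u , v ⟩)) (filterᵇ (but u) vertices)) vertices
                                        (⟦⟧≡0 (m+n≡0⇒m≡0 (Eᵃ f) ok)) in u , e

    hitting : HittingTimesEqual Π ω
    hitting t (minDeg , least) = (λ u v u≢v → let (p , y , xs , tr , un) = connected u v u≢v in trail⇒PiPath Π ω t tr un) ,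
      λ i i<t C → least i i<t (PiConnected⇒MinInOut1 Π ω i 2≤n C)
      where
      In : Fin n → Fin n → Fin r → Set
      In = ArcIn ω t

      -- A vertex without early out-arcs has some out-arc at time `t`, so a label of at least `K`
      -- has been reached and every early arc came before.
      late-arc : ∃[ j ] (toℕ j < t × K ≤ time j)
      late-arc = from (proj₂ (minDeg (proj₁ late-vertex)))
        where
        u : Fin n
        u = proj₁ late-vertex
        from : ∃[ w ] ∃[ c ] In u w c → ∃[ j ] (toℕ j < t × K ≤ time j)
        from (w , c , j , j<t , ej , _) = j , j<t , ≮⇒≥ (λ l → contradiction
          (trans (sym (any-false (λ v → early (f ⟨ u , v ⟩)) (proj₂ late-vertex)
              (∈-filterᵇ⁺ (but u) (∈-allFin w) (false-not (≢ᵇ (λ e → tail≢head ej (sym e)))))))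
            (trans (cong early (point-arc ω labelling loop V j ej)) (<ᵇ-complete l))) λ ())

      early-In : ∀ u v → u ≢ v → early (f ⟨ u , v ⟩) ≡ true → In u v (proj₂ (f ⟨ u , v ⟩))
      early-In u v h e = let (j , ej) = covers ω V h
                             q = point-arc ω labelling loop V j ej
                             (j' , j'<t , late) = late-arc
                             before = ≤-trans (<ᵇ-sound (trans (sym (cong early q)) e)) late
        in j , <-trans (order j j' before) j'<t , ej , sym (cong proj₂ q)

      In-mid : ∀ {u v c} → In u v c → u ≢ v × mid (f ⟨ u , v ⟩) ≡ true
      In-mid {u} {v} (j , j<t , ej , _) = tail≢head ej , trans (cong mid (point-arc ω labelling loop V j ej)) (<ᵇ-complete soon)
        where
        -- Otherwise all mid arcs would precede step `j`. They serve every vertex in both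
        -- directions, so the degree condition would hold before `t`.
        soon : time j < 2 * K
        soon = ≰⇒> (λ l → least (toℕ j) j<t (λ x → into l x , out l x))
          where
          earlier : 2 * K ≤ time j → ∀ i → time i < 2 * K → toℕ i < toℕ j
          earlier l i h = order i j (≤-trans h l)
          into : 2 * K ≤ time j → ∀ x → ∃[ w ] ∃[ c ] ArcIn ω (toℕ j) w x c
          into l x = let (w , i , e , h) = mid-arc bwd x in w , _ , i , earlier l i h , e , refl
          out : 2 * K ≤ time j → ∀ x → ∃[ w ] ∃[ c ] ArcIn ω (toℕ j) x w c
          out l x = let (w , i , e , h) = mid-arc fwd x in w , _ , i , earlier l i h , e , refl

      open Routes Fr
      open Connecting surj f ok In early-In In-mid (λ u → proj₂ (minDeg u)) (λ u → proj₁ (minDeg u))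

  labels-unique : Unique labels
  labels-unique = cartesianProduct⁺ (allFin⁺ (D * K)) (allFin⁺ r)

  ∈-labels : ∀ a → a ∈ labels
  ∈-labels (i , c) = ∈-cartesianProduct⁺ (∈-allFin i) (∈-allFin c)

  bad-outcomes : List (Outcome n r)
  bad-outcomes = exceptions labels labels-unique ∈-labels failure

  complete : (∀ c → ∃[ p ] lookup Π p ≡ c) → 2 ≤ n → ∀ ω → Valid ω → ¬ HittingTimesEqual Π ω → ω ∈ bad-outcomes
  complete surj 2≤n ω V ¬h = ∈-exceptions labels labels-unique ∈-labels failure ω V (λ s g I → n≢0⇒n>0 (λ ok → ¬h (hitting surj 2≤n ω V s g I ok)))

  bad-outcomes-few : length bad-outcomes * (length (increasing (D * K) N) * length labels ^ n) ≤ ∑ Ω failure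
  bad-outcomes-few = subst (λ w → length bad-outcomes * (length (increasing (D * K) N) * w) ≤ ∑ Ω failure)
    (length-enumV n labels) (exceptions-few labels labels-unique ∈-labels failure)

-- Numerical estimates

^-distribʳ-* : ∀ a b h → (a * b) ^ h ≡ a ^ h * b ^ h
^-distribʳ-* a b zero = refl
^-distribʳ-* a b (suc h) rewrite ^-distribʳ-* a b h =
  solve 4 (λ a b c d → (a :* b) :* (c :* d) := (a :* c) :* (b :* d)) refl a b (a ^ h) (b ^ h)

-- Bernoulli's inequality (1 - d/B)^h ≥ 1 - h d/B for B = x + d, cleared of denominators.
bernoulli-upper : ∀ x d h → (x + d) ^ h * (x + d) ≤ x ^ h * (x + d) + h * d * (x + d) ^ h
bernoulli-upper x d zero = m≤m+n _ _
bernoulli-upper x d (suc h) = begin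
  B * B ^ h * B ≡⟨ *-assoc B (B ^ h) B ⟩
  B * (B ^ h * B) ≤⟨ *-monoʳ-≤ B (bernoulli-upper x d h) ⟩
  B * (x ^ h * B + h * d * B ^ h)
    ≡⟨ solve 5 (λ x d h X Y → (x :+ d) :* (X :* (x :+ d) :+ h :* d :* Y) := x :* X :* (x :+ d) :+ d :* (X :* (x :+ d)) :+ h :* d :* ((x :+ d) :* Y)) refl x d h (x ^ h) (B ^ h) ⟩
  x * x ^ h * B + d * (x ^ h * B) + h * d * (B * B ^ h)
    ≤⟨ +-monoˡ-≤ _ (+-monoʳ-≤ (x * x ^ h * B) (*-monoʳ-≤ d (*-monoˡ-≤ B (^-monoˡ-≤ h (m≤m+n x d))))) ⟩
  x * x ^ h * B + d * (B ^ h * B) + h * d * (B * B ^ h)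
    ≡⟨ solve 5 (λ P d h Y B → P :+ d :* (Y :* B) :+ h :* d :* (B :* Y) := P :+ (con 1 :+ h) :* d :* (B :* Y)) refl (x * x ^ h * B) d h (B ^ h) B ⟩
  x * x ^ h * B + suc h * d * (B * B ^ h) ∎
  where
  open ≤-Reasoning
  B = x + d

-- The companion (1 - c/B)^h ≤ 1/(1 + h c/B) for B = a + c.
bernoulli-lower : ∀ a c h → a ^ h * (a + c + h * c) ≤ (a + c) ^ suc h
bernoulli-lower a c zero = ≤-reflexive (solve 2 (λ a c → con 1 :* (a :+ c :+ con 0) := (a :+ c) :* con 1) refl a c)
bernoulli-lower a c (suc h) = begin
  a * a ^ h * (a + c + suc h * c) ≤⟨ m≤m+n _ (a ^ h * (c * c + h * c * c)) ⟩
  a * a ^ h * (a + c + suc h * c) + a ^ h * (c * c + h * c * c)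
    ≡⟨ solve 4 (λ a c h P → a :* P :* (a :+ c :+ (con 1 :+ h) :* c) :+ P :* (c :* c :+ h :* c :* c) := (a :+ c) :* (P :* (a :+ c :+ h :* c))) refl a c h (a ^ h) ⟩
  (a + c) * (a ^ h * (a + c + h * c)) ≤⟨ *-monoʳ-≤ (a + c) (bernoulli-lower a c h) ⟩
  (a + c) * (a + c) ^ suc h ∎
  where open ≤-Reasoning

halving : ∀ x d h → 0 < x + d → 2 * (h * d) ≤ x + d → (x + d) ^ h ≤ 2 * x ^ h
halving x d h pos le = *-cancelʳ-≤ _ _ (x + d) {{>-nonZero pos}} (+-cancelʳ-≤ (B ^ h * B) _ _ (begin
  B ^ h * B + B ^ h * B ≤⟨ +-mono-≤ (bernoulli-upper x d h) (bernoulli-upper x d h) ⟩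
  (x ^ h * B + h * d * B ^ h) + (x ^ h * B + h * d * B ^ h)
    ≡⟨ solve 4 (λ X B k Y → (X :* B :+ k :* Y) :+ (X :* B :+ k :* Y) := con 2 :* X :* B :+ con 2 :* k :* Y) refl (x ^ h) B (h * d) (B ^ h) ⟩
  2 * x ^ h * B + 2 * (h * d) * B ^ h ≤⟨ +-monoʳ-≤ (2 * x ^ h * B) (≤-trans (*-monoˡ-≤ (B ^ h) le) (≤-reflexive (*-comm B (B ^ h)))) ⟩
  2 * x ^ h * B + B ^ h * B ∎))
  where
  open ≤-Reasoning
  B = x + d

doubling : ∀ x → 2 * x ^ suc x ≤ suc x ^ suc x
doubling x = begin
  2 * x ^ suc x ≡⟨ solve 2 (λ x P → con 2 :* (x :* P) := P :* (con 2 :* x)) refl x (x ^ x) ⟩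
  x ^ x * (2 * x) ≤⟨ *-monoʳ-≤ (x ^ x) (≤-trans (n≤1+n _) (≤-reflexive (solve 1 (λ x → con 1 :+ con 2 :* x := x :+ con 1 :+ x :* con 1) refl x))) ⟩
  x ^ x * (x + 1 + x * 1) ≤⟨ bernoulli-lower x 1 x ⟩
  (x + 1) ^ suc x ≡⟨ cong (_^ suc x) (+-comm x 1) ⟩
  suc x ^ suc x ∎
  where open ≤-Reasoning

^-split : ∀ a {t T} → t ≤ T → a ^ T ≡ a ^ t * a ^ (T ∸ t)
^-split a {t} {T} h = trans (cong (a ^_) (sym (m+[n∸m]≡n h))) (^-distribˡ-+-* a t (T ∸ t))

-- Each run of `suc x` factors 1 - 1/(x + 1) at least halves the product.
decay : ∀ x y T → suc x * y ≤ T → 2 ^ y * x ^ T ≤ suc x ^ T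
decay x y T h = begin
  2 ^ y * x ^ T ≡⟨ cong (2 ^ y *_) (^-split x h) ⟩
  2 ^ y * (x ^ (suc x * y) * x ^ R) ≡⟨ cong (λ z → 2 ^ y * (z * x ^ R)) (sym (^-*-assoc x (suc x) y)) ⟩
  2 ^ y * ((x ^ suc x) ^ y * x ^ R) ≡⟨ sym (*-assoc (2 ^ y) _ _) ⟩
  2 ^ y * (x ^ suc x) ^ y * x ^ R ≡⟨ cong (_* x ^ R) (sym (^-distribʳ-* 2 (x ^ suc x) y)) ⟩
  (2 * x ^ suc x) ^ y * x ^ R ≤⟨ *-mono-≤ (^-monoˡ-≤ y (doubling x)) (^-monoˡ-≤ R (n≤1+n x)) ⟩
  (suc x ^ suc x) ^ y * suc x ^ R ≡⟨ cong (_* suc x ^ R) (^-*-assoc (suc x) (suc x) y) ⟩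
  suc x ^ (suc x * y) * suc x ^ R ≡⟨ sym (^-split (suc x) h) ⟩
  suc x ^ T ∎
  where
  open ≤-Reasoning
  R = T ∸ suc x * y

cube-growth : ∀ z → (z + 5) * (z + 5) * (z + 5) ≤ 2 * ((z + 4) * (z + 4) * (z + 4))
cube-growth z = ≤-trans (m≤m+n _ (z * z * z + 9 * z * z + 21 * z + 3)) (≤-reflexive
  (solve 1 (λ z → (z :+ con 5) :* (z :+ con 5) :* (z :+ con 5) :+ (z :* z :* z :+ con 9 :* z :* z :+ con 21 :* z :+ con 3)
    := con 2 :* ((z :+ con 4) :* (z :+ con 4) :* (z :+ con 4))) refl z))

-- With y = z + 3 this is (y + 1)^3 ≤ 8 * 2^y: an equality at y = 3, from where on the cube at most
-- doubles at each step.
cube≤exp : ∀ z → (z + 4) * (z + 4) * (z + 4) ≤ 8 * 2 ^ (z + 3)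
cube≤exp zero = ≤-refl
cube≤exp (suc z) = begin
  (suc z + 4) * (suc z + 4) * (suc z + 4) ≡⟨ cong (λ w → w * w * w) (sym (+-suc z 4)) ⟩
  (z + 5) * (z + 5) * (z + 5) ≤⟨ cube-growth z ⟩
  2 * ((z + 4) * (z + 4) * (z + 4)) ≤⟨ *-monoʳ-≤ 2 (cube≤exp z) ⟩
  2 * (8 * 2 ^ (z + 3)) ≡⟨ solve 1 (λ e → con 2 :* (con 8 :* e) := con 8 :* (con 2 :* e)) refl (2 ^ (z + 3)) ⟩
  8 * 2 ^ (suc z + 3) ∎
  where open ≤-Reasoning

square≤exp : ∀ C y → 8 * C + 3 ≤ y → C * (suc y * suc y) ≤ 2 ^ y
square≤exp C y h = *-cancelˡ-≤ 8 (begin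
  8 * (C * (suc y * suc y)) ≡⟨ sym (*-assoc 8 C _) ⟩
  8 * C * (suc y * suc y) ≤⟨ *-monoˡ-≤ (suc y * suc y) (≤-trans (m≤m+n (8 * C) 3) (≤-trans h (n≤1+n y))) ⟩
  suc y * (suc y * suc y) ≡⟨ cong (λ w → w * (w * w)) e4 ⟩
  (z + 4) * ((z + 4) * (z + 4)) ≡⟨ sym (*-assoc (z + 4) (z + 4) (z + 4)) ⟩
  (z + 4) * (z + 4) * (z + 4) ≤⟨ cube≤exp z ⟩
  8 * 2 ^ (z + 3) ≡⟨ cong (λ w → 8 * 2 ^ w) e3 ⟩
  8 * 2 ^ y ∎)
  where
  open ≤-Reasoning
  z = y ∸ 3
  e3 : z + 3 ≡ y
  e3 = m∸n+n≡m (≤-trans (m≤n+m 3 (8 * C)) h)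
  e4 : suc y ≡ z + 4
  e4 = trans (cong suc (sym e3)) (sym (+-suc z 3))

n<2^n : ∀ n → n < 2 ^ n
n<2^n zero = s≤s z≤n
n<2^n (suc n) = ≤-trans (s≤s (n<2^n n)) (≤-trans (+-monoˡ-≤ (2 ^ n) (m^n>0 2 n)) (+-monoʳ-≤ (2 ^ n) (m≤m+n (2 ^ n) 0)))

-- For large `y` the exponential beats the square; for small `y` the left side is below a constant
-- that `n` exceeds.
log-small : ∀ C n y → C * ((8 * C + 4) * (8 * C + 4)) ≤ n → 2 ^ y ≤ n → C * (suc y * suc y) ≤ n
log-small C n y big h with 8 * C + 3 ≤? y
... | yes l = ≤-trans (square≤exp C y l) h
... | no l = ≤-trans (*-monoʳ-≤ C (*-mono-≤ small small)) big
  where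
  small : suc y ≤ 8 * C + 4
  small = ≤-trans (≰⇒> l) (+-monoʳ-≤ (8 * C) (n≤1+n 3))

crossing : {P : ℕ → Set} → (∀ d → Dec (P d)) → ∀ a b → ¬ P a → P (a + b) → ∃[ d ] (a ≤ d × ¬ P d × P (suc d))
crossing {P} P? a zero ¬a p = contradiction (subst P (+-identityʳ a) p) ¬a
crossing {P} P? a (suc b) ¬a p with P? (suc a)
... | yes q = a , ≤-refl , ¬a , q
... | no ¬q = let (d , h , r) = crossing {P} P? (suc a) b ¬q (subst P (+-suc a b) p) in d , ≤-trans (n≤1+n a) h , r

-- The true size of `D` is about n / log n. The last two fields retain what is needed: it is far
-- below n and its square far above n, each by the factor `C`.
record Scale (q C n : ℕ) : Set where
  field
    D : ℕ
    2≤D : 2 ≤ D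
    lower : q * D ^ (n ∸ 1) ≤ n * (D ∸ 1) ^ (n ∸ 1)
    upper : n * (D ∸ 1) ^ (n ∸ 1) ≤ 2 * q * D ^ (n ∸ 1)
    sparse : C * D ≤ n
    dense : C * n ≤ D * D

-- D is taken where n (1 - 1/D)^(n-1) crosses q.
scale : ∀ q C n → 1 ≤ q → 8 ≤ C → C * ((8 * C + 4) * (8 * C + 4)) ≤ n → 2 * q * 2 ^ (3 * C) < n → Scale q C n
scale q C (suc N) 1≤q 8≤C big large = record
  { D = suc d ; 2≤D = s≤s 1≤d ; lower = lower ; upper = upper ; sparse = ≮⇒≥ sparse ; dense = dense }
  where
  open ≤-Reasoning
  n = suc N
  P : ℕ → Set
  P D = q * D ^ N ≤ n * (D ∸ 1) ^ N
  2q≤n : 2 * q ≤ n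
  2q≤n = ≤-trans (≤-reflexive (sym (*-identityʳ _))) (≤-trans (*-monoʳ-≤ (2 * q) (m^n>0 2 (3 * C))) (<⇒≤ large))
  0<N : 0 < N
  0<N = ≤-pred (≤-trans (*-monoʳ-≤ 2 1≤q) 2q≤n)
  ¬P1 : ¬ P 1
  ¬P1 h = contradiction (≤-trans (*-mono-≤ 1≤q (≤-reflexive (sym (^-zeroˡ N)))) (≤-trans h (≤-reflexive (trans (cong (n *_) (0^ N 0<N)) (*-zeroʳ n))))) λ ()
    where
    0^ : ∀ k → 0 < k → 0 ^ k ≡ 0
    0^ (suc k) _ = refl
  -- At D = 2n the power (1 - 1/D)^(n-1) is at least 1/2.
  P2n : P (1 + (N + n))
  P2n = begin
    q * suc (N + n) ^ N ≡⟨ cong (λ z → q * z ^ N) (+-comm 1 (N + n)) ⟩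
    q * (N + n + 1) ^ N ≤⟨ *-monoʳ-≤ q (halving (N + n) 1 N (m≤n+m 1 (N + n)) (≤-trans (≤-reflexive (solve 1 (λ N → con 2 :* (N :* con 1) := N :+ N) refl N)) (≤-trans (+-monoʳ-≤ N (n≤1+n N)) (m≤m+n (N + n) 1)))) ⟩
    q * (2 * (N + n) ^ N) ≡⟨ solve 2 (λ q e → q :* (con 2 :* e) := con 2 :* q :* e) refl q ((N + n) ^ N) ⟩
    2 * q * (N + n) ^ N ≤⟨ *-monoˡ-≤ _ 2q≤n ⟩
    n * (N + n) ^ N ∎
  found : ∃[ d ] (1 ≤ d × ¬ P d × P (suc d))
  found = crossing {P} (λ D → _ ≤? _) 1 (N + n) ¬P1 P2n
  d : ℕ
  d = proj₁ found
  1≤d : 1 ≤ d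
  1≤d = proj₁ (proj₂ found)
  lower : P (suc d)
  lower = proj₂ (proj₂ (proj₂ found))
  instance
    d≢0 : NonZero d
    d≢0 = >-nonZero 1≤d
    d^N≢0 : NonZero (d ^ N)
    d^N≢0 = m^n≢0 d N
  y : ℕ
  y = N / suc d
  -- Here n (1 - 1/D)^N ≥ q ≥ 1 while (1 - 1/D)^N ≤ 2^(-y). Thus `y` is at most logarithmic, and `D`
  -- at least n / (1 + y).
  log : 2 ^ y ≤ n
  log = *-cancelʳ-≤ _ _ (d ^ N) (begin
    2 ^ y * d ^ N ≤⟨ decay d y N (≤-trans (≤-reflexive (*-comm (suc d) y)) (m/n*n≤m N (suc d))) ⟩
    suc d ^ N ≤⟨ m≤n*m (suc d ^ N) q {{>-nonZero 1≤q}} ⟩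
    q * suc d ^ N ≤⟨ lower ⟩
    n * d ^ N ∎)
  n≤ : n ≤ suc d * suc y
  n≤ = begin
    suc N ≡⟨ cong suc (m≡m%n+[m/n]*n N (suc d)) ⟩
    suc (N % suc d) + y * suc d ≤⟨ +-monoˡ-≤ (y * suc d) (m%n<n N (suc d)) ⟩
    suc y * suc d ≡⟨ *-comm (suc y) (suc d) ⟩
    suc d * suc y ∎
  dense : C * n ≤ suc d * suc d
  dense = *-cancelʳ-≤ _ _ (suc y * suc y) (begin
    C * n * (suc y * suc y) ≡⟨ solve 3 (λ C n z → C :* n :* z := n :* (C :* z)) refl C n (suc y * suc y) ⟩
    n * (C * (suc y * suc y)) ≤⟨ *-monoʳ-≤ n (log-small C n y big log) ⟩
    n * n ≤⟨ *-mono-≤ n≤ n≤ ⟩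
    suc d * suc y * (suc d * suc y) ≡⟨ solve 2 (λ a b → (a :* b) :* (a :* b) := (a :* a) :* (b :* b)) refl (suc d) (suc y) ⟩
    suc d * suc d * (suc y * suc y) ∎)
  2n≤dd : 2 * n ≤ d * d
  2n≤dd = *-cancelˡ-≤ 4 (begin
    4 * (2 * n) ≡⟨ sym (*-assoc 4 2 n) ⟩
    8 * n ≤⟨ *-monoˡ-≤ n 8≤C ⟩
    C * n ≤⟨ dense ⟩
    suc d * suc d ≤⟨ *-mono-≤ D≤2d D≤2d ⟩
    2 * d * (2 * d) ≡⟨ solve 1 (λ d → con 2 :* d :* (con 2 :* d) := con 4 :* (d :* d)) refl d ⟩
    4 * (d * d) ∎)
    where
    D≤2d : suc d ≤ 2 * d
    D≤2d = ≤-trans (+-monoˡ-≤ d 1≤d) (+-monoʳ-≤ d (m≤m+n d 0))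
  2≤d : 2 ≤ d
  2≤d = ≰⇒> (λ d≤1 → contradiction (≤-trans 2n≤dd (*-mono-≤ d≤1 d≤1)) (<⇒≱ (≤-trans (s≤s (s≤s z≤n)) (*-monoʳ-≤ 2 (s≤s (z≤n {N}))))))
  e : ℕ
  e = d ∸ 1
  e+1 : e + 1 ≡ d
  e+1 = m∸n+n≡m 1≤d
  instance
    e^N≢0 : NonZero (e ^ N)
    e^N≢0 = m^n≢0 e N {{>-nonZero (∸-monoˡ-≤ 1 2≤d)}}
  -- The condition fails at `d`, so n (1 - 1/d)^N < q. Moving to d + 1 multiplies the power by
  -- (d^2/(d^2 - 1))^N, which is at most 2 because 2n ≤ d^2.
  upper : n * d ^ N ≤ 2 * q * suc d ^ N
  upper = *-cancelʳ-≤ _ _ (e ^ N) (begin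
    n * d ^ N * e ^ N ≡⟨ solve 3 (λ n x y → n :* x :* y := n :* y :* x) refl n (d ^ N) (e ^ N) ⟩
    n * e ^ N * d ^ N ≤⟨ *-monoˡ-≤ (d ^ N) (<⇒≤ (≰⇒> (proj₁ (proj₂ (proj₂ found))))) ⟩
    q * d ^ N * d ^ N ≡⟨ trans (*-assoc q _ _) (cong (q *_) (sym (^-distribʳ-* d d N))) ⟩
    q * (d * d) ^ N ≡⟨ cong (λ z → q * z ^ N) square ⟩
    q * (e * suc d + 1) ^ N ≤⟨ *-monoʳ-≤ q (halving (e * suc d) 1 N (m≤n+m 1 _) (≤-trans (*-monoʳ-≤ 2 (≤-trans (≤-reflexive (*-identityʳ N)) (n≤1+n N))) (≤-trans 2n≤dd (≤-reflexive square)))) ⟩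
    q * (2 * (e * suc d) ^ N) ≡⟨ cong (λ z → q * (2 * z)) (^-distribʳ-* e (suc d) N) ⟩
    q * (2 * (e ^ N * suc d ^ N)) ≡⟨ solve 3 (λ q x y → q :* (con 2 :* (x :* y)) := con 2 :* q :* y :* x) refl q (e ^ N) (suc d ^ N) ⟩
    2 * q * suc d ^ N * e ^ N ∎)
    where
    square : d * d ≡ e * suc d + 1
    square = trans (cong (λ z → z * z) (sym e+1)) (trans (solve 1 (λ e → (e :+ con 1) :* (e :+ con 1) := e :* (con 1 :+ (e :+ con 1)) :+ con 1) refl e) (cong (λ z → e * suc z + 1) e+1))
  -- If `D` were above n/C, then (1 - 1/D)^N would be at least 2^(-3C), and `upper` would contradict
  -- the size of n.
  sparse : ¬ (n < C * suc d)
  sparse lt = contradiction (*-cancelʳ-≤ _ _ (d ^ N) (begin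
      n * d ^ N ≤⟨ upper ⟩
      2 * q * suc d ^ N ≤⟨ *-monoʳ-≤ (2 * q) slow ⟩
      2 * q * (2 ^ (3 * C) * d ^ N) ≡⟨ sym (*-assoc (2 * q) _ _) ⟩
      2 * q * 2 ^ (3 * C) * d ^ N ∎)) (<⇒≱ large)
    where
    h : ℕ
    h = suc d / 2
    2h≤D : 2 * h ≤ suc d
    2h≤D = ≤-trans (≤-reflexive (*-comm 2 h)) (m/n*n≤m (suc d) 2)
    D≤3h : suc d ≤ 3 * h
    D≤3h = begin
      suc d ≡⟨ m≡m%n+[m/n]*n (suc d) 2 ⟩
      suc d % 2 + h * 2 ≤⟨ +-monoˡ-≤ (h * 2) (≤-trans (≤-pred (m%n<n (suc d) 2)) 1≤h) ⟩
      h + h * 2 ≡⟨ solve 1 (λ h → h :+ h :* con 2 := con 3 :* h) refl h ⟩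
      3 * h ∎
      where
      1≤h : 1 ≤ h
      1≤h = ≰⇒> (λ h≤0 → contradiction (≤-trans (≤-reflexive (m≡m%n+[m/n]*n (suc d) 2)) (≤-trans (+-monoʳ-≤ (suc d % 2) (*-monoˡ-≤ 2 h≤0)) (≤-trans (≤-reflexive (+-identityʳ _)) (≤-pred (m%n<n (suc d) 2))))) (<⇒≱ (s≤s 1≤d)))
    T : ℕ
    T = h * (3 * C)
    N≤T : N ≤ T
    N≤T = begin
      N ≤⟨ n≤1+n N ⟩
      n ≤⟨ <⇒≤ lt ⟩
      C * suc d ≤⟨ *-monoʳ-≤ C D≤3h ⟩
      C * (3 * h) ≡⟨ solve 2 (λ C h → C :* (con 3 :* h) := h :* (con 3 :* C)) refl C h ⟩
      T ∎
    slow : suc d ^ N ≤ 2 ^ (3 * C) * d ^ N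
    slow = *-cancelʳ-≤ _ _ (d ^ (T ∸ N)) {{m^n≢0 d (T ∸ N)}} (begin
      suc d ^ N * d ^ (T ∸ N) ≤⟨ *-monoʳ-≤ (suc d ^ N) (^-monoˡ-≤ (T ∸ N) (n≤1+n d)) ⟩
      suc d ^ N * suc d ^ (T ∸ N) ≡⟨ sym (^-split (suc d) N≤T) ⟩
      suc d ^ (h * (3 * C)) ≡⟨ sym (^-*-assoc (suc d) h (3 * C)) ⟩
      (suc d ^ h) ^ (3 * C) ≤⟨ ^-monoˡ-≤ (3 * C) (subst (λ z → z ^ h ≤ 2 * d ^ h) (+-comm d 1) (halving d 1 h (m≤n+m 1 d)
          (≤-trans (*-monoʳ-≤ 2 (≤-reflexive (*-identityʳ h))) (≤-trans 2h≤D (≤-reflexive (+-comm 1 d)))))) ⟩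
      (2 * d ^ h) ^ (3 * C) ≡⟨ ^-distribʳ-* 2 (d ^ h) (3 * C) ⟩
      2 ^ (3 * C) * (d ^ h) ^ (3 * C) ≡⟨ cong (2 ^ (3 * C) *_) (^-*-assoc d h (3 * C)) ⟩
      2 ^ (3 * C) * d ^ T ≡⟨ cong (2 ^ (3 * C) *_) (^-split d N≤T) ⟩
      2 ^ (3 * C) * (d ^ N * d ^ (T ∸ N)) ≡⟨ sym (*-assoc (2 ^ (3 * C)) _ _) ⟩
      2 ^ (3 * C) * d ^ N * d ^ (T ∸ N) ∎)

-- (1 - c/t)^n ≤ 1/(1 + n c/t) ≤ 1/q, where n c/t is the expected number of vertices without early
-- out-arc.
num-a : ∀ q n t c → 0 < t → c ≤ t → q * t ≤ n * c → q * (t ∸ c) ^ n ≤ t ^ n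
num-a q n t c pos c≤t h = *-cancelˡ-≤ t {{>-nonZero pos}} (begin
  t * (q * a ^ n) ≡⟨ solve 3 (λ t q p → t :* (q :* p) := p :* (q :* t)) refl t q (a ^ n) ⟩
  a ^ n * (q * t) ≤⟨ *-monoʳ-≤ (a ^ n) (≤-trans h (m≤n+m (n * c) (a + c))) ⟩
  a ^ n * (a + c + n * c) ≤⟨ bernoulli-lower a c n ⟩
  (a + c) ^ suc n ≡⟨ cong (_^ suc n) (m∸n+n≡m c≤t) ⟩
  t * t ^ n ∎)
  where
  open ≤-Reasoning
  a = t ∸ c

square≤ : ∀ q n U V → n * U ≤ 2 * q * V → n * U * (n * U) ≤ 4 * q * q * (V * V)
square≤ q n U V h = ≤-trans (*-mono-≤ h h) (≤-reflexive
  (solve 2 (λ q V → con 2 :* q :* V :* (con 2 :* q :* V) := con 4 :* q :* q :* (V :* V)) refl q V))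

-- As e (e + 2) ≤ (e + 1)^2, one has n (1 - 2/D)^N ≤ n (1 - 1/D)^(2N) ≤ 4 q^2/n for D = e + 2.
num-b : ∀ q n N e → 0 < n → n * suc e ^ N ≤ 2 * q * suc (suc e) ^ N → 4 * q * q * q ≤ n →
  q * (n * e ^ N) ≤ suc (suc e) ^ N
num-b q n N e pos upper big = *-cancelʳ-≤ _ _ (n * V) {{m*n≢0 n V {{>-nonZero pos}} {{m^n≢0 (suc (suc e)) N}}}} (begin
  q * (n * e ^ N) * (n * V) ≡⟨ solve 4 (λ q n E V → q :* (n :* E) :* (n :* V) := q :* (n :* n :* (E :* V))) refl q n (e ^ N) V ⟩
  q * (n * n * (e ^ N * V)) ≡⟨ cong (λ z → q * (n * n * z)) (sym (^-distribʳ-* e (suc (suc e)) N)) ⟩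
  q * (n * n * (e * suc (suc e)) ^ N) ≤⟨ *-monoʳ-≤ q (*-monoʳ-≤ (n * n) (^-monoˡ-≤ N (≤-trans (n≤1+n _) (≤-reflexive
      (solve 1 (λ e → con 1 :+ e :* (con 2 :+ e) := (con 1 :+ e) :* (con 1 :+ e)) refl e))))) ⟩
  q * (n * n * (suc e * suc e) ^ N) ≡⟨ cong (λ z → q * (n * n * z)) (^-distribʳ-* (suc e) (suc e) N) ⟩
  q * (n * n * (U * U)) ≡⟨ cong (q *_) (solve 2 (λ n U → n :* n :* (U :* U) := n :* U :* (n :* U)) refl n U) ⟩
  q * (n * U * (n * U)) ≤⟨ *-monoʳ-≤ q (square≤ q n U V upper) ⟩
  q * (4 * q * q * (V * V)) ≡⟨ solve 2 (λ q V → q :* (con 4 :* q :* q :* (V :* V)) := con 4 :* q :* q :* q :* (V :* V)) refl q V ⟩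
  4 * q * q * q * (V * V) ≤⟨ *-monoˡ-≤ (V * V) big ⟩
  n * (V * V) ≡⟨ solve 2 (λ n V → n :* (V :* V) := V :* (n :* V)) refl n V ⟩
  V * (n * V) ∎)
  where
  open ≤-Reasoning
  U = suc e ^ N
  V = suc (suc e) ^ N

-- Of the three factors `2 ^ m` gained, two pay for the pairs of sets and the third for the
-- constant.
num-c : ∀ q r m T x → suc x * (3 * m) ≤ T → 15 * q * r ≤ 2 ^ m →
  let z = r * (2 ^ m * (2 ^ m * x ^ T)) in q * (5 * (z + (z + z))) ≤ suc x ^ T
num-c q r m T x h big = begin
  q * (5 * (z + (z + z))) ≡⟨ solve 4 (λ q r P E → let z = r :* (P :* (P :* E)) in q :* (con 5 :* (z :+ (z :+ z))) := con 15 :* q :* r :* (P :* (P :* E))) refl q r (2 ^ m) (x ^ T) ⟩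
  15 * q * r * (2 ^ m * (2 ^ m * x ^ T)) ≤⟨ *-monoˡ-≤ (2 ^ m * (2 ^ m * x ^ T)) big ⟩
  2 ^ m * (2 ^ m * (2 ^ m * x ^ T)) ≡⟨ solve 2 (λ P E → P :* (P :* (P :* E)) := P :* (P :* (P :* con 1)) :* E) refl (2 ^ m) (x ^ T) ⟩
  (2 ^ m) ^ 3 * x ^ T ≡⟨ cong (_* x ^ T) (trans (^-*-assoc 2 m 3) (cong (2 ^_) (*-comm m 3))) ⟩
  2 ^ (3 * m) * x ^ T ≤⟨ decay x (3 * m) T h ⟩
  suc x ^ T ∎
  where
  open ≤-Reasoning
  z = r * (2 ^ m * (2 ^ m * x ^ T))

-- The ratio n/(b + 1) is at most a constant times y + 1, which the decay 2^(-y) outweighs.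
num-d : ∀ q n ℓ r D b y T x → suc x ≡ D * r → suc x * y ≤ T → n ≤ 60 * (suc x * suc y) → D ≤ suc b * (8 * q * q) →
  q * (5 * ℓ) * 60 * r * (8 * q * q) * suc y ≤ 2 ^ y →
  q * (n * (5 * (ℓ * x ^ T))) ≤ suc b * suc x ^ T
num-d q n ℓ r D b y T x U≡ h n≤ D≤ big = begin
  q * (n * (5 * (ℓ * E))) ≤⟨ *-monoʳ-≤ q (*-monoˡ-≤ (5 * (ℓ * E)) n≤) ⟩
  q * (60 * (suc x * suc y) * (5 * (ℓ * E))) ≡⟨ cong (λ U → q * (60 * (U * suc y) * (5 * (ℓ * E)))) U≡ ⟩
  q * (60 * (D * r * suc y) * (5 * (ℓ * E)))
    ≡⟨ solve 6 (λ q D r V ℓ E → q :* (con 60 :* (D :* r :* V) :* (con 5 :* (ℓ :* E))) := D :* (q :* (con 5 :* ℓ) :* con 60 :* r :* V :* E)) refl q D r (suc y) ℓ E ⟩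
  D * (q * (5 * ℓ) * 60 * r * suc y * E) ≤⟨ *-monoˡ-≤ _ D≤ ⟩
  suc b * (8 * q * q) * (q * (5 * ℓ) * 60 * r * suc y * E)
    ≡⟨ solve 6 (λ B K P r V E → B :* K :* (P :* con 60 :* r :* V :* E) := B :* ((P :* con 60 :* r :* K :* V) :* E)) refl (suc b) (8 * q * q) (q * (5 * ℓ)) r (suc y) E ⟩
  suc b * (q * (5 * ℓ) * 60 * r * (8 * q * q) * suc y * E) ≤⟨ *-monoʳ-≤ (suc b) (*-monoˡ-≤ E big) ⟩
  suc b * (2 ^ y * E) ≤⟨ *-monoʳ-≤ (suc b) (decay x y T h) ⟩
  suc b * suc x ^ T ∎
  where
  open ≤-Reasoning
  E = x ^ T

halve : ∀ x h → 2 * h ≤ suc x → suc x ^ h ≤ 2 * x ^ h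
halve x h le = subst (λ z → z ^ h ≤ 2 * x ^ h) (+-comm x 1) (halving x 1 h (m≤n+m 1 x)
  (≤-trans (*-monoʳ-≤ 2 (≤-reflexive (*-identityʳ h))) (≤-trans le (≤-reflexive (+-comm 1 x)))))

-- Restoring the `b` missing factors costs at most 2; the expectation is then at most 8 q b/D.
num-e : ∀ q n N b x → n * x ^ N ≤ 2 * q * suc x ^ N → 8 * q * q * b ≤ suc x → 2 * b ≤ suc x → b ≤ N →
  q * (n * (b * (2 * x ^ (N ∸ b)))) ≤ suc x * suc x ^ (N ∸ b)
num-e q n N b x upper small half b≤N = *-cancelˡ-≤ (suc x ^ b) {{m^n≢0 (suc x) b}} (begin
  suc x ^ b * (q * (n * (b * (2 * x ^ t)))) ≤⟨ *-monoˡ-≤ _ (halve x b half) ⟩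
  2 * x ^ b * (q * (n * (b * (2 * x ^ t)))) ≡⟨ solve 5 (λ q n b A B → con 2 :* A :* (q :* (n :* (b :* (con 2 :* B)))) := con 4 :* q :* b :* (n :* (A :* B))) refl q n b (x ^ b) (x ^ t) ⟩
  4 * q * b * (n * (x ^ b * x ^ t)) ≡⟨ cong (λ z → 4 * q * b * (n * z)) (sym (^-split x b≤N)) ⟩
  4 * q * b * (n * x ^ N) ≤⟨ *-monoʳ-≤ (4 * q * b) upper ⟩
  4 * q * b * (2 * q * suc x ^ N) ≡⟨ solve 3 (λ q b V → con 4 :* q :* b :* (con 2 :* q :* V) := con 8 :* q :* q :* b :* V) refl q b (suc x ^ N) ⟩
  8 * q * q * b * suc x ^ N ≤⟨ *-monoˡ-≤ (suc x ^ N) small ⟩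
  suc x * suc x ^ N ≡⟨ cong (suc x *_) (^-split (suc x) b≤N) ⟩
  suc x * (suc x ^ b * suc x ^ t) ≡⟨ solve 3 (λ D A B → D :* (A :* B) := A :* (D :* B)) refl (suc x) (suc x ^ b) (suc x ^ t) ⟩
  suc x ^ b * (suc x * suc x ^ t) ∎)
  where
  open ≤-Reasoning
  t = N ∸ b

-- Restoring the missing factors costs 2 in each direction. Two of the three factors n are absorbed
-- by the squared power, and what remains is at most 64 q^2 n/D^2.
num-f : ∀ q n N b x t → b + t ≡ N → n * x ^ N ≤ 2 * q * suc x ^ N → 64 * q * q * q * n ≤ suc x * suc x → 2 * b ≤ suc x →
  q * (n * (n * (n * (2 ^ 2 * (x ^ t * x ^ t))))) ≤ suc x ^ 2 * (suc x ^ t * suc x ^ t)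
num-f q n N b x t e upper dense half = *-cancelˡ-≤ (suc x ^ b * suc x ^ b) {{m*n≢0 (suc x ^ b) (suc x ^ b) {{m^n≢0 (suc x) b}} {{m^n≢0 (suc x) b}}}} (begin
  suc x ^ b * suc x ^ b * (q * (n * (n * (n * (4 * (x ^ t * x ^ t)))))) ≤⟨ *-monoˡ-≤ _ (*-mono-≤ (halve x b half) (halve x b half)) ⟩
  2 * x ^ b * (2 * x ^ b) * (q * (n * (n * (n * (4 * (x ^ t * x ^ t))))))
    ≡⟨ solve 4 (λ q n A B → con 2 :* A :* (con 2 :* A) :* (q :* (n :* (n :* (n :* (con 4 :* (B :* B)))))) := con 16 :* q :* n :* (n :* (A :* B) :* (n :* (A :* B)))) refl q n (x ^ b) (x ^ t) ⟩
  16 * q * n * (n * (x ^ b * x ^ t) * (n * (x ^ b * x ^ t))) ≡⟨ cong (λ z → 16 * q * n * (n * z * (n * z))) (split x) ⟩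
  16 * q * n * (n * x ^ N * (n * x ^ N)) ≤⟨ *-monoʳ-≤ (16 * q * n) (square≤ q n (x ^ N) V upper) ⟩
  16 * q * n * (4 * q * q * (V * V)) ≡⟨ solve 3 (λ q n V → con 16 :* q :* n :* (con 4 :* q :* q :* V) := con 64 :* q :* q :* q :* n :* V) refl q n (V * V) ⟩
  64 * q * q * q * n * (V * V) ≤⟨ *-monoˡ-≤ (V * V) dense ⟩
  suc x * suc x * (V * V) ≡⟨ cong (λ z → suc x * suc x * (z * z)) (sym (split (suc x))) ⟩
  suc x * suc x * (suc x ^ b * suc x ^ t * (suc x ^ b * suc x ^ t))
    ≡⟨ solve 3 (λ D A B → D :* D :* (A :* B :* (A :* B)) := A :* A :* (D :* (D :* con 1) :* (B :* B))) refl (suc x) (suc x ^ b) (suc x ^ t) ⟩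
  suc x ^ b * suc x ^ b * (suc x ^ 2 * (suc x ^ t * suc x ^ t)) ∎)
  where
  open ≤-Reasoning
  V = suc x ^ N
  split : ∀ a → a ^ b * a ^ t ≡ a ^ N
  split a = trans (sym (^-distribˡ-+-* a b t)) (cong (a ^_) e)

-- Blocks, constants and the total probability of failure

module Blocks (n m : ℕ) (fits : 15 * m ≤ n) where

  block : Fin 5 → Fin 3 → Fin m → Fin n
  block i c x = inject≤ (combine (combine i c) x) fits

  part : Fin n → ℕ
  part v with toℕ v <? 15 * m
  ... | yes h = toℕ (proj₁ (remQuot {5} 3 (proj₁ (remQuot {15} m (fromℕ< h)))))
  -- The vertices left over belong to no block, so they get an index that no block has.
  ... | no _ = 5

  part-block : ∀ i c x → part (block i c x) ≡ toℕ i
  part-block i c x with toℕ (block i c x) <? 15 * m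
  ... | no h = contradiction (subst (_< 15 * m) (sym (toℕ-inject≤ (combine (combine i c) x) fits)) (toℕ<n (combine (combine i c) x))) h
  ... | yes h = trans (cong (λ z → toℕ (proj₁ (remQuot {5} 3 (proj₁ (remQuot {15} m z))))) code)
      (trans (cong (λ z → toℕ (proj₁ (remQuot {5} 3 (proj₁ z)))) (remQuot-combine (combine i c) x)) (cong (λ z → toℕ (proj₁ z)) (remQuot-combine i c)))
    where
    code : fromℕ< h ≡ combine (combine i c) x
    code = toℕ-injective (trans (toℕ-fromℕ< h) (toℕ-inject≤ (combine (combine i c) x) fits))

  block-injective : ∀ i {c c' x x'} → block i c x ≡ block i c' x' → c ≡ c' × x ≡ x'
  block-injective i {c} {c'} {x} {x'} e =
    let (e₁ , e₂) = combine-injective (combine i c) x (combine i c') x' (inject≤-injective fits fits _ _ e)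
    in proj₂ (combine-injective i c i c' e₁) , e₂

module Parameters (q r ℓ : ℕ) where

  -- `A` is the constant to beat in `num-d`. The summands of `C` serve `scale`, `num-f`, `y-large`
  -- and `s-large`. Those of the threshold serve `scale` (two of them), `num-b` and the lower bound
  -- on `m`.
  A C threshold : ℕ
  A = q * (5 * ℓ) * 60 * r * (8 * q * q)
  C = 8 + 64 * q * q * q + 60 * r * (8 * A + 3) + 240 * ℓ * (24 * ℓ * r)
  threshold = C * ((8 * C + 4) * (8 * C + 4)) + suc (2 * q * 2 ^ (3 * C)) + 4 * q * q * q + 15 * (15 * q * r + 4 * ℓ)

module Estimate (q r ℓ : ℕ) .{{ℓ≢0 : NonZero ℓ}} (1≤q : 1 ≤ q) (1≤r : 1 ≤ r) (Π : Vec (Fin r) ℓ) (n : ℕ)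
  (large : Parameters.threshold q r ℓ ≤ n) where

  open Parameters q r ℓ

  1≤ℓ : 1 ≤ ℓ
  1≤ℓ = >-nonZero⁻¹ ℓ

  private
    x₁ x₂ x₃ x₄ : ℕ
    x₁ = C * ((8 * C + 4) * (8 * C + 4))
    x₂ = suc (2 * q * 2 ^ (3 * C))
    x₃ = 4 * q * q * q
    x₄ = 15 * (15 * q * r + 4 * ℓ)

  n≥₁ : x₁ ≤ n
  n≥₁ = ≤-trans (≤-trans (m≤m+n x₁ x₂) (≤-trans (m≤m+n (x₁ + x₂) x₃) (m≤m+n (x₁ + x₂ + x₃) x₄))) large

  n≥₂ : x₂ ≤ n
  n≥₂ = ≤-trans (≤-trans (m≤n+m x₂ x₁) (≤-trans (m≤m+n (x₁ + x₂) x₃) (m≤m+n (x₁ + x₂ + x₃) x₄))) large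

  n≥₃ : x₃ ≤ n
  n≥₃ = ≤-trans (≤-trans (m≤n+m x₃ (x₁ + x₂)) (m≤m+n (x₁ + x₂ + x₃) x₄)) large

  n≥₄ : x₄ ≤ n
  n≥₄ = ≤-trans (m≤n+m x₄ (x₁ + x₂ + x₃)) large

  C₁ C₂ C₃ C₄ : ℕ
  C₁ = 8
  C₂ = 64 * q * q * q
  C₃ = 60 * r * (8 * A + 3)
  C₄ = 240 * ℓ * (24 * ℓ * r)

  C≥₁ : C₁ ≤ C
  C≥₁ = ≤-trans (m≤m+n C₁ C₂) (≤-trans (m≤m+n (C₁ + C₂) C₃) (m≤m+n (C₁ + C₂ + C₃) C₄))

  C≥₂ : C₂ ≤ C
  C≥₂ = ≤-trans (m≤n+m C₂ C₁) (≤-trans (m≤m+n (C₁ + C₂) C₃) (m≤m+n (C₁ + C₂ + C₃) C₄))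

  C≥₃ : C₃ ≤ C
  C≥₃ = ≤-trans (m≤n+m C₃ (C₁ + C₂)) (m≤m+n (C₁ + C₂ + C₃) C₄)

  C≥₄ : C₄ ≤ C
  C≥₄ = m≤n+m C₄ (C₁ + C₂ + C₃)

  open Scale (scale q C n 1≤q C≥₁ n≥₁ n≥₂)

  instance
    4ℓ≢0 : NonZero (4 * ℓ)
    4ℓ≢0 = m*n≢0 4 ℓ
    qq≢0 : NonZero (8 * q * q)
    qq≢0 = >-nonZero (*-mono-≤ {1} {8 * q} {1} (*-mono-≤ {1} {8} {1} (s≤s z≤n) 1≤q) 1≤q)

  -- There are 15 classes of `m` vertices. With `4 * ℓ * s ≤ m` a class has room for a path of
  -- length 2ℓs, for `s` new vertices and for ℓ dead classes. `K` gives at least 2 N^2 labels.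
  m s b₀ K N : ℕ
  m = n / 15
  s = m / (4 * ℓ)
  b₀ = D / (8 * q * q)
  N = N′ n
  K = suc (2 * (N * N))

  fits : 15 * m ≤ n
  fits = ≤-trans (≤-reflexive (*-comm 15 m)) (m/n*n≤m n 15)

  div-upper : ∀ a b .{{_ : NonZero b}} → a < b * suc (a / b)
  div-upper a b = begin-strict
    a ≡⟨ m≡m%n+[m/n]*n a b ⟩
    a % b + a / b * b <⟨ +-monoˡ-< (a / b * b) (m%n<n a b) ⟩
    suc (a / b) * b ≡⟨ *-comm (suc (a / b)) b ⟩
    b * suc (a / b) ∎
    where open ≤-Reasoning

  le-div : ∀ a b c .{{_ : NonZero b}} → c * b ≤ a → c ≤ a / b
  le-div a b c h = ≤-trans (≤-reflexive (sym (m*n/n≡m c b))) (/-monoˡ-≤ b h)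

  m≥ : 15 * q * r + 4 * ℓ ≤ m
  m≥ = le-div n 15 _ (≤-trans (≤-reflexive (*-comm (15 * q * r + 4 * ℓ) 15)) n≥₄)

  4ℓ≤m : 4 * ℓ ≤ m
  4ℓ≤m = ≤-trans (m≤n+m (4 * ℓ) (15 * q * r)) m≥

  1≤m : 1 ≤ m
  1≤m = ≤-trans (*-mono-≤ {1} {4} {1} (s≤s z≤n) 1≤ℓ) 4ℓ≤m

  1≤s : 1 ≤ s
  1≤s = le-div m (4 * ℓ) 1 (≤-trans (≤-reflexive (*-identityˡ (4 * ℓ))) 4ℓ≤m)

  4ℓs≤m : 4 * ℓ * s ≤ m
  4ℓs≤m = ≤-trans (≤-reflexive (*-comm (4 * ℓ) s)) (m/n*n≤m m (4 * ℓ))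

  n≤30m : n ≤ 30 * m
  n≤30m = ≤-trans (<⇒≤ (div-upper n 15)) (≤-trans (*-monoʳ-≤ 15 (+-monoˡ-≤ m 1≤m)) (≤-reflexive (solve 1 (λ m → con 15 :* (m :+ m) := con 30 :* m) refl m)))

  m≤8ℓs : m ≤ 8 * ℓ * s
  m≤8ℓs = ≤-trans (<⇒≤ (div-upper m (4 * ℓ))) (≤-trans (*-monoʳ-≤ (4 * ℓ) (+-monoˡ-≤ s 1≤s)) (≤-reflexive (solve 2 (λ ℓ s → con 4 :* ℓ :* (s :+ s) := con 8 :* ℓ :* s) refl ℓ s)))

  4s≤m : 4 * s ≤ m
  4s≤m = ≤-trans (*-monoˡ-≤ s (≤-trans (≤-reflexive (sym (*-identityʳ 4))) (*-monoʳ-≤ 4 1≤ℓ))) 4ℓs≤m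

  room : (s * ℓ + s * ℓ) + s + ℓ * s ≤ m
  room = ≤-trans (+-monoˡ-≤ (ℓ * s) (+-monoʳ-≤ (s * ℓ + s * ℓ) (≤-trans (≤-reflexive (sym (*-identityʳ s))) (*-monoʳ-≤ s 1≤ℓ))))
    (≤-trans (≤-reflexive (solve 2 (λ s l → (s :* l :+ s :* l) :+ s :* l :+ l :* s := con 4 :* l :* s) refl s ℓ)) 4ℓs≤m)

  open Blocks n m fits

  frame : Frame r ℓ
  frame = record
    { Π = Π ; n = n ; m = m ; s = s ; D = D ; K = K ; b₀ = b₀ ; 1≤r = 1≤r ; 2≤D = 2≤D ; 1≤K = s≤s z≤n
    ; origin = fromℕ< 1≤m ; room = room ; blk = block ; pt = part ; pt-blk = part-block ; blk-injective = block-injective }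

  x : ℕ
  x = D ∸ 1

  D≡ : suc x ≡ D
  D≡ = trans (+-comm 1 x) (m∸n+n≡m (<⇒≤ 2≤D))

  at-D : (P : ℕ → Set) → P D → P (suc x)
  at-D P = subst P (sym D≡)

  upper′ : n * x ^ (n ∸ 1) ≤ 2 * q * suc x ^ (n ∸ 1)
  upper′ = at-D (λ d → n * x ^ (n ∸ 1) ≤ 2 * q * d ^ (n ∸ 1)) upper

  z : ℕ
  z = D * r ∸ 1

  0<Dr : 0 < D * r
  0<Dr = *-mono-≤ {1} {D} {1} (<⇒≤ 2≤D) 1≤r

  z≡ : suc z ≡ D * r
  z≡ = trans (+-comm 1 z) (m∸n+n≡m 0<Dr)

  instance
    Dr≢0 : NonZero (D * r)
    Dr≢0 = >-nonZero 0<Dr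

  T y : ℕ
  T = m ∸ s
  y = T / (D * r)

  m≤2T : m ≤ 2 * T
  m≤2T = +-cancelʳ-≤ (2 * s) _ _ (begin
    m + 2 * s ≤⟨ +-monoʳ-≤ m (≤-trans (*-monoˡ-≤ s (s≤s (s≤s (z≤n {2})))) 4s≤m) ⟩
    m + m ≡⟨ cong (m +_) (sym (+-identityʳ m)) ⟩
    2 * m ≡⟨ cong (2 *_) (sym (m∸n+n≡m (≤-trans (m≤n*m s 4) 4s≤m))) ⟩
    2 * (T + s) ≡⟨ *-distribˡ-+ 2 T s ⟩
    2 * T + 2 * s ∎)
    where open ≤-Reasoning

  n≤60T : n ≤ 60 * T
  n≤60T = ≤-trans n≤30m (≤-trans (*-monoʳ-≤ 30 m≤2T) (≤-reflexive (sym (*-assoc 30 2 T))))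

  y-large : 8 * A + 3 ≤ y
  y-large = le-div T (D * r) (8 * A + 3) (*-cancelˡ-≤ 60 (begin
    60 * ((8 * A + 3) * (D * r)) ≡⟨ solve 3 (λ a D r → con 60 :* (a :* (D :* r)) := con 60 :* r :* a :* D) refl (8 * A + 3) D r ⟩
    60 * r * (8 * A + 3) * D ≤⟨ *-monoˡ-≤ D C≥₃ ⟩
    C * D ≤⟨ sparse ⟩
    n ≤⟨ n≤60T ⟩
    60 * T ∎))
    where open ≤-Reasoning

  exponential : A * suc y ≤ 2 ^ y
  exponential = ≤-trans (*-monoʳ-≤ A (≤-trans (≤-reflexive (sym (*-identityʳ (suc y)))) (*-monoʳ-≤ (suc y) (s≤s (z≤n {y}))))) (square≤exp A y y-large)

  s-large : 24 * ℓ * r * D ≤ s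
  s-large = *-cancelˡ-≤ (240 * ℓ) {{m*n≢0 240 ℓ}} (begin
    240 * ℓ * (24 * ℓ * r * D) ≡⟨ sym (*-assoc (240 * ℓ) (24 * ℓ * r) D) ⟩
    240 * ℓ * (24 * ℓ * r) * D ≤⟨ *-monoˡ-≤ D C≥₄ ⟩
    C * D ≤⟨ sparse ⟩
    n ≤⟨ n≤30m ⟩
    30 * m ≤⟨ *-monoʳ-≤ 30 m≤8ℓs ⟩
    30 * (8 * ℓ * s) ≡⟨ solve 2 (λ ℓ s → con 30 :* (con 8 :* ℓ :* s) := con 240 :* ℓ :* s) refl ℓ s ⟩
    240 * ℓ * s ∎)
    where open ≤-Reasoning

  entropy : D * r * (3 * m) ≤ s * s
  entropy = begin
    D * r * (3 * m) ≤⟨ *-monoʳ-≤ (D * r) (*-monoʳ-≤ 3 m≤8ℓs) ⟩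
    D * r * (3 * (8 * ℓ * s)) ≡⟨ solve 4 (λ D r ℓ s → D :* r :* (con 3 :* (con 8 :* ℓ :* s)) := con 24 :* ℓ :* r :* D :* s) refl D r ℓ s ⟩
    24 * ℓ * r * D * s ≤⟨ *-monoˡ-≤ s s-large ⟩
    s * s ∎
    where open ≤-Reasoning

  8b₀≤D : 8 * q * q * b₀ ≤ D
  8b₀≤D = ≤-trans (≤-reflexive (*-comm (8 * q * q) b₀)) (m/n*n≤m D (8 * q * q))

  C*≤ : ∀ {c} → c ≤ C → c * n ≤ D * D
  C*≤ h = ≤-trans (*-monoˡ-≤ n h) dense

  8≤n : 8 ≤ n
  8≤n = ≤-trans C≥₁ (≤-trans (≤-trans (≤-reflexive (sym (*-identityʳ C))) (*-monoʳ-≤ C (*-mono-≤ {1} {8 * C + 4} {1} (≤-trans (s≤s z≤n) (m≤n+m 4 (8 * C))) (≤-trans (s≤s z≤n) (m≤n+m 4 (8 * C)))))) n≥₁)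

  8≤D : 8 ≤ D
  8≤D = ≰⇒> (λ D≤7 → contradiction (≤-trans (*-monoʳ-≤ 8 8≤n) (≤-trans (C*≤ C≥₁) (*-mono-≤ D≤7 D≤7))) (<⇒≱ (m≤m+n 50 14)))

  -- The extra 2 accounts for the exponent in `cherry-rare`, which starts from `n ∸ 3` instead of
  -- `n ∸ 1`.
  half-b₀ : 2 * (b₀ + 2) ≤ D
  half-b₀ = *-cancelˡ-≤ 4 (begin
    4 * (2 * (b₀ + 2)) ≡⟨ solve 1 (λ b → con 4 :* (con 2 :* (b :+ con 2)) := con 8 :* b :+ con 16) refl b₀ ⟩
    8 * b₀ + 16 ≤⟨ +-mono-≤ (≤-trans (*-monoˡ-≤ b₀ (≤-trans (≤-reflexive (sym (*-identityʳ 8))) (*-mono-≤ {8} {8 * q} {1} (≤-trans (≤-reflexive (sym (*-identityʳ 8))) (*-monoʳ-≤ 8 1≤q)) 1≤q))) 8b₀≤D) (*-monoʳ-≤ 2 8≤D) ⟩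
    D + 2 * D ≤⟨ m≤n+m (D + 2 * D) D ⟩
    4 * D ∎)
    where open ≤-Reasoning

  b₀+2≤N : b₀ + 2 ≤ n ∸ 1
  b₀+2≤N = ≤-trans (≤-trans (m≤m+n (b₀ + 2) (b₀ + 2 + 0)) half-b₀) (∸-monoˡ-≤ 1 (begin
    suc D ≤⟨ +-monoˡ-≤ D (<⇒≤ 2≤D) ⟩
    D + D ≡⟨ cong (D +_) (sym (+-identityʳ D)) ⟩
    2 * D ≤⟨ *-monoˡ-≤ D (≤-trans (s≤s (s≤s z≤n)) C≥₁) ⟩
    C * D ≤⟨ sparse ⟩
    n ∎))
    where open ≤-Reasoning

  open Setup frame using (total; Ω; failure; Eᵃ; Eᵇ; Eᶜ; Eᵈ; Eᵉ; Eᶠ; both-dirs; Mat) public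
  open Bounds frame
  open Bounds₂ frame
  open Rare

  Rare-scale : ∀ {num den F} → 0 < den → q * num ≤ den → Rare num den F → q * ∑ Ω F ≤ total
  Rare-scale {num} {den} {F} pos le R = *-cancelˡ-≤ den {{>-nonZero pos}} (begin
    den * (q * ∑ Ω F) ≡⟨ solve 3 (λ d q s → d :* (q :* s) := q :* (d :* s)) refl den q (∑ Ω F) ⟩
    q * (den * ∑ Ω F) ≤⟨ *-monoʳ-≤ q (bound R) ⟩
    q * (num * total) ≡⟨ sym (*-assoc q num total) ⟩
    q * num * total ≤⟨ *-monoˡ-≤ total le ⟩
    den * total ∎)
    where open ≤-Reasoning

  0<D^ : ∀ e → 0 < D ^ e
  0<D^ e = m^n>0 D {{>-nonZero (<⇒≤ 2≤D)}} e

  a-rare : q * ∑ Ω Eᵃ ≤ total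
  a-rare = Rare-scale (m^n>0 (D ^ (n ∸ 1)) {{>-nonZero (0<D^ (n ∸ 1))}} n)
    (num-a q n (D ^ (n ∸ 1)) (x ^ (n ∸ 1)) (0<D^ (n ∸ 1)) (^-monoˡ-≤ (n ∸ 1) (m∸n≤m D 1)) lower) Eᵃ-rare

  b-rare : ∀ d → q * ∑ Ω (Eᵇ d) ≤ total
  b-rare d = Rare-scale (0<D^ (n ∸ 1)) (subst (λ z → q * (n * (D ∸ 2) ^ (n ∸ 1)) ≤ z ^ (n ∸ 1)) D≡₂
      (num-b q n (n ∸ 1) (D ∸ 2) (≤-trans (s≤s z≤n) 8≤n)
        (subst₂ (λ a b → n * a ^ (n ∸ 1) ≤ 2 * q * b ^ (n ∸ 1)) (sym x≡) (sym D≡₂) upper) n≥₃)) (Eᵇ-rare d)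
    where
    D≡₂ : suc (suc (D ∸ 2)) ≡ D
    D≡₂ = trans (+-comm 2 (D ∸ 2)) (m∸n+n≡m 2≤D)
    x≡ : suc (D ∸ 2) ≡ x
    x≡ = suc-injective (trans D≡₂ (sym D≡))

  c-rare : q * ∑ Ω Eᶜ ≤ total
  c-rare = Rare-scale (m^n>0 (D * r) (s * s)) (subst (λ w → q * (5 * (ζ + (ζ + ζ))) ≤ w ^ (s * s)) z≡
      (num-c q r m (s * s) z (subst (λ w → w * (3 * m) ≤ s * s) (sym z≡) entropy)
        (≤-trans (≤-trans (m≤m+n (15 * q * r) (4 * ℓ)) m≥) (<⇒≤ (n<2^n m))))) Eᶜ-rare
    where
    ζ : ℕ
    ζ = r * (2 ^ m * (2 ^ m * z ^ (s * s)))

  d-rare : ∀ d → q * ∑ Ω (Eᵈ d) ≤ total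
  d-rare d = Rare-scale (*-mono-≤ {1} {suc b₀} {1} (s≤s z≤n) (m^n>0 (D * r) T)) (subst (λ w → q * (n * (5 * (ℓ * z ^ T))) ≤ suc b₀ * w ^ T) z≡
      (num-d q n ℓ r D b₀ y T z z≡ (subst (λ w → w * y ≤ T) (sym z≡) (≤-trans (≤-reflexive (*-comm (D * r) y)) (m/n*n≤m T (D * r))))
        (subst (λ w → n ≤ 60 * (w * suc y)) (sym z≡) (≤-trans n≤60T (*-monoʳ-≤ 60 (<⇒≤ (div-upper T (D * r))))))
        (≤-trans (<⇒≤ (div-upper D (8 * q * q))) (≤-reflexive (*-comm (8 * q * q) (suc b₀)))) exponential)) (Eᵈ-rare d)

  e-rare : ∀ d → q * ∑ Ω (Eᵉ d) ≤ total
  e-rare d = Rare-scale (*-mono-≤ {1} {D} {1} (<⇒≤ 2≤D) (0<D^ (n ∸ 1 ∸ b₀)))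
    (subst (λ w → q * (n * (b₀ * (2 * x ^ (n ∸ 1 ∸ b₀)))) ≤ w * w ^ (n ∸ 1 ∸ b₀)) D≡
      (num-e q n (n ∸ 1) b₀ x upper′ (at-D (8 * q * q * b₀ ≤_) 8b₀≤D)
        (at-D (2 * b₀ ≤_) (≤-trans (*-monoʳ-≤ 2 (m≤m+n b₀ 2)) half-b₀)) (≤-trans (m≤m+n b₀ 2) b₀+2≤N))) (Eᵉ-rare d)

  f-rare : q * ∑ Ω Eᶠ ≤ total
  f-rare = Rare-scale (*-mono-≤ {1} {D ^ 2} {1} (0<D^ 2) (*-mono-≤ {1} {D ^ t} {1} (0<D^ t) (0<D^ t)))
    (subst (λ w → q * (n * (n * (n * (2 ^ 2 * (x ^ t * x ^ t))))) ≤ w ^ 2 * (w ^ t * w ^ t)) D≡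
      (num-f q n (n ∸ 1) (b₀ + 2) x t b+t upper′ (subst (λ w → 64 * q * q * q * n ≤ w * w) (sym D≡) (C*≤ C≥₂)) (at-D (2 * (b₀ + 2) ≤_) half-b₀))) Eᶠ-rare
    where
    t : ℕ
    t = n ∸ 3 ∸ b₀
    b+t : b₀ + 2 + t ≡ n ∸ 1
    b+t = trans (cong (b₀ + 2 +_) (trans (cong (_∸ b₀) (sym (∸-+-assoc n 1 2))) (trans (∸-+-assoc (n ∸ 1) 2 b₀) (cong (n ∸ 1 ∸_) (+-comm 2 b₀))))) (m+[n∸m]≡n b₀+2≤N)

  -- Nine terms: `Eᵃ`, `Eᶜ`, `Eᶠ`, and three for each direction.
  failure-rare : q * ∑ Ω failure ≤ 9 * total
  failure-rare = begin
    q * ∑ Ω failure ≡⟨ cong (q *_) (split Eᵃ (λ f → Eᶜ f + (Eᶠ f + (both-dirs fwd f + both-dirs bwd f))) (split Eᶜ _ (split Eᶠ _ (split (both-dirs fwd) (both-dirs bwd) refl)))) ⟩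
    q * (∑ Ω Eᵃ + (∑ Ω Eᶜ + (∑ Ω Eᶠ + (∑ Ω (both-dirs fwd) + ∑ Ω (both-dirs bwd)))))
      ≡⟨ solve 6 (λ q a b c d e → q :* (a :+ (b :+ (c :+ (d :+ e)))) := q :* a :+ (q :* b :+ (q :* c :+ (q :* d :+ q :* e)))) refl q (∑ Ω Eᵃ) (∑ Ω Eᶜ) (∑ Ω Eᶠ) (∑ Ω (both-dirs fwd)) (∑ Ω (both-dirs bwd)) ⟩
    q * ∑ Ω Eᵃ + (q * ∑ Ω Eᶜ + (q * ∑ Ω Eᶠ + (q * ∑ Ω (both-dirs fwd) + q * ∑ Ω (both-dirs bwd))))
      ≤⟨ +-mono-≤ a-rare (+-mono-≤ c-rare (+-mono-≤ f-rare (+-mono-≤ (dir fwd) (dir bwd)))) ⟩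
    total + (total + (total + (3 * total + 3 * total)))
      ≡⟨ solve 1 (λ t → t :+ (t :+ (t :+ (con 3 :* t :+ con 3 :* t))) := con 9 :* t) refl total ⟩
    9 * total ∎
    where
    open ≤-Reasoning
    split : ∀ F G {v} → ∑ Ω G ≡ v → ∑ Ω (λ f → F f + G f) ≡ ∑ Ω F + v
    split F G e = trans (∑-+ Ω F G) (cong (∑ Ω F +_) e)
    dir : ∀ d → q * ∑ Ω (both-dirs d) ≤ 3 * total
    dir d = begin
      q * ∑ Ω (both-dirs d) ≡⟨ cong (q *_) (split (Eᵇ d) (λ f → Eᵈ d f + Eᵉ d f) (∑-+ Ω (Eᵈ d) (Eᵉ d))) ⟩
      q * (∑ Ω (Eᵇ d) + (∑ Ω (Eᵈ d) + ∑ Ω (Eᵉ d)))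
        ≡⟨ solve 4 (λ q a b c → q :* (a :+ (b :+ c)) := q :* a :+ (q :* b :+ q :* c)) refl q (∑ Ω (Eᵇ d)) (∑ Ω (Eᵈ d)) (∑ Ω (Eᵉ d)) ⟩
      q * ∑ Ω (Eᵇ d) + (q * ∑ Ω (Eᵈ d) + q * ∑ Ω (Eᵉ d)) ≤⟨ +-mono-≤ (b-rare d) (+-mono-≤ (d-rare d) (e-rare d)) ⟩
      total + (total + total) ≡⟨ solve 1 (λ t → t :+ (t :+ t) := con 3 :* t) refl total ⟩
      3 * total ∎

  2≤n : 2 ≤ n
  2≤n = ≤-trans (s≤s (s≤s z≤n)) 8≤n

-- From failing matrices to the number of exceptional outcomes

module Conclusion (k r ℓ : ℕ) .{{ℓ≢0 : NonZero ℓ}} (1≤r : 1 ≤ r) (Π : Vec (Fin r) ℓ) (surj : ∀ c → ∃[ p ] lookup Π p ≡ c)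
  (n : ℕ) (large : Parameters.threshold (9 * (2 * suc k)) r ℓ ≤ n) where

  open Estimate (9 * (2 * suc k)) r ℓ (s≤s z≤n) 1≤r Π n large using (frame; failure-rare; 2≤n) public
  open Setup frame using (D; K; labels; length-labels; labels>0; Ω; total; total≡; failure; K≤DK)
  open Sampling {n} {r} {D * K}
  open Hitting frame using (bad-outcomes; bad-outcomes-few; complete) public

  private
    M a I e : ℕ
    M = D * K
    a = length labels
    I = length (increasing M N)
    e = length bad-outcomes

  -- Since M ≥ 2 N^2, (1 - N/M)^N ≥ 1/2: at least half of all label sequences on the arcs have no
  -- ties.
  many-labellings : M ^ N ≤ 2 * (N ! * I)
  many-labellings = begin
    M ^ N ≡⟨ cong (_^ N) (sym M∸N+N) ⟩
    (M ∸ N + N) ^ N ≤⟨ halving (M ∸ N) N N (subst (0 <_) (sym M∸N+N) (≤-trans (s≤s z≤n) K≤DK)) (subst (2 * (N * N) ≤_) (sym M∸N+N) 2NN≤M) ⟩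
    2 * (M ∸ N) ^ N ≤⟨ *-monoʳ-≤ 2 (falling-≥ M N) ⟩
    2 * falling M N ≡⟨ cong (2 *_) (sym (length-increasing M N)) ⟩
    2 * (N ! * I) ∎
    where
    open ≤-Reasoning
    2NN≤M : 2 * (N * N) ≤ M
    2NN≤M = ≤-trans (n≤1+n (2 * (N * N))) K≤DK
    N≤NN : ∀ j → j ≤ 2 * (j * j)
    N≤NN zero = z≤n
    N≤NN (suc j) = ≤-trans (m≤m*n (suc j) (suc j)) (m≤m+n _ _)
    M∸N+N : M ∸ N + N ≡ M
    M∸N+N = m∸n+n≡m (≤-trans (N≤NN N) 2NN≤M)

  few : 2 * suc k * ∑ Ω failure ≤ total
  few = *-cancelˡ-≤ 9 (≤-trans (≤-reflexive (sym (*-assoc 9 (2 * suc k) _))) failure-rare)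

  -- Of q = 9 * 2 * (k + 1), the 9 pays for the failure terms and the 2 for sequences with ties; the
  -- labels on the arcs and the loop entries cancel.
  count : suc k * e ≤ N ! * r ^ N
  count = *-cancelʳ-≤ _ _ (M ^ N * a ^ n) {{nz}} (begin
    suc k * e * (M ^ N * a ^ n) ≤⟨ *-monoʳ-≤ (suc k * e) (*-monoˡ-≤ (a ^ n) many-labellings) ⟩
    suc k * e * (2 * (N ! * I) * a ^ n)
      ≡⟨ solve 5 (λ k e F I A → k :* e :* (con 2 :* (F :* I) :* A) := F :* (con 2 :* k :* (e :* (I :* A)))) refl (suc k) e (N !) I (a ^ n) ⟩
    N ! * (2 * suc k * (e * (I * a ^ n))) ≤⟨ *-monoʳ-≤ (N !) (*-monoʳ-≤ (2 * suc k) bad-outcomes-few) ⟩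
    N ! * (2 * suc k * ∑ Ω failure) ≤⟨ *-monoʳ-≤ (N !) few ⟩
    N ! * total ≡⟨ cong (N ! *_) total-split ⟩
    N ! * (M ^ N * r ^ N * a ^ n) ≡⟨ solve 4 (λ F M R A → F :* (M :* R :* A) := F :* R :* (M :* A)) refl (N !) (M ^ N) (r ^ N) (a ^ n) ⟩
    N ! * r ^ N * (M ^ N * a ^ n) ∎)
    where
    open ≤-Reasoning
    n*n : ∀ n → n * n ≡ N′ n + n
    n*n zero = refl
    n*n (suc n) = trans (*-suc (suc n) n) (+-comm (suc n) (suc n * n))
    total-split : total ≡ M ^ N * r ^ N * a ^ n
    total-split = trans total≡ (trans (^-*-assoc a n n) (trans (cong (a ^_) (n*n n)) (trans (^-distribˡ-+-* a N n)
      (cong (_* a ^ n) (trans (cong (_^ N) length-labels) (^-distribʳ-* M r N))))))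
    0<M : 0 < M
    0<M = ≤-trans (s≤s z≤n) K≤DK
    nz : NonZero (M ^ N * a ^ n)
    nz = m*n≢0 (M ^ N) (a ^ n) {{m^n≢0 M N {{>-nonZero 0<M}}}} {{m^n≢0 a n {{>-nonZero labels>0}}}}

theorem4 : (r ℓ : ℕ) .{{_ : NonZero ℓ}} → 1 ≤ r → (Π : Vec (Fin r) ℓ) →
    (∀ (c : Fin r) → ∃[ p ] lookup Π p ≡ c) →
    ∀ (k : ℕ) → ∃[ n₀ ] ∀ (n : ℕ) → n₀ ≤ n → ℓ ∣ n →
    ∃[ L ] ((∀ (ω : Outcome n r) → Valid ω → ¬ HittingTimesEqual Π ω → ω ∈ L) ×
    k * length L ≤ (N′ n) ! * r ^ N′ n)
theorem4 r ℓ 1≤r Π surj k = Parameters.threshold (9 * (2 * suc k)) r ℓ , λ n large _ →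
  let open Conclusion k r ℓ 1≤r Π surj n large in
  bad-outcomes , complete surj 2≤n , ≤-trans (*-monoˡ-≤ (length bad-outcomes) (n≤1+n k)) count
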